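{- Let $0<1/n\ll 1/\ell\ll\varepsilon\ll\gamma\ll 1/r$, where $n,\ell,r\in\mathbb N$, and let $T\in\mathcal T_r$ for some $r\ge 3$. Suppose that $G$ is a digraph on $n$ vertices with $\delta^0(G)\ge (1-1/r-\varepsilon)n$. Then at least one of the following holds: (i) $G$ contains a $T$-packing that covers all but at most $\ell$ vertices; (ii) $G$ contains a $\gamma$-independent set of size at least $n/r$.
   Context: Hierarchy notation: $0<a\ll b\ll c$ means the constants are chosen from right to left, each sufficiently small in terms of those to its right (there are increasing functions $f,g$ such that the statement holds whenever $b\le f(c)$ and $a\le g(b)$); longer hierarchies are analogous. A digraph has no loops and at most one edge in each direction between any two vertices; $\delta^0(G)$ is the minimum of the minimum out- and indegree. $\mathcal T_r$ is the set of tournaments on $r$ vertices. A $T$-packing is a collection of vertex-disjoint (not necessarily induced) copies of $T$ in $G$. For $G$ on $n$ vertices, $S\subseteq V(G)$ is $\gamma$-independent if $G[S]$ has at most $\gamma n^2$ edges. -}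

module Defs where

open import Data.Nat using (ℕ; zero; suc; _+_; _*_; _≤_)
open import Data.Bool using (Bool; true; false; if_then_else_; _∧_)
open import Data.Fin using (Fin; zero; suc)
open import Data.Product using (Σ; _×_; _,_)
open import Data.Integer using (+_)
open import Data.Rational using (ℚ; _/_; 0ℚ; 1ℚ)
import Data.Rational as Q
open import Relation.Binary.PropositionalEquality using (_≡_; _≢_)
open import Relation.Nullary using (¬_)

toℚ : ℕ → ℚ
toℚ k = + k / 1

-- 1/r (only used for r ≥ 3; value at 0 is irrelevant)
inv : ℕ → ℚ
inv zero = 0ℚ
inv (suc k) = + 1 / suc k

count : {n : ℕ} → (Fin n → Bool) → ℕ
count {zero} P = 0
count {suc n} P = (if P zero then 1 else 0) + count (λ i → P (suc i))

-- A digraph on vertex set Fin n: adjacency u → v given by E u v ≡ true.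
-- Edges in both directions between two vertices are allowed (at most one each way);
-- loops are forbidden.
Digraph : ℕ → Set
Digraph n = Fin n → Fin n → Bool

Loopless : {n : ℕ} → Digraph n → Set
Loopless E = ∀ v → E v v ≡ false

IsTournament : {r : ℕ} → Digraph r → Set
IsTournament T = Loopless T ×
  (∀ i j → i ≢ j → (T i j ≡ true × T j i ≡ false) Data.Sum.⊎ (T i j ≡ false × T j i ≡ true))
  where import Data.Sum

outdeg indeg : {n : ℕ} → Digraph n → Fin n → ℕ
outdeg E v = count (λ w → E v w)
indeg E v = count (λ w → E w v)

MinSemideg≥ : {n : ℕ} → Digraph n → ℚ → Set
MinSemideg≥ E d = ∀ v → (d Q.≤ toℚ (outdeg E v)) × (d Q.≤ toℚ (indeg E v))

sumF : {n : ℕ} → (Fin n → ℕ) → ℕ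
sumF {zero} f = 0
sumF {suc n} f = f zero + sumF (λ i → f (suc i))

edgesIn : {n : ℕ} → Digraph n → (Fin n → Bool) → ℕ
edgesIn E S = sumF (λ u → count (λ v → S u ∧ (S v ∧ E u v)))

γIndependent : {n : ℕ} → Digraph n → ℚ → (Fin n → Bool) → Set
γIndependent {n} E γ S = toℚ (edgesIn E S) Q.≤ γ Q.* toℚ (n * n)

IsTPacking : {r n : ℕ} → Digraph r → Digraph n → (k : ℕ) → (Fin k → Fin r → Fin n) → Set
IsTPacking T E k φ =
  (∀ a b i j → φ a i ≡ φ b j → (a ≡ b × i ≡ j)) ×
  (∀ a i j → T i j ≡ true → E (φ a i) (φ a j) ≡ true)

-- G has a T-packing covering all but at most ℓ vertices (it covers exactly k·r vertices)
HasAlmostPerfectPacking : {r n : ℕ} → Digraph r → Digraph n → ℕ → Set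
HasAlmostPerfectPacking {r} {n} T E ℓ =
  Σ ℕ λ k → Σ (Fin k → Fin r → Fin n) λ φ → IsTPacking T E k φ × (n ≤ k * r + ℓ)

HasIndepSet : {n : ℕ} → Digraph n → ℚ → ℕ → Set
HasIndepSet {n} E γ r = Σ (Fin n → Bool) λ S → γIndependent E γ S × (n ≤ r * count S)

{-# OPTIONS --safe #-}
-- Start with a packing leaving many vertices uncovered, group these into phantom classes of r vertices and regard the copies
-- in the packing as further classes. Sample a bounded number of classes, one of them chosen among the phantoms. By Chernoff
-- bounds the sampled digraph R usually inherits the degree condition and the absence of large independent sets; for
-- the latter one only tracks the pairwise overlaps of missed neighbourhoods, since a sparse set of size about n/r is
-- essentially the missed neighbourhood of any of its vertices, so if one exists in R, then G has one as well.
--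
-- For every weighting w of R there is a copy of T whose weight is at most r times the average: either the greedy copy
-- works, or one in which an edge inside the lightest j/r of the vertices saves weight. Taking as w the current load and
-- repeating (a potential argument with the sum of the squared loads) gives a family of copies in R covering
-- all vertices almost equally often. The adjacency of R occurs in a positive proportion of the samples, hence on a box of
-- many clones of each class; there the family becomes a packing of disjoint copies, which has more members than
-- the packing classes it uses. Iterating leaves a bounded number of vertices.
module Submission where

open import Defs
open import Data.Nat using (s≤s⁻¹; nonZero; >-nonZero; ℕ; zero; suc; _+_; _*_; _∸_; _^_; _≤_; _<_; z≤n; s≤s; _≤?_; _<?_; _⊓_; _/_)
open import Data.Nat.Properties hiding (_≟_; suc-injective)
open import Data.Nat.Tactic.RingSolver using (solve-∀)
open import Data.Bool using (Bool; true; false; if_then_else_; _∧_; _∨_; not)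
open import Data.Bool.Properties using (∧-zeroʳ) renaming (_≟_ to _≟ᵇ_)
open import Data.Fin using (Fin; zero; suc; toℕ; _↑ˡ_; _↑ʳ_; splitAt; join; inject≤; combine; remQuot; fromℕ<)
open import Data.Fin.Properties using (_≟_; any?; toℕ<n; combine-remQuot; remQuot-combine; splitAt-↑ˡ; splitAt-↑ʳ; join-splitAt; ↑ˡ-injective; ↑ʳ-injective; toℕ-fromℕ<; suc-injective; inject≤-injective)
open import Data.Nat.DivMod using (m/n*n≤m; m%n<n; m≡m%n+[m/n]*n)
open import Data.Vec using (Vec; []; _∷_; lookup; _[_]≔_; tabulate)
open import Data.Vec.Properties using (lookup∘update′; lookup∘tabulate)
open import Data.Product using (Σ; ∃; _×_; _,_; proj₁; proj₂)
open import Data.Sum using (_⊎_; inj₁; inj₂)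
open import Data.Empty using (⊥; ⊥-elim)
open import Function using (_∘_; id; case_of_)
open import Relation.Nullary using (¬_; Dec; yes; no)
open import Relation.Nullary.Decidable using (⌊_⌋; _×-dec_)
open import Relation.Binary.PropositionalEquality using (_≡_; _≢_; refl; sym; trans; cong; cong₂; subst; subst₂; module ≡-Reasoning)
open import Data.Rational using (ℚ; 0ℚ; 1ℚ; mkℚ; toℚᵘ; NonNegative; nonNegative)
import Data.Rational as Q
import Data.Rational.Properties as QP
import Data.Rational.Unnormalised as U
import Data.Rational.Unnormalised.Properties as UP
import Data.Integer as Z
import Data.Integer.Properties as ZP
open import Data.Rational.Solver using (module +-*-Solver)

-- Why light copies exist: the semidegree lies slightly below `(1 - 1/r) n`, so the greedy copy may
-- exceed the average weight by a small error. If it does, the weights hardly rise just after the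
-- positions j/r. If the copies that use an edge among the light vertices are too heavy as well,
-- then each greedy threshold is at most about r times the previous one. The first threshold is 0
-- after a shift, so every threshold, even the last one, is a tiny fraction of the last one, which
-- is absurd.
--
-- Why an augmentation gains: with N sampled classes and `t = r N^4` copies, the loads have mean
-- `r N^3` and exceed it by at most `r N^2`. So `D = r N^3 + r N^2` clones per class suffice. The N
-- - 1 classes taken from the packing cost at most `(N - 1) D = r N^4 - r N^2` old copies, fewer
-- than t. The phantom clones cost nothing, and their 1/N share outweighs the fluctuation of the
-- loads.
--
-- Why the remainder is bounded: N, D and the density of the most frequent adjacency pattern depend
-- only on r and on the sparsity wanted, so a bounded number of phantom classes already contains the
-- clones needed.

bit : Bool → ℕ
bit b = if b then 1 else 0

bit≤1 : ∀ b → bit b ≤ 1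
bit≤1 true = s≤s z≤n
bit≤1 false = z≤n

bit-pos : ∀ {b} → 0 < bit b → b ≡ true
bit-pos {true} _ = refl

bit-≤ : ∀ b {c} → (b ≡ true → 1 ≤ c) → bit b ≤ c
bit-≤ true h = h refl
bit-≤ false h = z≤n

true≢false : ∀ {b} → b ≡ true → b ≡ false → ⊥
true≢false refl ()

∧-true⁻ : ∀ a {b} → a ∧ b ≡ true → a ≡ true × b ≡ true
∧-true⁻ true e = refl , e

∧-true⁺ : ∀ {a b} → a ≡ true → b ≡ true → a ∧ b ≡ true
∧-true⁺ refl refl = refl

∨-true⁻ : ∀ a {b} → a ∨ b ≡ true → a ≡ true ⊎ b ≡ true
∨-true⁻ true _ = inj₁ refl
∨-true⁻ false e = inj₂ e

∨-false⁻ : ∀ a {b} → a ∨ b ≡ false → a ≡ false × b ≡ false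
∨-false⁻ false e = refl , e

not-true⁻ : ∀ {a} → not a ≡ true → a ≡ false
not-true⁻ {false} _ = refl

not-true⁺ : ∀ {a} → a ≡ false → not a ≡ true
not-true⁺ refl = refl

bool-split : ∀ b → b ≡ true ⊎ b ≡ false
bool-split true = inj₁ refl
bool-split false = inj₂ refl

dec-true : ∀ {A : Set} (d : Dec A) → A → ⌊ d ⌋ ≡ true
dec-true (yes _) _ = refl
dec-true (no ¬a) a = ⊥-elim (¬a a)

dec-false : ∀ {A : Set} (d : Dec A) → ¬ A → ⌊ d ⌋ ≡ false
dec-false (yes a) ¬a = ⊥-elim (¬a a)
dec-false (no _) _ = refl

dec-true⁻ : ∀ {A : Set} (d : Dec A) → ⌊ d ⌋ ≡ true → A
dec-true⁻ (yes a) _ = a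

dec-false⁻ : ∀ {A : Set} (d : Dec A) → ⌊ d ⌋ ≡ false → ¬ A
dec-false⁻ (no ¬a) _ = ¬a

infix 4 _==_
_==_ : ∀ {n} → Fin n → Fin n → Bool
i == j = ⌊ i ≟ j ⌋

==-refl : ∀ {n} (i : Fin n) → (i == i) ≡ true
==-refl i = dec-true (i ≟ i) refl

-- Finite sums

sumF-cong : ∀ {n} {f g : Fin n → ℕ} → (∀ i → f i ≡ g i) → sumF f ≡ sumF g
sumF-cong {zero} h = refl
sumF-cong {suc n} h = cong₂ _+_ (h zero) (sumF-cong (h ∘ suc))

sumF-mono : ∀ {n} {f g : Fin n → ℕ} → (∀ i → f i ≤ g i) → sumF f ≤ sumF g
sumF-mono {zero} h = z≤n
sumF-mono {suc n} h = +-mono-≤ (h zero) (sumF-mono (h ∘ suc))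

+-interchange : ∀ a b c d → (a + b) + (c + d) ≡ (a + c) + (b + d)
+-interchange = solve-∀

sumF-+ : ∀ {n} (f g : Fin n → ℕ) → sumF (λ i → f i + g i) ≡ sumF f + sumF g
sumF-+ {zero} f g = refl
sumF-+ {suc n} f g rewrite sumF-+ (f ∘ suc) (g ∘ suc) = +-interchange (f zero) (g zero) _ _

sumF-* : ∀ {n} c (f : Fin n → ℕ) → sumF (λ i → c * f i) ≡ c * sumF f
sumF-* {zero} c f = sym (*-zeroʳ c)
sumF-* {suc n} c f rewrite sumF-* c (f ∘ suc) = sym (*-distribˡ-+ c (f zero) _)

sumF-const : ∀ n c → sumF {n} (λ _ → c) ≡ n * c
sumF-const zero c = refl
sumF-const (suc n) c = cong (c +_) (sumF-const n c)

sumF-0 : ∀ {n} {f : Fin n → ℕ} → (∀ i → f i ≡ 0) → sumF f ≡ 0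
sumF-0 {n} h = trans (sumF-cong h) (trans (sumF-const n 0) (*-zeroʳ n))

sumF-≤const : ∀ {n c} {f : Fin n → ℕ} → (∀ i → f i ≤ c) → sumF f ≤ n * c
sumF-≤const {n} {c} h = ≤-trans (sumF-mono h) (≤-reflexive (sumF-const n c))

sumF-swap : ∀ {m n} (f : Fin m → Fin n → ℕ) →
  sumF (λ i → sumF (λ j → f i j)) ≡ sumF (λ j → sumF (λ i → f i j))
sumF-swap {zero} {n} f = sym (trans (sumF-const n 0) (*-zeroʳ n))
sumF-swap {suc m} f rewrite sumF-swap (f ∘ suc) = sym (sumF-+ (f zero) _)

term≤sumF : ∀ {n} (f : Fin n → ℕ) i → f i ≤ sumF f
term≤sumF f zero = m≤m+n _ _
term≤sumF f (suc i) = ≤-trans (term≤sumF (f ∘ suc) i) (m≤n+m _ _)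

sumF-pos : ∀ {n} (f : Fin n → ℕ) → 0 < sumF f → ∃ λ i → 0 < f i
sumF-pos {suc n} f h with f zero in eq
... | suc c = zero , subst (0 <_) (sym eq) (s≤s z≤n)
... | zero with sumF-pos (f ∘ suc) h
...   | i , p = suc i , p

sumF-average : ∀ {n} (f : Fin (suc n) → ℕ) → ∃ λ i → sumF f ≤ suc n * f i
sumF-average {zero} f = zero , ≤-refl
sumF-average {suc n} f with sumF-average (f ∘ suc)
... | i , p with ≤-total (f zero) (f (suc i))
...   | inj₁ q = suc i , +-mono-≤ q p
...   | inj₂ q = zero , +-monoʳ-≤ (f zero) (≤-trans p (*-monoʳ-≤ (suc n) q))

sumF-least : ∀ {n} (f g : Fin n → ℕ) → sumF f < sumF g → ∃ λ i → f i < g i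
sumF-least {suc n} f g h with f zero <? g zero
... | yes p = zero , p
... | no ¬p with sumF-least (f ∘ suc) (g ∘ suc)
    (≰⇒> λ q → <⇒≱ h (+-mono-≤ (≮⇒≥ ¬p) q))
...   | i , p = suc i , p

sumF-δ : ∀ {n} (j : Fin n) (f : Fin n → ℕ) → sumF (λ i → bit (i == j) * f i) ≡ f j
sumF-δ {suc n} zero f = trans (cong₂ _+_ (+-identityʳ _) (sumF-0 {n} λ i → refl)) (+-identityʳ _)
sumF-δ {suc n} (suc j) f = trans (sumF-cong {n} λ i → cong (λ b → bit b * f (suc i)) (lem i)) (sumF-δ j (f ∘ suc))
  where
  lem : ∀ i → (suc i == suc j) ≡ (i == j)
  lem i with bool-split (i == j)
  ... | inj₁ p = trans (dec-true (suc i ≟ suc j) (cong suc (dec-true⁻ (i ≟ j) p))) (sym p)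
  ... | inj₂ p = trans (dec-false (suc i ≟ suc j) (dec-false⁻ (i ≟ j) p ∘ suc-injective)) (sym p)

sumF-δ1 : ∀ {n} (j : Fin n) → sumF (λ i → bit (i == j)) ≡ 1
sumF-δ1 {n} j = trans (sumF-cong {n} λ i → sym (*-identityʳ _)) (sumF-δ j (λ _ → 1))

sumF-++ : ∀ m {n} (f : Fin (m + n) → ℕ) → sumF f ≡ sumF (λ i → f (i ↑ˡ n)) + sumF (λ j → f (m ↑ʳ j))
sumF-++ zero f = refl
sumF-++ (suc m) f rewrite sumF-++ m (f ∘ suc) = sym (+-assoc (f zero) _ _)

sumF-combine : ∀ m {n} (f : Fin (m * n) → ℕ) → sumF f ≡ sumF {m} (λ i → sumF {n} (λ j → f (combine i j)))
sumF-combine zero f = refl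
sumF-combine (suc m) {n} f = trans (sumF-++ n {m * n} f) (cong (sumF (λ j → f (j ↑ˡ (m * n))) +_) (sumF-combine m {n} _))

sumF-atMostOne : ∀ {n} (P : Fin n → Bool) → (∀ i j → P i ≡ true → P j ≡ true → i ≡ j) → sumF (λ i → bit (P i)) ≤ 1
sumF-atMostOne {zero} P h = z≤n
sumF-atMostOne {suc n} P h with P zero in eq
... | false = sumF-atMostOne (P ∘ suc) λ i j p q → suc-injective (h _ _ p q)
... | true = s≤s (≤-reflexive (sumF-0 λ i → lem i))
  where
  lem : ∀ i → bit (P (suc i)) ≡ 0
  lem i with P (suc i) in e
  ... | false = refl
  ... | true with h zero (suc i) eq e
  ...   | ()

-- Cardinalities of Boolean predicates

count≡sumF : ∀ {n} (P : Fin n → Bool) → count P ≡ sumF (λ i → bit (P i))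
count≡sumF {zero} P = refl
count≡sumF {suc n} P = cong (bit (P zero) +_) (count≡sumF (P ∘ suc))

count-≤-sumF : ∀ {n} {P : Fin n → Bool} {f : Fin n → ℕ} → (∀ i → P i ≡ true → 1 ≤ f i) → count P ≤ sumF f
count-≤-sumF {P = P} h = ≤-trans (≤-reflexive (count≡sumF P)) (sumF-mono λ i → bit-≤ (P i) (h i))

bit-mono : ∀ {a b} → (a ≡ true → b ≡ true) → bit a ≤ bit b
bit-mono {false} h = z≤n
bit-mono {true} h rewrite h refl = ≤-refl

count-mono : ∀ {n} {P Q : Fin n → Bool} → (∀ i → P i ≡ true → Q i ≡ true) → count P ≤ count Q
count-mono {P = P} {Q} h = subst₂ _≤_ (sym (count≡sumF P)) (sym (count≡sumF Q)) (sumF-mono λ i → bit-mono (h i))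

count-≤n : ∀ {n} (P : Fin n → Bool) → count P ≤ n
count-≤n {n} P = subst₂ _≤_ (sym (count≡sumF P)) (*-identityʳ n) (sumF-≤const λ i → bit≤1 (P i))

count-cover : ∀ {n} {P Q R : Fin n → Bool} → (∀ i → P i ≡ true → Q i ≡ true ⊎ R i ≡ true) → count P ≤ count Q + count R
count-cover {n} {P = P} {Q} {R} h = subst₂ _≤_ (sym (count≡sumF P))
  (trans (sumF-+ {n} _ _) (cong₂ _+_ (sym (count≡sumF Q)) (sym (count≡sumF R))))
  (sumF-mono λ i → bit-≤ (P i) (λ p → lem i (h i p)))
  where
  lem : ∀ i → Q i ≡ true ⊎ R i ≡ true → 1 ≤ bit (Q i) + bit (R i)
  lem i (inj₁ q) rewrite q = s≤s z≤n
  lem i (inj₂ q) rewrite q = m≤n+m 1 _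

count-disjoint : ∀ {n} {P Q R : Fin n → Bool} → (∀ i → P i ≡ true → Q i ≡ true → ⊥) →
  (∀ i → P i ≡ true → R i ≡ true) → (∀ i → Q i ≡ true → R i ≡ true) → count P + count Q ≤ count R
count-disjoint {n} {P = P} {Q} {R} d p q = subst₂ _≤_
  (trans (sumF-+ {n} _ _) (cong₂ _+_ (sym (count≡sumF P)) (sym (count≡sumF Q)))) (sym (count≡sumF R))
  (sumF-mono λ i → lem i)
  where
  lem : ∀ i → bit (P i) + bit (Q i) ≤ bit (R i)
  lem i with P i in ep | Q i in eq
  ... | false | false = z≤n
  ... | true | true = ⊥-elim (d i ep eq)
  ... | true | false rewrite p i ep = ≤-refl
  ... | false | true rewrite q i eq = ≤-refl

count-not : ∀ {n} (P : Fin n → Bool) → count P + count (not ∘ P) ≡ n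
count-not {zero} P = refl
count-not {suc n} P with P zero | count-not (P ∘ suc)
... | true | e = cong suc e
... | false | e = trans (+-suc _ _) (cong suc e)

count-pos : ∀ {n} (P : Fin n → Bool) → 0 < count P → ∃ λ i → P i ≡ true
count-pos P h with sumF-pos (λ i → bit (P i)) (subst (0 <_) (count≡sumF P) h)
... | i , p = i , bit-pos p

count-∖ : ∀ {n} (P Q : Fin n → Bool) → count P ≤ count (λ i → P i ∧ not (Q i)) + count Q
count-∖ P Q = count-cover λ i p → lem i p
  where
  lem : ∀ i → P i ≡ true → P i ∧ not (Q i) ≡ true ⊎ Q i ≡ true
  lem i p with Q i
  ... | true = inj₂ refl
  ... | false = inj₁ (∧-true⁺ p refl)

count-true : ∀ n → count {n} (λ _ → true) ≡ n
count-true zero = refl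
count-true (suc n) = cong suc (count-true n)

enumerate : ∀ {n} (P : Fin n → Bool) → Σ (Fin (count P) → Fin n) λ f →
  (∀ j → P (f j) ≡ true) × (∀ i j → f i ≡ f j → i ≡ j)
enumerate {zero} P = (λ ()) , (λ ()) , λ ()
enumerate {suc n} P with P zero in eq | enumerate (P ∘ suc)
... | false | f , p , inj = suc ∘ f , p , λ i j e → inj i j (suc-injective e)
... | true | f , p , inj = g , q , inj′
  where
  g : Fin (suc (count (P ∘ suc))) → Fin (suc n)
  g zero = zero
  g (suc j) = suc (f j)
  q : ∀ j → P (g j) ≡ true
  q zero = eq
  q (suc j) = p j
  inj′ : ∀ i j → g i ≡ g j → i ≡ j
  inj′ zero zero _ = refl
  inj′ (suc i) (suc j) e = cong suc (inj i j (suc-injective e))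

-- Double counting of the pairs with `v == f i`: by injectivity each `v` belongs to at most one `i`.
sumF-image : ∀ {a n} (f : Fin a → Fin n) (Q : Fin n → Bool) → (∀ i j → f i ≡ f j → i ≡ j) →
  sumF (λ i → bit (Q (f i))) ≤ count Q
sumF-image {a} {n} f Q inj = begin
  sumF (λ i → bit (Q (f i)))
    ≡⟨ sumF-cong (λ i → sym (sumF-δ (f i) (bit ∘ Q))) ⟩
  sumF (λ i → sumF (λ v → bit (v == f i) * bit (Q v)))
    ≡⟨ sumF-swap {a} {n} _ ⟩
  sumF (λ v → sumF (λ i → bit (v == f i) * bit (Q v)))
    ≡⟨ sumF-cong (λ v → trans (sumF-cong {a} λ i → *-comm (bit (v == f i)) _) (sumF-* {a} (bit (Q v)) _)) ⟩
  sumF (λ v → bit (Q v) * sumF (λ i → bit (v == f i)))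
    ≤⟨ sumF-mono (λ v → ≤-trans (*-monoʳ-≤ (bit (Q v)) (sumF-atMostOne (λ i → v == f i)
         (λ i j p q → inj i j (trans (sym (dec-true⁻ (v ≟ f i) p)) (dec-true⁻ (v ≟ f j) q)))))
         (≤-reflexive (*-identityʳ _))) ⟩
  sumF (λ v → bit (Q v))
    ≡⟨ sym (count≡sumF Q) ⟩
  count Q ∎
  where open ≤-Reasoning

-- The opposite double count: each `i` accounts for exactly one `v`, and every `v` in `Q` is
-- accounted for.
count-covered : ∀ {a n} (f : Fin a → Fin n) (Q : Fin n → Bool) → (∀ v → Q v ≡ true → ∃ λ i → f i ≡ v) → count Q ≤ a
count-covered {a} {n} f Q h = begin
  count Q ≤⟨ count-≤-sumF (λ v q → lem v (h v q)) ⟩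
  sumF (λ v → sumF (λ i → bit (v == f i))) ≡⟨ sumF-swap {n} {a} _ ⟩
  sumF (λ i → sumF (λ v → bit (v == f i))) ≡⟨ sumF-cong (λ i → sumF-δ1 (f i)) ⟩
  sumF {a} (λ i → 1) ≡⟨ sumF-const a 1 ⟩
  a * 1 ≡⟨ *-identityʳ a ⟩
  a ∎
  where
  open ≤-Reasoning
  lem : ∀ v → (∃ λ i → f i ≡ v) → 1 ≤ sumF (λ i → bit (v == f i))
  lem v (i , refl) = ≤-trans (≤-reflexive (cong bit (sym (==-refl (f i))))) (term≤sumF (λ j → bit (f i == f j)) i)

-- Embedding tournaments

Copy : ∀ {r n} → Digraph r → Digraph n → (Fin r → Fin n) → Set
Copy T E C = ∀ i j → T i j ≡ true → E (C i) (C j) ≡ true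

Oriented : ∀ {r} → Digraph r → Set
Oriented T = ∀ i j → T i j ≡ true → T j i ≡ true → ⊥

tail : ∀ {r} → Digraph (suc r) → Digraph r
tail T i j = T (suc i) (suc j)

consF : ∀ {r} {A : Set} → A → (Fin r → A) → Fin (suc r) → A
consF v C zero = v
consF v C (suc ρ) = C ρ

-- Only one direction is ever tested: where the edge from `zero` to `suc ρ` is absent, the reverse
-- one is demanded, as a tournament requires.
fits : ∀ {r n} → Digraph (suc r) → Digraph n → Fin n → Fin r → Fin n → Bool
fits T E v ρ x = if T zero (suc ρ) then E v x else E x v

consF-copy : ∀ {r n} {T : Digraph (suc r)} (E : Digraph n) → Oriented T → ∀ v C →
  (∀ ρ → fits T E v ρ (C ρ) ≡ true) → Copy (tail T) E C → Copy T E (consF v C)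
consF-copy {T = T} E o v C f c zero zero p = ⊥-elim (o zero zero p p)
consF-copy {T = T} E o v C f c zero (suc j) p with T zero (suc j) | f j
... | true | q = q
consF-copy {T = T} E o v C f c (suc i) zero p with T zero (suc i) in eq | f i
... | false | q = q
... | true | _ = ⊥-elim (o zero (suc i) eq p)
consF-copy E o v C f c (suc i) (suc j) p = c i j p

-- Degrees are recorded as numbers of non-neighbours, which in a loopless digraph include the vertex
-- itself, because these are what an embedded vertex removes from the candidate sets.
record MissAtMost {n : ℕ} (E : Digraph n) (m : ℕ) : Set where
  field
    out : ∀ v → count (λ w → not (E v w)) ≤ m
    inn : ∀ v → count (λ w → not (E w v)) ≤ m

fits-miss : ∀ {r n m} {T : Digraph (suc r)} {E : Digraph n} → MissAtMost E m → ∀ v ρ →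
  count (λ x → not (fits T E v ρ x)) ≤ m
fits-miss {T = T} h v ρ with T zero (suc ρ)
... | true = MissAtMost.out h v
... | false = MissAtMost.inn h v

restrict : ∀ {n m k} (U N : Fin n → Bool) → count (λ x → not (N x)) ≤ m → m + k ≤ count U → k ≤ count (λ x → U x ∧ N x)
restrict {n} {m} {k} U N h le = +-cancelˡ-≤ m k _ (≤-trans le (≤-trans
  (count-cover {P = U} {Q = λ x → not (N x)} {R = λ x → U x ∧ N x} λ x u → split x u)
  (+-monoˡ-≤ _ h)))
  where
  split : ∀ x → U x ≡ true → not (N x) ≡ true ⊎ U x ∧ N x ≡ true
  split x u with N x
  ... | true = inj₂ (∧-true⁺ u refl)
  ... | false = inj₁ refl

EmbedsIn : ∀ {r n} → Digraph r → Digraph n → (Fin r → Fin n → Bool) → Set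
EmbedsIn T E U = ∃ λ C → Copy T E C × (∀ ρ → U ρ (C ρ) ≡ true)

consF-embeds : ∀ {r n} {T : Digraph (suc r)} (E : Digraph n) → Oriented T → (U : Fin (suc r) → Fin n → Bool) → ∀ v →
  U zero v ≡ true → EmbedsIn (tail T) E (λ ρ x → U (suc ρ) x ∧ fits T E v ρ x) → EmbedsIn T E U
consF-embeds {T = T} E o U v uv (C , c , u) = consF v C , consF-copy E o v C (λ ρ → proj₂ (∧-true⁻ (U (suc ρ) (C ρ)) (u ρ))) c , mem
  where
  mem : ∀ ρ → U ρ (consF v C ρ) ≡ true
  mem zero = uv
  mem (suc ρ) = proj₁ (∧-true⁻ (U (suc ρ) (C ρ)) (u ρ))

tail-oriented : ∀ {r} {T : Digraph (suc r)} → Oriented T → Oriented (tail T)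
tail-oriented o i j = o (suc i) (suc j)

restrict-fits : ∀ {r n m k} {T : Digraph (suc r)} {E : Digraph n} → MissAtMost E m → ∀ v ρ (U : Fin n → Bool) →
  m + k ≤ count U → k ≤ count (λ x → U x ∧ fits T E v ρ x)
restrict-fits {T = T} {E} h v ρ U = restrict U (fits T E v ρ) (fits-miss {T = T} h v ρ)

-- Each embedded vertex shrinks the later candidate sets by at most `m`, and role `ρ` is shrunk
-- `toℕ ρ` times before its turn.
greedy : ∀ {r n m} {T : Digraph r} {E : Digraph n} → Oriented T → MissAtMost E m → (U : Fin r → Fin n → Bool) →
  (∀ ρ → toℕ ρ * m < count (U ρ)) → EmbedsIn T E U
greedy {zero} o h U c = (λ ()) , (λ ()) , (λ ())
greedy {suc r} {n} {m} {T} {E} o h U c with count-pos (U zero) (c zero)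
... | v , uv = consF-embeds E o U v uv (greedy (tail-oriented o) h _ λ ρ →
      restrict-fits {T = T} h v ρ (U (suc ρ)) (≤-trans (≤-reflexive (+-suc m _)) (c (suc ρ))))

record NearlyComplete {n : ℕ} (E : Digraph n) (d K : ℕ) (Z : Fin n → Bool) : Set where
  field
    large : 2 * d * K < count Z
    miss : ∀ a → Z a ≡ true → count (λ z → Z z ∧ not (E a z)) ≤ d

-- At most `d |Z|` ordered pairs inside `Z` are missing, so some vertex receives at most `d` of
-- them. This is how a bound on out-misses alone controls the in-misses.
low-indegree-miss : ∀ {n d} {E : Digraph n} (Z : Fin n → Bool) → 0 < count Z →
  (∀ a → Z a ≡ true → count (λ z → Z z ∧ not (E a z)) ≤ d) →
  ∃ λ z → Z z ≡ true × count (λ x → Z x ∧ not (E x z)) ≤ d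
low-indegree-miss {n} {d} {E} Z pos miss = proj₁ least , lemma (Z (proj₁ least)) refl (proj₂ least)
  where
  mis : Fin n → Fin n → Bool
  mis x z = Z x ∧ not (E x z)
  f : Fin n → ℕ
  f z = bit (Z z) * count (λ x → mis x z)
  total : sumF f ≤ d * count Z
  total = begin
    sumF (λ z → bit (Z z) * count (λ x → mis x z))
      ≡⟨ sumF-cong (λ z → trans (cong (bit (Z z) *_) (count≡sumF (λ x → mis x z))) (sym (sumF-* (bit (Z z)) (λ x → bit (mis x z))))) ⟩
    sumF (λ z → sumF (λ x → bit (Z z) * bit (mis x z)))
      ≡⟨ sumF-swap {n} {n} _ ⟩
    sumF (λ x → sumF (λ z → bit (Z z) * bit (mis x z)))
      ≤⟨ sumF-mono (λ x → row x (Z x) refl) ⟩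
    sumF (λ x → d * bit (Z x))
      ≡⟨ sumF-* {n} d _ ⟩
    d * sumF (λ x → bit (Z x))
      ≡⟨ cong (d *_) (sym (count≡sumF Z)) ⟩
    d * count Z ∎
    where
    open ≤-Reasoning
    same : ∀ a b c → bit a * bit (b ∧ c) ≡ bit (b ∧ (a ∧ c))
    same true b c = +-identityʳ _
    same false true c = refl
    same false false c = refl
    row : ∀ x b → Z x ≡ b → sumF (λ z → bit (Z z) * bit (mis x z)) ≤ d * bit (Z x)
    row x false e = ≤-trans (≤-reflexive (sumF-0 λ z → trans (cong (λ b → bit (Z z) * bit (b ∧ not (E x z))) e) (*-zeroʳ (bit (Z z))))) z≤n
    row x true e = begin
      sumF (λ z → bit (Z z) * bit (mis x z)) ≡⟨ sumF-cong (λ z → trans (same (Z z) (Z x) (not (E x z))) (cong (λ b → bit (b ∧ (Z z ∧ not (E x z)))) e)) ⟩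
      sumF (λ z → bit (Z z ∧ not (E x z))) ≡⟨ sym (count≡sumF (λ z → Z z ∧ not (E x z))) ⟩
      count (λ z → Z z ∧ not (E x z)) ≤⟨ miss x e ⟩
      d ≡⟨ sym (*-identityʳ d) ⟩
      d * 1 ≡⟨ cong (λ b → d * bit b) (sym e) ⟩
      d * bit (Z x) ∎
  -- The factor `suc d` in place of `d` makes the comparison strict, and `bit (Z z)` forces the
  -- index found into `Z`.
  least : ∃ λ z → f z < suc d * bit (Z z)
  least = sumF-least f (λ z → suc d * bit (Z z)) (≤-trans (s≤s total) (≤-trans
    (+-monoˡ-≤ (d * count Z) pos)
    (≤-reflexive (sym (trans (sumF-* {n} (suc d) _) (cong (suc d *_) (sym (count≡sumF Z))))))))
  lemma : ∀ {z} b → Z z ≡ b → f z < suc d * bit (Z z) → Z z ≡ true × count (λ x → mis x z) ≤ d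
  lemma {z} true e lt rewrite e = refl , s≤s⁻¹ (subst₂ _<_ (+-identityʳ _) (*-identityʳ (suc d)) lt)
  lemma {z} false e lt rewrite e = ⊥-elim (n≮0 (subst (0 <_) (*-zeroʳ d) lt))

-- A vertex with at most `d` misses in each direction is embedded next. Restricting to its common
-- in- and outneighbours costs at most `2 d` vertices and makes every remaining vertex fit, whatever
-- the direction of the edge in `T`.
dense-embeds : ∀ {r n d} {T : Digraph r} {E : Digraph n} → Oriented T → (Z : Fin n → Bool) → NearlyComplete E d r Z →
  EmbedsIn T E (λ _ → Z)
dense-embeds {zero} o Z h = (λ ()) , (λ ()) , (λ ())
dense-embeds {suc r} {n} {d} {T} {E} o Z h with low-indegree-miss {E = E} Z (≤-trans (s≤s z≤n) (NearlyComplete.large h)) (NearlyComplete.miss h)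
... | z , uz , inmiss = consF-embeds E o (λ _ → Z) z uz (widen (dense-embeds (tail-oriented o) Z″ record { large = large ; miss = miss }))
  where
  Z′ Z″ : Fin n → Bool
  Z′ x = Z x ∧ E z x
  Z″ x = Z′ x ∧ E x z
  drop : ∀ (U V : Fin n → Bool) → count U ≤ count (λ x → U x ∧ not (V x)) + count (λ x → U x ∧ V x)
  drop U V = count-cover λ x u → lem x u
    where
    lem : ∀ x → U x ≡ true → U x ∧ not (V x) ≡ true ⊎ U x ∧ V x ≡ true
    lem x u with V x
    ... | true = inj₂ (∧-true⁺ u refl)
    ... | false = inj₁ (∧-true⁺ u refl)
  sizes : count Z ≤ d + (d + count Z″)
  sizes = ≤-trans (drop Z (E z)) (+-mono-≤ (NearlyComplete.miss h z uz) (≤-trans (drop Z′ (λ x → E x z))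
    (+-monoˡ-≤ _ (≤-trans (count-mono λ x p → ∧-true⁺ (proj₁ (∧-true⁻ (Z x) (proj₁ (∧-true⁻ (Z′ x) p)))) (proj₂ (∧-true⁻ (Z′ x) p))) inmiss))))
  large : 2 * d * r < count Z″
  large = +-cancelˡ-≤ (d + d) _ _ (≤-trans (≤-reflexive (arith d r)) (≤-trans (NearlyComplete.large h) (≤-trans sizes (≤-reflexive (sym (+-assoc d d _))))))
    where
    arith : ∀ d r → (d + d) + suc (2 * d * r) ≡ suc (2 * d * suc r)
    arith = solve-∀
  sub : ∀ x → Z″ x ≡ true → Z x ≡ true
  sub x p = proj₁ (∧-true⁻ (Z x) (proj₁ (∧-true⁻ (Z′ x) p)))
  miss : ∀ a → Z″ a ≡ true → count (λ w → Z″ w ∧ not (E a w)) ≤ d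
  miss a p = ≤-trans (count-mono λ w q → ∧-true⁺ (sub w (proj₁ (∧-true⁻ (Z″ w) q))) (proj₂ (∧-true⁻ (Z″ w) q)))
    (NearlyComplete.miss h a (sub a p))
  widen : EmbedsIn (tail T) E (λ _ → Z″) → EmbedsIn (tail T) E (λ ρ x → Z x ∧ fits T E z ρ x)
  widen (C , c , u) = C , c , λ ρ → ∧-true⁺ (sub (C ρ) (u ρ)) (fit ρ)
    where
    fit : ∀ ρ → fits T E z ρ (C ρ) ≡ true
    fit ρ with T zero (suc ρ)
    ... | true = proj₂ (∧-true⁻ (Z (C ρ)) (proj₁ (∧-true⁻ (Z′ (C ρ)) (u ρ))))
    ... | false = proj₂ (∧-true⁻ (Z′ (C ρ)) (u ρ))

-- `s` and `d` split the permitted misses: a vertex that misses a set of size `s` has at most `d`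
-- misses left. Sets of size `slack` span an edge, and `slack-≤` says that a set of size `s` keeps
-- more than `2 d K` vertices after an edgeless part is removed.
record Host {n : ℕ} (E : Digraph n) (m s d K : ℕ) : Set where
  field
    misses : MissAtMost E m
    split : s + d ≡ m
    slack : ℕ
    slack-≤ : slack + 2 * d * K ≤ s
    edge : ∀ U → slack ≤ count U → ∃ λ u → ∃ λ v → U u ≡ true × U v ≡ true × E u v ≡ true

-- If no edge leads from X to Y, then Y exhausts almost all out-misses of every vertex of X.
-- So either X ∖ Y is nearly complete, or X ∩ Y is a large independent set, which is excluded.
edge-between : ∀ {n m s d K} {E : Digraph n} → Host E m s d K → (X Y : Fin n → Bool) → s ≤ count X → s ≤ count Y →
  (∃ λ x → ∃ λ y → X x ≡ true × Y y ≡ true × E x y ≡ true) ⊎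
  (∃ λ Z → (∀ x → Z x ≡ true → X x ≡ true) × NearlyComplete E d K Z)
edge-between {n} {m} {s} {d} {K} {E} h X Y sX sY
  with any? (λ x → any? (λ y → (X x ≟ᵇ true) ×-dec ((Y y ≟ᵇ true) ×-dec (E x y ≟ᵇ true))))
... | yes found = inj₁ found
... | no none = inj₂ (Z , (λ x p → proj₁ (∧-true⁻ (X x) p)) , record { large = large ; miss = miss })
  where
  Z W : Fin n → Bool
  Z x = X x ∧ not (Y x)
  W x = X x ∧ Y x
  noedge : ∀ a z → X a ≡ true → Y z ≡ true → not (E a z) ≡ true
  noedge a z p q with E a z in e
  ... | true = ⊥-elim (none (a , z , p , q , e))
  ... | false = refl
  miss : ∀ a → Z a ≡ true → count (λ z → Z z ∧ not (E a z)) ≤ d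
  miss a p = +-cancelˡ-≤ s _ _ (≤-trans (+-monoˡ-≤ _ sY) (≤-trans
    (count-disjoint {P = Y} {Q = λ z → Z z ∧ not (E a z)} {R = λ z → not (E a z)}
      (λ z y q → true≢false y (not-true⁻ (proj₂ (∧-true⁻ (X z) (proj₁ (∧-true⁻ (Z z) q))))))
      (λ z y → noedge a z (proj₁ (∧-true⁻ (X a) p)) y)
      (λ z q → proj₂ (∧-true⁻ (Z z) q)))
    (≤-trans (MissAtMost.out (Host.misses h) a) (≤-reflexive (sym (Host.split h))))))
  cover : count X ≤ count W + count Z
  cover = count-cover λ x p → cov x p
    where
    cov : ∀ x → X x ≡ true → W x ≡ true ⊎ Z x ≡ true
    cov x p with Y x
    ... | true = inj₁ (∧-true⁺ p refl)
    ... | false = inj₂ (∧-true⁺ p refl)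
  large : 2 * d * K < count Z
  large = ≰⇒> λ small → case Host.edge h W (+-cancelʳ-≤ (2 * d * K) _ _
      (≤-trans (Host.slack-≤ h) (≤-trans sX (≤-trans cover (+-monoʳ-≤ _ small))))) of
    λ { (u , v , p , q , e) → none (u , v , proj₁ (∧-true⁻ (X u) p) , proj₂ (∧-true⁻ (X v) q) , e) }

embed-from-edge : ∀ {n m s d κ} {E : Digraph n} → Host E m s d κ → ∀ K {T : Digraph (suc (suc K))} → Oriented T → (U : Fin (suc (suc K)) → Fin n → Bool) →
  (∀ ρ → toℕ ρ ≢ 0 → toℕ ρ ≢ 1 → toℕ ρ * m < count (U ρ)) →
  ∀ x y → U zero x ≡ true → U (suc zero) y ≡ true → fits T E x zero y ≡ true → EmbedsIn T E U
embed-from-edge {n} {m} {E = E} h K {T} o U far x y ux uy e = consF-embeds E o U x ux (consF-embeds E (tail-oriented o) (λ ρ w → U (suc ρ) w ∧ fits T E x ρ w) y (∧-true⁺ uy e)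
  (greedy (tail-oriented (tail-oriented o)) (Host.misses h) _ λ ρ →
    restrict-fits {T = tail T} (Host.misses h) y ρ (λ w → U (suc (suc ρ)) w ∧ fits T E x (suc ρ) w)
     (restrict-fits {T = T} (Host.misses h) x (suc ρ) (U (suc (suc ρ)))
      (≤-trans (≤-reflexive (trans (cong (m +_) (+-suc m _)) (+-suc m _))) (far (suc (suc ρ)) (λ ()) (λ ()))))))

-- The first `j` roles are embedded greedily and cost the sets of roles `j` and `suc j` at most
-- `j m` vertices, so that `edge-between` applies to what remains. The gain over `greedy` is at role
-- `suc j`: `j m + s` candidates suffice where more than `(j + 1) m` were demanded.
embed-with-edge : ∀ {n m s d κ} {E : Digraph n} → Host E m s d κ → ∀ j K {T : Digraph (j + suc (suc K))} → Oriented T →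
  (P : Fin n → Bool) (U : Fin (j + suc (suc K)) → Fin n → Bool) →
  (∀ ρ → toℕ ρ ≢ j → toℕ ρ ≢ suc j → toℕ ρ * m < count (U ρ)) →
  (∀ ρ → toℕ ρ ≡ j ⊎ toℕ ρ ≡ suc j → j * m + s ≤ count (U ρ) × (∀ x → U ρ x ≡ true → P x ≡ true)) →
  EmbedsIn T E U ⊎ ∃ λ Z → (∀ x → Z x ≡ true → P x ≡ true) × NearlyComplete E d κ Z
embed-with-edge {n} {m} {s} {d} {κ} {E} h zero K {T} o P U far near with T zero (suc zero) in t01
... | true = case edge-between h (U zero) (U (suc zero)) (proj₁ (near zero (inj₁ refl))) (proj₁ (near (suc zero) (inj₂ refl))) of λ where
    (inj₂ (Z , sub , nc)) → inj₂ (Z , (λ x z → proj₂ (near zero (inj₁ refl)) x (sub x z)) , nc)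
    (inj₁ (x , y , ux , uy , e)) → inj₁ (embed-from-edge h K o U far x y ux uy (trans (cong (λ b → if b then E x y else E y x) t01) e))
... | false = case edge-between h (U (suc zero)) (U zero) (proj₁ (near (suc zero) (inj₂ refl))) (proj₁ (near zero (inj₁ refl))) of λ where
    (inj₂ (Z , sub , nc)) → inj₂ (Z , (λ x z → proj₂ (near (suc zero) (inj₂ refl)) x (sub x z)) , nc)
    (inj₁ (y , x , uy , ux , e)) → inj₁ (embed-from-edge h K o U far x y ux uy (trans (cong (λ b → if b then E x y else E y x) t01) e))
embed-with-edge {n} {m} {s} {d} {κ} {E} h (suc j) K {T} o P U far near with count-pos (U zero) (far zero (λ ()) (λ ()))
... | v , uv with embed-with-edge h j K {tail T} (tail-oriented o) P (λ ρ x → U (suc ρ) x ∧ fits T E v ρ x)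
    (λ ρ a b → restrict-fits {T = T} (Host.misses h) v ρ (U (suc ρ)) (≤-trans (≤-reflexive (+-suc m _)) (far (suc ρ) (a ∘ cong (_∸ 1)) (b ∘ cong (_∸ 1)))))
    (λ ρ a → restrict-fits {T = T} (Host.misses h) v ρ (U (suc ρ)) (≤-trans (≤-reflexive (sym (+-assoc m (j * m) s))) (proj₁ (near (suc ρ) (up a))))
           , λ x p → proj₂ (near (suc ρ) (up a)) x (proj₁ (∧-true⁻ (U (suc ρ) x) p)))
  where
  up : ∀ {a} → a ≡ j ⊎ a ≡ suc j → suc a ≡ suc j ⊎ suc a ≡ suc (suc j)
  up (inj₁ e) = inj₁ (cong suc e)
  up (inj₂ e) = inj₂ (cong suc e)
...   | inj₁ emb = inj₁ (consF-embeds E o U v uv emb)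
...   | inj₂ z = inj₂ z

-- Light copies of T

below : ∀ {n} → (Fin n → ℕ) → ℕ → Fin n → Bool
below w q v = ⌊ w v <? q ⌋

below-mono : ∀ {n} (w : Fin n → ℕ) {p q} → p ≤ q → count (below w p) ≤ count (below w q)
below-mono w {p} {q} le = count-mono λ v h → dec-true (w v <? q) (≤-trans (dec-true⁻ (w v <? p) h) le)

-- `q` is the entry at position `c`, counted from 0, when the weights are sorted in ascending order.
record Quantile {n : ℕ} (w : Fin n → ℕ) (c q : ℕ) : Set where
  field
    lower : count (below w q) ≤ c
    upper : c < count (below w (suc q))

quantile : ∀ {n} (w : Fin n → ℕ) c → c < n → ∃ (Quantile w c)
quantile {n} w c c<n = search (suc (sumF w)) (≤-trans c<n (≤-trans (≤-reflexive (sym (count-true n)))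
    (count-mono λ v _ → dec-true (w v <? suc (sumF w)) (s≤s (term≤sumF w v)))))
  where
  search : ∀ B → c < count (below w B) → ∃ (Quantile w c)
  search zero h = ⊥-elim (n≮0 (≤-trans h (≤-trans (≤-reflexive (count≡sumF (below w 0)))
    (≤-reflexive (sumF-0 λ v → cong bit (dec-false (w v <? 0) n≮0))))))
  search (suc B) h with c <? count (below w B)
  ... | yes p = search B p
  ... | no p = B , record { lower = ≮⇒≥ p ; upper = h }

quantile-mono : ∀ {n} {w : Fin n → ℕ} {c c′ q q′} → c ≤ c′ → Quantile w c q → Quantile w c′ q′ → q ≤ q′
quantile-mono {w = w} le Q Q′ = ≮⇒≥ λ lt → <⇒≱ (Quantile.upper Q′) (≤-trans (below-mono w lt) (≤-trans (Quantile.lower Q) le))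

-- Junk value 0 when c ≥ n.
qval : ∀ {n} (w : Fin n → ℕ) → ℕ → ℕ
qval {n} w c with c <? n
... | yes p = proj₁ (quantile w c p)
... | no _ = 0

qval-quantile : ∀ {n} (w : Fin n → ℕ) {c} → c < n → Quantile w c (qval w c)
qval-quantile {n} w {c} c<n with c <? n
... | yes p = proj₂ (quantile w c p)
... | no ¬p = ⊥-elim (¬p c<n)

truncated : ∀ {n} → (Fin n → ℕ) → ℕ → ℕ
truncated w q = sumF (λ v → w v ⊓ q)

-- Raising the cut-off from `q` to `q + x` adds a full `x` at every vertex of weight at least
-- `q + x`, and at least `n - c` vertices are that heavy.
truncated-step : ∀ {n} (w : Fin n → ℕ) {c N} q x → count (below w (q + x)) ≤ c → N + c ≤ n →
  truncated w q + N * x ≤ truncated w (q + x)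
truncated-step {n} w {c} {N} q x lt Nc = begin
  truncated w q + N * x
    ≤⟨ +-monoʳ-≤ _ (*-monoˡ-≤ x many) ⟩
  truncated w q + count above * x
    ≡⟨ cong (truncated w q +_) (trans (*-comm (count above) x) (trans (cong (x *_) (count≡sumF above)) (sym (sumF-* {n} x _)))) ⟩
  truncated w q + sumF (λ v → x * bit (above v))
    ≡⟨ sym (sumF-+ {n} _ _) ⟩
  sumF (λ v → w v ⊓ q + x * bit (above v))
    ≤⟨ sumF-mono (λ v → pointwise v) ⟩
  truncated w (q + x) ∎
  where
  open ≤-Reasoning
  above : Fin n → Bool
  above v = not (below w (q + x) v)
  many : N ≤ count above
  many = +-cancelʳ-≤ c _ _ (≤-trans Nc (≤-trans (≤-reflexive (sym (count-not (below w (q + x)))))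
    (≤-trans (+-monoˡ-≤ _ lt) (≤-reflexive (+-comm c _)))))
  pointwise : ∀ v → w v ⊓ q + x * bit (above v) ≤ w v ⊓ (q + x)
  pointwise v with w v <? q + x
  ... | yes _ = ≤-trans (≤-reflexive (trans (cong (w v ⊓ q +_) (*-zeroʳ x)) (+-identityʳ _))) (⊓-monoʳ-≤ (w v) (m≤m+n q x))
  ... | no p = ≤-trans (+-mono-≤ (m⊓n≤n (w v) q) (≤-reflexive (*-identityʳ x)))
          (≤-reflexive (sym (m≥n⇒m⊓n≡n (≮⇒≥ p))))

sumℕ : (ℕ → ℕ) → ℕ → ℕ
sumℕ f r = sumF {r} (λ ρ → f (toℕ ρ))

sumℕ-snoc : ∀ f r → sumℕ f (suc r) ≡ sumℕ f r + f r
sumℕ-snoc f zero = +-identityʳ _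
sumℕ-snoc f (suc r) = trans (cong (f 0 +_) (sumℕ-snoc (f ∘ suc) r)) (sym (+-assoc (f 0) _ _))

-- The recursion of `Heavy.step`: with the last threshold as unit, it bounds `κ * a j`.
growth : ℕ → ℕ → ℕ
growth r zero = 0
growth r (suc j) = r * growth r j + suc r

-- The errors grow by a factor of about r from each role of T to the next; κ beats the accumulated growth.
record Balanced {n : ℕ} (r κ : ℕ) (E : Digraph n) (m s d e : ℕ) : Set where
  field
    host : Host E m s d r
    s-pos : 0 < s
    e-pos : 0 < e
    cover : r * m ≤ n + e
    room : ∀ {j} → j < r → j * m < n
    dominates : growth r (r ∸ 1) < κ
    gap : κ * e ≤ suc d
    tiny : κ * (r * e) ≤ n

embed-with-edge-at : ∀ {n m s d κ R j k} {E : Digraph n} {T : Digraph R} → R ≡ j + suc (suc k) → Host E m s d κ → Oriented T →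
  (U : ℕ → Fin n → Bool) (P : Fin n → Bool) →
  (∀ ρ → ρ < R → ρ ≢ j → ρ ≢ suc j → ρ * m < count (U ρ)) →
  (∀ ρ → ρ ≡ j ⊎ ρ ≡ suc j → j * m + s ≤ count (U ρ) × (∀ x → U ρ x ≡ true → P x ≡ true)) →
  EmbedsIn T E (λ ρ → U (toℕ ρ)) ⊎ ∃ λ Z → (∀ x → Z x ≡ true → P x ≡ true) × NearlyComplete E d κ Z
embed-with-edge-at {j = j} {k} refl H o U P far near =
  embed-with-edge H j k o P (λ ρ → U (toℕ ρ)) (λ ρ → far (toℕ ρ) (toℕ<n ρ)) (λ ρ → near (toℕ ρ))

module Light {n r κ : ℕ} {E : Digraph n} {m s d e : ℕ} (B : Balanced (suc (suc r)) κ E m s d e)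
  {T : Digraph (suc (suc r))} (o : Oriented T) (w : Fin n → ℕ) (min0 : ∃ λ v → w v ≡ 0) where
  open Balanced B
  R : ℕ
  R = suc (suc r)

  s≤m : s ≤ m
  s≤m = ≤-trans (m≤m+n s d) (≤-reflexive (Host.split host))

  -- Positions start at 0, so position `j m + s - 1` is the one that guarantees `j m + s` vertices
  -- up to its weight.
  bIndex : ℕ → ℕ
  bIndex j = j * m + (s ∸ 1)

  bIndex-suc : ∀ j → suc (bIndex j) ≡ j * m + s
  bIndex-suc j = trans (sym (+-suc (j * m) (s ∸ 1))) (cong (j * m +_) (m+[n∸m]≡n s-pos))

  -- More than `j m` vertices have weight at most `a j`, which is what `greedy` demands for role
  -- `j`. The value 0 of `a zero` is the right quantile because the weight 0 is attained.
  a b : ℕ → ℕ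
  a zero = 0
  a (suc j) = qval w (suc j * m)
  b j = qval w (bIndex j)

  bIndex≤ : ∀ j → bIndex j ≤ suc j * m
  bIndex≤ j = ≤-trans (n≤1+n _) (≤-trans (≤-reflexive (bIndex-suc j)) (≤-trans (+-monoʳ-≤ (j * m) s≤m) (≤-reflexive (+-comm (j * m) m))))

  aQ : ∀ {j} → j < R → Quantile w (j * m) (a j)
  aQ {zero} j< = record
    { lower = ≤-trans (≤-reflexive (count≡sumF (below w 0))) (≤-reflexive (sumF-0 λ v → cong bit (dec-false (w v <? 0) n≮0)))
    ; upper = ≤-trans (≤-trans (≤-reflexive (cong bit (sym (dec-true (w (proj₁ min0) <? 1) (≤-reflexive (cong suc (proj₂ min0)))))))
        (term≤sumF (λ v → bit (below w 1 v)) (proj₁ min0))) (≤-reflexive (sym (count≡sumF (below w 1)))) }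
  aQ {suc j} j< = qval-quantile w (room j<)

  bQ : ∀ {j} → suc j < R → Quantile w (bIndex j) (b j)
  bQ {j} j< = qval-quantile w (≤-trans (s≤s (bIndex≤ j)) (room j<))

  a≤b : ∀ {j} → suc j < R → a j ≤ b j
  a≤b {j} j< = quantile-mono (m≤m+n _ _) (aQ (<-trans (n<1+n j) j<)) (bQ j<)

  b≤a : ∀ {j i} → suc j ≤ i → i < R → b j ≤ a i
  b≤a {j} le i< = quantile-mono (≤-trans (bIndex≤ j) (*-monoˡ-≤ m le)) (bQ (≤-<-trans le i<)) (aQ i<)

  W A : ℕ
  W = sumF w
  A = sumℕ a R

  excess : ℕ → ℕ
  excess j = sumℕ (λ i → b i ∸ a i) j

  h : ℕ
  h = suc d

  -- The invariant compares `n` times the sum of all thresholds, cut off at `a j`, with `R` times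
  -- the total weight cut off there, up to the error `R e a j`. Every layer between `a j` and `b j`
  -- is carried by at least `c + h` vertices, every layer between `b j` and `a (suc j)` by at least
  -- `c`. The surplus `h` is credited in the `excess` term.
  weight-step : ∀ j k → suc j + suc k ≡ R → ∀ x y → b j ≡ a j + x → a (suc j) ≡ a j + x + y →
    n * sumℕ a j + n * (suc (suc k) * a j) + R * h * excess j ≤ R * truncated w (a j) + R * e * a j →
    n * sumℕ a (suc j) + n * (suc k * a (suc j)) + R * h * excess (suc j) ≤ R * truncated w (a (suc j)) + R * e * a (suc j)
  weight-step j k R≡ x y bx ay ih = begin
    n * sumℕ a (suc j) + n * (suc k * a (suc j)) + R * h * excess (suc j)
      ≡⟨ cong₂ _+_ (cong₂ _+_ (cong (n *_) (sumℕ-snoc a j)) (cong (λ z → n * (suc k * z)) ay))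
           (cong (R * h *_) (trans (sumℕ-snoc (λ i → b i ∸ a i) j) (cong (excess j +_) (trans (cong (_∸ a j) bx) (m+n∸m≡n (a j) x))))) ⟩
    n * (sumℕ a j + a j) + n * (suc k * (a j + x + y)) + R * h * (excess j + x)
      ≡⟨ alg1 n (sumℕ a j) (a j) k x y R h (excess j) ⟩
    (n * sumℕ a j + n * (suc (suc k) * a j) + R * h * excess j) + suc k * n * (x + y) + R * h * x
      ≤⟨ +-monoˡ-≤ (R * h * x) (+-mono-≤ ih (*-monoˡ-≤ (x + y) kn)) ⟩
    (R * truncated w (a j) + R * e * a j) + (R * c + R * e) * (x + y) + R * h * x
      ≡⟨ alg2 R (truncated w (a j)) e (a j) c x y h ⟩
    R * (truncated w (a j) + (c + h) * x + c * y) + R * e * (a j + x + y)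
      ≤⟨ +-monoˡ-≤ _ (*-monoʳ-≤ R layers) ⟩
    R * truncated w (a j + x + y) + R * e * (a j + x + y)
      ≡⟨ cong (λ z → R * truncated w z + R * e * z) (sym ay) ⟩
    R * truncated w (a (suc j)) + R * e * a (suc j) ∎
    where
    open ≤-Reasoning
    alg1 : ∀ n P a k x y R h X → n * (P + a) + n * (suc k * (a + x + y)) + R * h * (X + x) ≡
      (n * P + n * (suc (suc k) * a) + R * h * X) + suc k * n * (x + y) + R * h * x
    alg1 = solve-∀
    alg2 : ∀ R S e a c x y h → (R * S + R * e * a) + (R * c + R * e) * (x + y) + R * h * x ≡
      R * (S + (c + h) * x + c * y) + R * e * (a + x + y)
    alg2 = solve-∀
    j<R : suc j < R
    j<R = subst (suc j <_) R≡ (m<m+n (suc j) (s≤s z≤n))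
    c : ℕ
    c = n ∸ suc j * m
    c+ : c + suc j * m ≡ n
    c+ = m∸n+n≡m (<⇒≤ (room j<R))
    -- `R c = R n - (j + 1) R m`, and `cover` bounds each `R m` by `n + e`.
    kn : suc k * n ≤ R * c + R * e
    kn = +-cancelˡ-≤ (suc j * n) _ _ (begin
      suc j * n + suc k * n ≡⟨ sym (*-distribʳ-+ n (suc j) (suc k)) ⟩
      (suc j + suc k) * n ≡⟨ cong₂ _*_ R≡ (sym c+) ⟩
      R * (c + suc j * m) ≡⟨ alg3 R c (suc j) m ⟩
      suc j * (R * m) + R * c ≤⟨ +-monoˡ-≤ (R * c) (*-monoʳ-≤ (suc j) cover) ⟩
      suc j * (n + e) + R * c ≡⟨ alg4 (suc j) n e (R * c) ⟩
      suc j * n + (R * c + suc j * e) ≤⟨ +-monoʳ-≤ (suc j * n) (+-monoʳ-≤ (R * c) (*-monoˡ-≤ e (<⇒≤ j<R))) ⟩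
      suc j * n + (R * c + R * e) ∎)
      where
      alg3 : ∀ R c j m → R * (c + j * m) ≡ j * (R * m) + R * c
      alg3 = solve-∀
      alg4 : ∀ j n e q → j * (n + e) + q ≡ j * n + (q + j * e)
      alg4 = solve-∀
    layers : truncated w (a j) + (c + h) * x + c * y ≤ truncated w (a j + x + y)
    layers = ≤-trans (+-monoˡ-≤ (c * y) (truncated-step w {N = c + h} (a j) x (subst (λ z → count (below w z) ≤ bIndex j) bx (Quantile.lower (bQ j<R)))
      (≤-reflexive (trans idx c+))))
      (truncated-step w {N = c} (a j + x) y (subst (λ z → count (below w z) ≤ suc j * m) ay (Quantile.lower (aQ j<R))) (≤-reflexive c+))
      where
      idx : c + h + bIndex j ≡ c + suc j * m
      idx = trans (+-assoc c h (bIndex j)) (cong (c +_) (trans (alg5 d (bIndex j)) (trans (cong (_+ d) (bIndex-suc j))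
        (trans (+-assoc (j * m) s d) (trans (cong (j * m +_) (Host.split host)) (+-comm (j * m) m))))))
        where
        alg5 : ∀ d i → suc d + i ≡ suc i + d
        alg5 = solve-∀

  weight-lower : ∀ j k → j + suc k ≡ R →
    n * sumℕ a j + n * (suc k * a j) + R * h * excess j ≤ R * truncated w (a j) + R * e * a j
  weight-lower zero k _ = ≤-reflexive (trans (zeros n (suc k) (R * h)) z≡)
    where
    zeros : ∀ n k q → n * 0 + n * (k * 0) + q * 0 ≡ 0
    zeros = solve-∀
    z≡ : 0 ≡ R * truncated w 0 + R * e * 0
    z≡ = sym (cong₂ _+_ (trans (cong (R *_) (sumF-0 λ v → ⊓-zeroʳ (w v))) (*-zeroʳ R)) (*-zeroʳ (R * e)))
  weight-lower (suc j) k p = weight-step j k p (b j ∸ a j) (a (suc j) ∸ b j)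
    (sym (m+[n∸m]≡n (a≤b j<R)))
    (sym (trans (cong (_+ (a (suc j) ∸ b j)) (m+[n∸m]≡n (a≤b j<R))) (m+[n∸m]≡n (b≤a {j} ≤-refl j<R))))
    (weight-lower j (suc k) (trans (+-suc j (suc k)) p))
    where
    j<R : suc j < R
    j<R = subst (suc j <_) p (m<m+n (suc j) (s≤s z≤n))

  last : ℕ
  last = a (suc r)

  weight-bound : n * A + R * h * excess (suc r) ≤ R * W + R * e * last
  weight-bound = begin
    n * A + R * h * excess (suc r)
      ≡⟨ cong (_+ R * h * excess (suc r)) (trans (cong (n *_) (trans (sumℕ-snoc a (suc r)) (cong (sumℕ a (suc r) +_) (sym (+-identityʳ last)))))
           (*-distribˡ-+ n (sumℕ a (suc r)) (1 * last))) ⟩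
    n * sumℕ a (suc r) + n * (1 * last) + R * h * excess (suc r)
      ≤⟨ weight-lower (suc r) 0 (+-comm (suc r) 1) ⟩
    R * truncated w last + R * e * last
      ≤⟨ +-monoˡ-≤ (R * e * last) (*-monoʳ-≤ R (sumF-mono λ v → m⊓n≤m (w v) last)) ⟩
    R * W + R * e * last ∎
    where open ≤-Reasoning

  -- b j is the weight threshold of the j m + s lightest vertices: an edge there saves weight over the greedy copy.
  pairBound : ℕ → ℕ → ℕ
  pairBound j ρ = if ⌊ ρ ≤? suc j ⌋ then b j else a ρ

  Weighted : (ℕ → ℕ) → Set
  Weighted β = EmbedsIn T E (λ ρ → below w (suc (β (toℕ ρ))))

  greedy-copy : Weighted a
  greedy-copy = greedy o (Host.misses host) _ λ ρ → Quantile.upper (aQ (toℕ<n ρ))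

  pairBound≤ : ∀ {j ρ} → ρ ≤ suc j → pairBound j ρ ≡ b j
  pairBound≤ {j} {ρ} p = cong (λ t → if t then b j else a ρ) (dec-true (ρ ≤? suc j) p)

  pairBound> : ∀ {j ρ} → ¬ ρ ≤ suc j → pairBound j ρ ≡ a ρ
  pairBound> {j} {ρ} p = cong (λ t → if t then b j else a ρ) (dec-false (ρ ≤? suc j) p)

  b-large : ∀ {j} → suc j < R → j * m + s ≤ count (below w (suc (b j)))
  b-large {j} j<R = ≤-trans (≤-reflexive (sym (bIndex-suc j))) (Quantile.upper (bQ j<R))

  far : ∀ j → suc j < R → ∀ ρ → ρ < R → ρ ≢ j → ρ ≢ suc j → ρ * m < count (below w (suc (pairBound j ρ)))
  far j j<R ρ ρ< n1 n2 = split (ρ ≤? suc j)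
    where
    split : Dec (ρ ≤ suc j) → ρ * m < count (below w (suc (pairBound j ρ)))
    split (yes p) = subst (λ q → ρ * m < count (below w (suc q))) (sym (pairBound≤ p))
      (≤-trans (≤-trans (≤-reflexive (+-comm 1 (ρ * m))) (+-mono-≤ (*-monoˡ-≤ m (s≤s⁻¹ (≤∧≢⇒< p n2))) s-pos)) (b-large j<R))
    split (no p) = subst (λ q → ρ * m < count (below w (suc q))) (sym (pairBound> p)) (Quantile.upper (aQ ρ<))

  near : ∀ j → suc j < R → ∀ ρ → ρ ≡ j ⊎ ρ ≡ suc j → j * m + s ≤ count (below w (suc (pairBound j ρ))) ×
    (∀ x → below w (suc (pairBound j ρ)) x ≡ true → below w (suc (b j)) x ≡ true)
  near j j<R ρ c = subst (λ q → j * m + s ≤ count (below w (suc q)) × (∀ x → below w (suc q) x ≡ true → below w (suc (b j)) x ≡ true))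
    (sym (pairBound≤ (le c))) (b-large j<R , λ x p → p)
    where
    le : ρ ≡ j ⊎ ρ ≡ suc j → ρ ≤ suc j
    le (inj₁ refl) = n≤1+n j
    le (inj₂ refl) = ≤-refl

  b≤pairBound : ∀ j ρ → ρ < R → b j ≤ pairBound j ρ
  b≤pairBound j ρ ρ< = split (ρ ≤? suc j)
    where
    split : Dec (ρ ≤ suc j) → b j ≤ pairBound j ρ
    split (yes p) = ≤-reflexive (sym (pairBound≤ p))
    split (no p) = ≤-trans (b≤a {j} (<⇒≤ (≰⇒> p)) ρ<) (≤-reflexive (sym (pairBound> p)))

  -- Both outcomes respect the bounds: inside a nearly complete set all of `T` has weights at most
  -- `b j`, which no `pairBound j ρ` undercuts.
  pair-copy : ∀ j k → R ≡ j + suc (suc k) → Weighted (pairBound j)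
  pair-copy j k R≡ = finish (embed-with-edge-at R≡ host o (λ ρ → below w (suc (pairBound j ρ))) (below w (suc (b j))) (far j j<R) (near j j<R))
    where
    j<R : suc j < R
    j<R = subst (suc j <_) (sym R≡) (≤-trans (≤-reflexive (sym (trans (+-suc j 1) (cong suc (+-comm j 1))))) (+-monoʳ-≤ j (s≤s (s≤s z≤n))))
    lift : ∀ {Z} → (∀ x → Z x ≡ true → below w (suc (b j)) x ≡ true) → EmbedsIn T E (λ _ → Z) → Weighted (pairBound j)
    lift sub (C , c , u) = C , c , λ ρ → dec-true (w (C ρ) <? _) (≤-trans (dec-true⁻ (w (C ρ) <? suc (b j)) (sub _ (u ρ))) (s≤s (b≤pairBound j (toℕ ρ) (toℕ<n ρ))))
    finish : Weighted (pairBound j) ⊎ (∃ λ Z → (∀ x → Z x ≡ true → below w (suc (b j)) x ≡ true) × NearlyComplete E d R Z) → Weighted (pairBound j)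
    finish (inj₁ x) = x
    finish (inj₂ (Z , sub , nc)) = lift {Z} sub (dense-embeds o Z nc)

  weighted-sum : ∀ β (C : Weighted β) → sumF (λ ρ → w (proj₁ C ρ)) ≤ sumℕ β R
  weighted-sum β (C , _ , u) = sumF-mono λ ρ → s≤s⁻¹ (dec-true⁻ (w (C ρ) <? _) (u ρ))

  -- Charging `b j` on top of `a ρ` is generous for every role except `suc j`, where `b j` replaces
  -- `a (suc j)` and the old threshold is saved.
  pairBound-sum : ∀ j → suc j < R → sumℕ (pairBound j) R + a (suc j) ≤ A + R * b j
  pairBound-sum j j<R = begin
    sumℕ (pairBound j) R + a (suc j)
      ≡⟨ cong (sumℕ (pairBound j) R +_) (trans (cong a (sym (toℕ-fromℕ< j<R))) (sym (sumF-δ jj (a ∘ toℕ)))) ⟩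
    sumℕ (pairBound j) R + sumF (λ ρ → bit (ρ == jj) * a (toℕ ρ))
      ≡⟨ sym (sumF-+ {R} (λ ρ → pairBound j (toℕ ρ)) (λ ρ → bit (ρ == jj) * a (toℕ ρ))) ⟩
    sumF (λ ρ → pairBound j (toℕ ρ) + bit (ρ == jj) * a (toℕ ρ))
      ≤⟨ sumF-mono {R} pointwise ⟩
    sumF {R} (λ ρ → a (toℕ ρ) + b j)
      ≡⟨ trans (sumF-+ {R} (λ ρ → a (toℕ ρ)) (λ _ → b j)) (cong (A +_) (sumF-const R (b j))) ⟩
    A + R * b j ∎
    where
    open ≤-Reasoning
    jj : Fin R
    jj = fromℕ< j<R
    pointwise : ∀ ρ → pairBound j (toℕ ρ) + bit (ρ == jj) * a (toℕ ρ) ≤ a (toℕ ρ) + b j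
    pointwise ρ with toℕ ρ ≤? suc j | ρ ≟ jj
    ... | yes _ | yes _ = ≤-reflexive (trans (cong (b j +_) (+-identityʳ _)) (+-comm (b j) _))
    ... | yes _ | no _ = ≤-trans (≤-reflexive (+-identityʳ _)) (m≤n+m (b j) _)
    ... | no _ | no _ = +-monoʳ-≤ (a (toℕ ρ)) z≤n
    ... | no p | yes refl = ⊥-elim (p (≤-reflexive (toℕ-fromℕ< j<R)))

  n-pos : 0 < n
  n-pos = room {0} (s≤s z≤n)

  term≤excess : ∀ j k → suc j ≤ k → b j ∸ a j ≤ excess k
  term≤excess j k j<k = ≤-trans (≤-reflexive (cong (λ i → b i ∸ a i) (sym (toℕ-fromℕ< j<k)))) (term≤sumF {k} (λ ρ → b (toℕ ρ) ∸ a (toℕ ρ)) (fromℕ< j<k))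

  -- Reductio. A heavy greedy copy makes all jumps from `a j` to `b j` tiny compared with `last`. A
  -- heavy copy for the pair at `j` then bounds `a (suc j)` by about `R` times `a j`. Iterated from
  -- `a 0 = 0`, this yields `κ * last ≤ growth R (R - 1) * last`, so `last` vanishes, which
  -- `B-small` forbids.
  module Heavy (heavy-greedy : R * W < n * A) (heavy-pair : ∀ j → suc j < R → R * W < n * sumℕ (pairBound j) R) where
    B-small : h * excess (suc r) < e * last
    B-small = *-cancelˡ-< R _ _ (+-cancelˡ-< (R * W) _ _ (begin-strict
      R * W + R * (h * excess (suc r)) <⟨ +-monoˡ-< _ heavy-greedy ⟩
      n * A + R * (h * excess (suc r)) ≡⟨ cong (n * A +_) (sym (*-assoc R h _)) ⟩
      n * A + R * h * excess (suc r) ≤⟨ weight-bound ⟩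
      R * W + R * e * last ≡⟨ cong (R * W +_) (*-assoc R e _) ⟩
      R * W + R * (e * last) ∎))
      where open ≤-Reasoning

    κB : κ * excess (suc r) ≤ last
    κB = <⇒≤ (*-cancelˡ-< e _ _ (≤-<-trans (≤-trans (≤-reflexive (alg e κ (excess (suc r)))) (*-monoˡ-≤ (excess (suc r)) gap)) B-small))
      where
      alg : ∀ e k x → e * (k * x) ≡ k * e * x
      alg = solve-∀

    step : ∀ j → suc j < R → κ * a (suc j) ≤ R * (κ * a j) + suc R * last
    step j j<R = *-cancelˡ-≤ n {{>-nonZero n-pos}} (begin
      n * (κ * a (suc j)) ≡⟨ alg1 n κ (a (suc j)) ⟩
      κ * (n * a (suc j)) ≤⟨ *-monoʳ-≤ κ raw ⟩
      κ * (n * (R * b j) + R * e * last) ≡⟨ cong (λ z → κ * (n * (R * z) + R * e * last)) (sym (m+[n∸m]≡n (a≤b j<R))) ⟩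
      κ * (n * (R * (a j + (b j ∸ a j))) + R * e * last) ≡⟨ alg2 κ n R (a j) (b j ∸ a j) e last ⟩
      n * (R * (κ * a j) + R * (κ * (b j ∸ a j))) + κ * (R * e) * last
        ≤⟨ +-mono-≤ (*-monoʳ-≤ n (+-monoʳ-≤ (R * (κ * a j)) (*-monoʳ-≤ R (≤-trans (*-monoʳ-≤ κ (term≤excess j (suc r) (s≤s⁻¹ j<R))) κB)))) (*-monoˡ-≤ last tiny) ⟩
      n * (R * (κ * a j) + R * last) + n * last ≡⟨ alg3 n (R * (κ * a j)) R last ⟩
      n * (R * (κ * a j) + suc R * last) ∎)
      where
      open ≤-Reasoning
      alg1 : ∀ n k x → n * (k * x) ≡ k * (n * x)
      alg1 = solve-∀
      alg2 : ∀ k n R x y e l → k * (n * (R * (x + y)) + R * e * l) ≡ n * (R * (k * x) + R * (k * y)) + k * (R * e) * l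
      alg2 = solve-∀
      alg3 : ∀ n x R l → n * (x + R * l) + n * l ≡ n * (x + suc R * l)
      alg3 = solve-∀
      raw : n * a (suc j) ≤ n * (R * b j) + R * e * last
      raw = +-cancelˡ-≤ (R * W) _ _ (begin
        R * W + n * a (suc j) ≤⟨ +-monoˡ-≤ _ (<⇒≤ (heavy-pair j j<R)) ⟩
        n * sumℕ (pairBound j) R + n * a (suc j) ≡⟨ sym (*-distribˡ-+ n _ _) ⟩
        n * (sumℕ (pairBound j) R + a (suc j)) ≤⟨ *-monoʳ-≤ n (pairBound-sum j j<R) ⟩
        n * (A + R * b j) ≡⟨ *-distribˡ-+ n _ _ ⟩
        n * A + n * (R * b j) ≤⟨ +-monoˡ-≤ _ (≤-trans (m≤m+n _ _) weight-bound) ⟩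
        R * W + R * e * last + n * (R * b j) ≡⟨ trans (+-assoc (R * W) _ _) (cong (R * W +_) (+-comm _ (n * (R * b j)))) ⟩
        R * W + (n * (R * b j) + R * e * last) ∎)

    geometric : ∀ j → j < R → κ * a j ≤ growth R j * last
    geometric zero _ = ≤-reflexive (*-zeroʳ κ)
    geometric (suc j) j<R = ≤-trans (step j j<R) (≤-trans (+-monoˡ-≤ _ (*-monoʳ-≤ R (geometric j (<-trans (n<1+n j) j<R))))
      (≤-reflexive (trans (cong (_+ suc R * last) (sym (*-assoc R (growth R j) last))) (sym (*-distribʳ-+ last (R * growth R j) (suc R))))))

    absurd : ⊥
    absurd = n≮0 (≤-trans B-small (≤-reflexive (trans (cong (e *_) last≡0) (*-zeroʳ e))))
      where
      last≡0 : last ≡ 0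
      last≡0 = n≤0⇒n≡0 (+-cancelʳ-≤ (growth R (suc r) * last) last 0 (≤-trans (*-monoˡ-≤ last dominates) (geometric (suc r) (n<1+n _))))

  light : ∃ λ C → Copy T E C × n * sumF (λ ρ → w (C ρ)) ≤ R * W
  light with n * A ≤? R * W
  ... | yes p = proj₁ greedy-copy , proj₁ (proj₂ greedy-copy) , ≤-trans (*-monoʳ-≤ n (weighted-sum a greedy-copy)) p
  ... | no p with any? {n = suc r} (λ j → n * sumℕ (pairBound (toℕ j)) R ≤? R * W)
  ...   | yes (j , q) = proj₁ pc , proj₁ (proj₂ pc) , ≤-trans (*-monoʳ-≤ n (weighted-sum (pairBound (toℕ j)) pc)) q
    where
    pc : Weighted (pairBound (toℕ j))
    pc = pair-copy (toℕ j) (r ∸ toℕ j) (sym (trans (+-suc (toℕ j) _) (cong suc (trans (+-suc (toℕ j) _) (cong suc (m+[n∸m]≡n (s≤s⁻¹ (toℕ<n j))))))))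
  ...   | no q = ⊥-elim (Heavy.absurd (≰⇒> p) λ j j<R → ≰⇒> λ le → q (fromℕ< (s≤s⁻¹ j<R) ,
            subst (λ i → n * sumℕ (pairBound i) R ≤ R * W) (sym (toℕ-fromℕ< (s≤s⁻¹ j<R))) le))

minimum : ∀ {n} (w : Fin (suc n) → ℕ) → ∃ λ v → ∀ u → w v ≤ w u
minimum {zero} w = zero , λ { zero → ≤-refl }
minimum {suc n} w with minimum (w ∘ suc)
... | v , h with ≤-total (w zero) (w (suc v))
...   | inj₁ p = zero , λ { zero → ≤-refl ; (suc u) → ≤-trans p (h u) }
...   | inj₂ p = suc v , λ { zero → p ; (suc u) → h u }

-- Subtracting the minimum lowers both sides by the same `n R w v`, because a copy has exactly `R`
-- vertices. So the weight 0 may be assumed to occur.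
light-copy : ∀ {n r κ} {E : Digraph n} {m s d e} → Balanced (suc (suc r)) κ E m s d e → {T : Digraph (suc (suc r))} → Oriented T →
  (w : Fin n → ℕ) → ∃ λ C → Copy T E C × n * sumF (λ ρ → w (C ρ)) ≤ suc (suc r) * sumF w
light-copy {zero} B o w = ⊥-elim (n≮0 (Balanced.room B {0} (s≤s z≤n)))
light-copy {suc n} {r} {E} B {T} o w with minimum w
... | v , low with Light.light B {T} o (λ u → w u ∸ w v) (v , n∸n≡0 (w v))
...   | C , c , le = C , c , (begin
  suc n * sumF (λ ρ → w (C ρ))
    ≡⟨ cong (suc n *_) (unshift C) ⟩
  suc n * (sumF (λ ρ → w (C ρ) ∸ w v) + R * w v)
    ≡⟨ *-distribˡ-+ (suc n) (sumF (λ ρ → w (C ρ) ∸ w v)) (R * w v) ⟩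
  suc n * sumF (λ ρ → w (C ρ) ∸ w v) + suc n * (R * w v)
    ≤⟨ +-monoˡ-≤ _ le ⟩
  R * sumF (λ u → w u ∸ w v) + suc n * (R * w v)
    ≡⟨ alg R (sumF (λ u → w u ∸ w v)) (suc n) (w v) ⟩
  R * (sumF (λ u → w u ∸ w v) + suc n * w v)
    ≡⟨ cong (R *_) (sym (unshift id)) ⟩
  R * sumF w ∎)
  where
  open ≤-Reasoning
  R : ℕ
  R = suc (suc r)
  alg : ∀ R x n y → R * x + n * (R * y) ≡ R * (x + n * y)
  alg = solve-∀
  unshift : ∀ {k} (f : Fin k → Fin (suc n)) → sumF (λ i → w (f i)) ≡ sumF (λ i → w (f i) ∸ w v) + k * w v
  unshift {k} f = trans (sumF-cong λ i → sym (m∸n+n≡m (low (f i)))) (trans (sumF-+ {k} _ _) (cong (sumF (λ i → w (f i) ∸ w v) +_) (sumF-const k (w v))))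

-- Balanced families of copies

HasLightCopies : ∀ {r n} → Digraph r → Digraph n → Set
HasLightCopies {r} {n} T E = ∀ w → ∃ λ C → Copy T E C × (n * sumF (λ ρ → w (C ρ)) ≤ r * sumF w)

-- Two roles of a tournament are joined by an edge, so a coincidence of their images would be a
-- loop.
copy-injective : ∀ {r n} {T : Digraph r} {E : Digraph n} → IsTournament T → Loopless E → ∀ {C} → Copy T E C → ∀ i j → C i ≡ C j → i ≡ j
copy-injective {T = T} {E} (_ , tour) loop {C} c i j e with i ≟ j
... | yes p = p
... | no p with tour i j p
...   | inj₁ (t , _) = ⊥-elim (true≢false (c i j t) (trans (cong (E (C i)) (sym e)) (loop (C i))))
...   | inj₂ (_ , t) = ⊥-elim (true≢false (c j i t) (trans (cong (E (C j)) e) (loop (C j))))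

-- The labels separate the copies through a common vertex; later they select its clone.
record Family {r n : ℕ} (T : Digraph r) (E : Digraph n) (t : ℕ) : Set where
  field
    copy : Fin t → Fin r → Fin n
    label : Fin t → Fin r → ℕ
    load : Fin n → ℕ
    isCopy : ∀ j → Copy T E (copy j)
    label< : ∀ j ρ → label j ρ < load (copy j ρ)
    separated : ∀ j ρ j′ ρ′ → copy j ρ ≡ copy j′ ρ′ → label j ρ ≡ label j′ ρ′ → j ≡ j′
    total : sumF load ≡ r * t
    square : n * sumF (λ v → load v * load v) ≤ r * t * (r * t) + r * n * t

-- With the loads as weights, lightness bounds the cross term of the new squares by `2 r (r t)`,
-- exactly the cross term of `(r (t + 1))^2`. The squares of the increments contribute `n r`, paid
-- by the linear term of `square`.
extend : ∀ {r n t} {T : Digraph r} {E : Digraph n} → IsTournament T → Loopless E → HasLightCopies T E → Family T E t → Family T E (suc t)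
extend {r} {n} {t} {T} {E} tour loop light F with light (Family.load F)
... | C , c , le = record
  { copy = consF C copy
  -- The label at a vertex is its load before the insertion, so the labels there run through 0, 1,
  -- 2, ... without repetition.
  ; label = consF (λ ρ → load (C ρ)) label
  ; load = load′
  ; isCopy = λ { zero → c ; (suc j) → isCopy j }
  ; label< = λ { zero ρ → new< ρ ; (suc j) ρ → <-≤-trans (label< j ρ) (m≤m+n _ _) }
  ; separated = sep
  ; total = trans (sumF-+ {n} load hit) (trans (cong₂ _+_ total hits) (trans (+-comm (r * t) r) (sym (*-suc r t))))
  ; square = square′
  }
  where
  open Family F
  hit load′ : Fin n → ℕ
  hit v = sumF (λ ρ → bit (v == C ρ))
  load′ v = load v + hit v
  hit≤1 : ∀ v → hit v ≤ 1
  hit≤1 v = sumF-atMostOne (λ ρ → v == C ρ) λ i j p q → copy-injective {E = E} tour loop c i j (trans (sym (dec-true⁻ (v ≟ C i) p)) (dec-true⁻ (v ≟ C j) q))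
  hits : sumF hit ≡ r
  hits = trans (sumF-swap {n} {r} _) (trans (sumF-cong λ ρ → sumF-δ1 (C ρ)) (trans (sumF-const r 1) (*-identityʳ r)))
  new< : ∀ ρ → load (C ρ) < load′ (C ρ)
  new< ρ = ≤-trans (≤-reflexive (+-comm 1 _)) (+-monoʳ-≤ (load (C ρ))
    (≤-trans (≤-reflexive (cong bit (sym (==-refl (C ρ))))) (term≤sumF (λ σ → bit (C ρ == C σ)) ρ)))
  sep : ∀ j ρ j′ ρ′ → consF C copy j ρ ≡ consF C copy j′ ρ′ →
    consF (λ ρ → load (C ρ)) label j ρ ≡ consF (λ ρ → load (C ρ)) label j′ ρ′ → j ≡ j′
  sep zero ρ zero ρ′ _ _ = refl
  sep zero ρ (suc j′) ρ′ p q = ⊥-elim (<-irrefl (trans (sym q) (cong load p)) (label< j′ ρ′))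
  sep (suc j) ρ zero ρ′ p q = ⊥-elim (<-irrefl (trans q (cong load (sym p))) (label< j ρ))
  sep (suc j) ρ (suc j′) ρ′ p q = cong suc (separated j ρ j′ ρ′ p q)
  cross : sumF (λ v → load v * hit v) ≡ sumF (λ ρ → load (C ρ))
  cross = trans (sumF-cong λ v → trans (sym (sumF-* {r} (load v) _)) (sumF-cong {r} λ ρ → *-comm (load v) _))
    (trans (sumF-swap {n} {r} _) (sumF-cong λ ρ → sumF-δ (C ρ) load))
  square′ : n * sumF (λ v → load′ v * load′ v) ≤ r * suc t * (r * suc t) + r * n * suc t
  square′ = begin
    n * sumF (λ v → load′ v * load′ v)
      ≤⟨ *-monoʳ-≤ n (sumF-mono λ v → pointwise (load v) (hit v) (hit≤1 v)) ⟩
    n * sumF (λ v → load v * load v + (2 * (load v * hit v) + hit v))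
      ≡⟨ cong (n *_) (trans (sumF-+ {n} _ _) (cong (sumF (λ v → load v * load v) +_) (trans (sumF-+ {n} _ _) (cong₂ _+_ (trans (sumF-* {n} 2 _) (cong (2 *_) cross)) hits)))) ⟩
    n * (sumF (λ v → load v * load v) + (2 * sumF (λ ρ → load (C ρ)) + r))
      ≡⟨ alg1 n (sumF (λ v → load v * load v)) (sumF (λ ρ → load (C ρ))) r ⟩
    n * sumF (λ v → load v * load v) + 2 * (n * sumF (λ ρ → load (C ρ))) + n * r
      ≤⟨ +-monoˡ-≤ (n * r) (+-mono-≤ square (*-monoʳ-≤ 2 (≤-trans le (≤-reflexive (cong (r *_) total))))) ⟩
    r * t * (r * t) + r * n * t + 2 * (r * (r * t)) + n * r
      ≤⟨ m≤m+n _ (r * r) ⟩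
    r * t * (r * t) + r * n * t + 2 * (r * (r * t)) + n * r + r * r
      ≡⟨ alg2 r n t ⟩
    r * suc t * (r * suc t) + r * n * suc t ∎
    where
    open ≤-Reasoning
    alg1 : ∀ n S x r → n * (S + (2 * x + r)) ≡ n * S + 2 * (n * x) + n * r
    alg1 = solve-∀
    alg2 : ∀ r n t → r * t * (r * t) + r * n * t + 2 * (r * (r * t)) + n * r + r * r ≡ r * suc t * (r * suc t) + r * n * suc t
    alg2 = solve-∀
    pointwise : ∀ x c → c ≤ 1 → (x + c) * (x + c) ≤ x * x + (2 * (x * c) + c)
    pointwise x zero _ = ≤-reflexive (lem x)
      where
      lem : ∀ x → (x + 0) * (x + 0) ≡ x * x + (2 * (x * 0) + 0)
      lem = solve-∀
    pointwise x (suc zero) _ = ≤-reflexive (lem x)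
      where
      lem : ∀ x → (x + 1) * (x + 1) ≡ x * x + (2 * (x * 1) + 1)
      lem = solve-∀
    pointwise x (suc (suc c)) (s≤s ())

family : ∀ {r n} {T : Digraph r} {E : Digraph n} → IsTournament T → Loopless E → HasLightCopies T E → ∀ t → Family T E t
family {r} {n} tour loop light zero = record
  { copy = λ () ; label = λ () ; load = λ _ → 0 ; isCopy = λ () ; label< = λ () ; separated = λ ()
  ; total = trans (sumF-const n 0) (trans (*-zeroʳ n) (sym (*-zeroʳ r)))
  ; square = ≤-trans (≤-reflexive (trans (cong (n *_) (trans (sumF-const n 0) (*-zeroʳ n))) (*-zeroʳ n))) z≤n }
family tour loop light (suc t) = extend tour loop light (family tour loop light t)

2ab≤a²+b² : ∀ a b → 2 * (a * b) ≤ a * a + b * b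
2ab≤a²+b² a b with ≤-total a b
... | inj₁ p = subst (λ z → 2 * (a * z) ≤ a * a + z * z) (m+[n∸m]≡n p) (lem a (b ∸ a))
  where
  lem : ∀ a k → 2 * (a * (a + k)) ≤ a * a + (a + k) * (a + k)
  lem a k = ≤-trans (m≤m+n _ (k * k)) (≤-reflexive (alg a k))
    where
    alg : ∀ a k → 2 * (a * (a + k)) + k * k ≡ a * a + (a + k) * (a + k)
    alg = solve-∀
... | inj₂ p = subst (λ z → 2 * (z * b) ≤ z * z + b * b) (m+[n∸m]≡n p) (lem b (a ∸ b))
  where
  lem : ∀ b k → 2 * ((b + k) * b) ≤ (b + k) * (b + k) + b * b
  lem b k = ≤-trans (m≤m+n _ (k * k)) (≤-reflexive (alg b k))
    where
    alg : ∀ b k → 2 * ((b + k) * b) + k * k ≡ (b + k) * (b + k) + b * b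
    alg = solve-∀

-- (n x_v − r t)² ≤ Σ (n x_u − r t)² ≤ r n² t.
load-deviation : ∀ {r n t} {T : Digraph r} {E : Digraph n} (F : Family T E t) v δ → n * Family.load F v ≡ r * t + δ → δ * δ ≤ r * (n * n) * t
load-deviation {r} {n} {t} F v δ eq = +-cancelˡ-≤ (2 * (n * (r * t * (r * t)))) _ _ (begin
  2 * (n * (r * t * (r * t))) + δ * δ
    ≡⟨ cong₂ _+_ left (sym (sumF-δ v (λ _ → δ * δ))) ⟩
  sumF (λ u → 2 * (n * load u * (r * t))) + sumF (λ u → bit (u == v) * (δ * δ))
    ≡⟨ sym (sumF-+ {n} _ _) ⟩
  sumF (λ u → 2 * (n * load u * (r * t)) + bit (u == v) * (δ * δ))
    ≤⟨ sumF-mono pointwise ⟩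
  sumF (λ u → n * load u * (n * load u) + r * t * (r * t))
    ≡⟨ trans (sumF-+ {n} _ _) (cong₂ _+_ (trans (sumF-cong λ u → alg1 n (load u)) (trans (sumF-* {n} (n * n) _) (*-assoc n n _))) (sumF-const n _)) ⟩
  n * (n * sumF (λ u → load u * load u)) + n * (r * t * (r * t))
    ≤⟨ +-monoˡ-≤ _ (*-monoʳ-≤ n square) ⟩
  n * (r * t * (r * t) + r * n * t) + n * (r * t * (r * t))
    ≡⟨ alg2 n r t ⟩
  2 * (n * (r * t * (r * t))) + r * (n * n) * t ∎)
  where
  open Family F
  open ≤-Reasoning
  alg1 : ∀ n x → n * x * (n * x) ≡ n * n * (x * x)
  alg1 = solve-∀
  alg2 : ∀ n r t → n * (r * t * (r * t) + r * n * t) + n * (r * t * (r * t)) ≡ 2 * (n * (r * t * (r * t))) + r * (n * n) * t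
  alg2 = solve-∀
  alg3 : ∀ n x y → 2 * (n * x * y) ≡ 2 * (n * y) * x
  alg3 = solve-∀
  left : 2 * (n * (r * t * (r * t))) ≡ sumF (λ u → 2 * (n * load u * (r * t)))
  left = sym (trans (sumF-cong λ u → alg3 n (load u) (r * t)) (trans (sumF-* {n} (2 * (n * (r * t))) load) (trans (cong (2 * (n * (r * t)) *_) total) (alg4 n (r * t)))))
    where
    alg4 : ∀ n x → 2 * (n * x) * x ≡ 2 * (n * (x * x))
    alg4 = solve-∀
  pointwise : ∀ u → 2 * (n * load u * (r * t)) + bit (u == v) * (δ * δ) ≤ n * load u * (n * load u) + r * t * (r * t)
  pointwise u with u ≟ v
  ... | no _ = ≤-trans (≤-reflexive (+-identityʳ _)) (2ab≤a²+b² (n * load u) (r * t))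
  ... | yes refl = subst (λ z → 2 * (z * (r * t)) + 1 * (δ * δ) ≤ z * z + r * t * (r * t)) (sym eq) (≤-reflexive (alg5 (r * t) δ))
    where
    alg5 : ∀ y d → 2 * ((y + d) * y) + 1 * (d * d) ≡ (y + d) * (y + d) + y * y
    alg5 = solve-∀

-- Number of copies against number of clones

copies : ℕ → ℕ → ℕ
copies r N = r * (N * N * (N * N))

-- On `N r` vertices, `copies r N` copies have mean load `r N^3`, and `load-deviation` allows an
-- excess of at most `r N^2`.
cap : ℕ → ℕ → ℕ
cap r N = r * (N * N * N) + r * (N * N)

load≤cap : ∀ {r N} {T : Digraph r} {E : Digraph (N * r)} (F : Family T E (copies r N)) v → Family.load F v ≤ cap r N
load≤cap {r} {N} F v = ≮⇒≥ λ big → contra big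
  where
  open Family F
  open ≤-Reasoning
  contra : cap r N < load v → ⊥
  contra big = <⇒≱ δ²-large (load-deviation F v δ (sym (m+[n∸m]≡n rt≤)))
    where
    alg1 : ∀ r N → N * r * suc (r * (N * N * N) + r * (N * N)) ≡ r * (r * (N * N * (N * N))) + (r * r * (N * N * N) + N * r)
    alg1 = solve-∀
    nx≥ : r * copies r N + (r * r * (N * N * N) + N * r) ≤ N * r * load v
    nx≥ = ≤-trans (≤-reflexive (sym (alg1 r N))) (*-monoʳ-≤ (N * r) big)
    rt≤ : r * copies r N ≤ N * r * load v
    rt≤ = ≤-trans (m≤m+n _ _) nx≥
    δ : ℕ
    δ = N * r * load v ∸ r * copies r N
    δ≥ : r * r * (N * N * N) + N * r ≤ δ
    δ≥ = +-cancelˡ-≤ (r * copies r N) _ _ (≤-trans nx≥ (≤-reflexive (sym (m+[n∸m]≡n rt≤))))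
    Nr-pos : 0 < N * r
    Nr-pos = fin-pos v
      where
      fin-pos : ∀ {k} → Fin k → 0 < k
      fin-pos zero = s≤s z≤n
      fin-pos (suc _) = s≤s z≤n
    δ²-large : r * (N * r * (N * r)) * copies r N < δ * δ
    δ²-large = begin-strict
      r * (N * r * (N * r)) * copies r N ≡⟨ alg2 r N ⟩
      r * r * (N * N * N) * (r * r * (N * N * N)) <⟨ *-mono-< lt lt ⟩
      δ * δ ∎
      where
      alg2 : ∀ r N → r * (N * r * (N * r)) * (r * (N * N * (N * N))) ≡ r * r * (N * N * N) * (r * r * (N * N * N))
      alg2 = solve-∀
      lt : r * r * (N * N * N) < δ
      lt = ≤-trans (≤-trans (≤-reflexive (+-comm 1 _)) (+-monoʳ-≤ (r * r * (N * N * N)) Nr-pos)) δ≥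

-- With `N = a + 1` the left side is `r N^2 (N^2 - 1)`. It will count the old copies given up, when
-- `a` packing classes have `cap r N` clones each, and the right side the new copies.
cap-copies : ∀ r a → 0 < r → a * cap r (suc a) < copies r (suc a)
cap-copies r a pos = ≤-trans (≤-trans (≤-reflexive (+-comm 1 _)) (+-monoʳ-≤ (a * cap r (suc a)) pos′)) (≤-reflexive (alg r a))
  where
  pos′ : 1 ≤ r * (suc a * suc a)
  pos′ = *-mono-≤ pos (*-mono-≤ {1} {suc a} {1} {suc a} (s≤s z≤n) (s≤s z≤n))
  alg : ∀ r a → a * (r * (suc a * suc a * suc a) + r * (suc a * suc a)) + r * (suc a * suc a) ≡ r * (suc a * suc a * (suc a * suc a))
  alg = solve-∀

-- Homogeneous boxes in products

-- Linearity and monotonicity are all that the density arguments use, so vectors and their products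
-- with a phantom coordinate are treated alike.
record Summation (Y : Set) : Set where
  field
    ∑ : (Y → ℕ) → ℕ
    ∑-mono : ∀ {f g} → (∀ y → f y ≤ g y) → ∑ f ≤ ∑ g
    ∑-+ : ∀ f g → ∑ (λ y → f y + g y) ≡ ∑ f + ∑ g
    ∑-* : ∀ c f → ∑ (λ y → c * f y) ≡ c * ∑ f

  ∑-cong : ∀ {f g} → (∀ y → f y ≡ g y) → ∑ f ≡ ∑ g
  ∑-cong h = ≤-antisym (∑-mono λ y → ≤-reflexive (h y)) (∑-mono λ y → ≤-reflexive (sym (h y)))

  ∑-0 : ∑ (λ _ → 0) ≡ 0
  ∑-0 = ∑-* 0 (λ _ → 0)

  ∑-sumF : ∀ {n} (f : Fin n → Y → ℕ) → ∑ (λ y → sumF (λ i → f i y)) ≡ sumF (λ i → ∑ (f i))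
  ∑-sumF {zero} f = ∑-0
  ∑-sumF {suc n} f = trans (∑-+ (f zero) _) (cong (∑ (f zero) +_) (∑-sumF (f ∘ suc)))

  mass : (Y → Bool) → ℕ
  mass Z = ∑ (λ y → bit (Z y))

  mass-mono : ∀ {P Q : Y → Bool} → (∀ y → P y ≡ true → Q y ≡ true) → mass P ≤ mass Q
  mass-mono h = ∑-mono λ y → bit-mono (h y)

  everything : ℕ
  everything = ∑ (λ _ → 1)

  mass-empty : ∀ (P : Y → Bool) → (∀ y → P y ≡ false) → mass P ≡ 0
  mass-empty P h = trans (∑-cong λ y → cong bit (h y)) ∑-0

finite : ∀ n → Summation (Fin n)
finite n = record
  { ∑ = sumF ; ∑-mono = sumF-mono ; ∑-+ = sumF-+ {n} ; ∑-* = sumF-* {n} }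

infixr 4 _⊗_
_⊗_ : ∀ {X Y : Set} → Summation X → Summation Y → Summation (X × Y)
S ⊗ S′ = record
  { ∑ = λ f → X.∑ (λ x → Y.∑ (λ y → f (x , y)))
  ; ∑-mono = λ h → X.∑-mono λ x → Y.∑-mono λ y → h (x , y)
  ; ∑-+ = λ f g → trans (X.∑-cong λ x → Y.∑-+ _ _) (X.∑-+ _ _)
  ; ∑-* = λ c f → trans (X.∑-cong λ x → Y.∑-* c _) (X.∑-* c _) }
  where
  module X = Summation S
  module Y = Summation S′

tuples : ∀ x a → Summation (Vec (Fin x) a)
tuples x zero = record { ∑ = λ f → f [] ; ∑-mono = λ h → h [] ; ∑-+ = λ f g → refl ; ∑-* = λ c f → refl }
tuples x (suc a) = record
  { ∑ = λ f → sumF {x} (λ i → T.∑ (λ y → f (i ∷ y)))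
  ; ∑-mono = λ h → sumF-mono λ i → T.∑-mono λ y → h (i ∷ y)
  ; ∑-+ = λ f g → trans (sumF-cong {x} λ i → T.∑-+ _ _) (sumF-+ {x} _ _)
  ; ∑-* = λ c f → trans (sumF-cong {x} λ i → T.∑-* c _) (sumF-* {x} c _) }
  where
  module T = Summation (tuples x a)

tuples-everything : ∀ x a → Summation.everything (tuples x a) ≡ x ^ a
tuples-everything x zero = refl
tuples-everything x (suc a) = trans (sumF-const x _) (cong (x *_) (tuples-everything x a))

module Popular {Y : Set} (S : Summation Y) {x : ℕ} (𝒢 : Fin x → Y → Bool) where
  open Summation S

  degree : Y → ℕ
  degree y = count (λ i → 𝒢 i y)

  degrees : sumF (λ i → mass (𝒢 i)) ≡ ∑ degree
  degrees = trans (sym (∑-sumF λ i y → bit (𝒢 i y))) (∑-cong λ y → sym (count≡sumF (λ i → 𝒢 i y)))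

  free : (Fin x → Bool) → Fin x → Y → Bool
  free used i y = 𝒢 i y ∧ not (used i)

  pick : 0 < x → ∀ q (used : Fin x → Bool) (Z : Y → Bool) → 0 < mass Z →
    (∀ y → Z y ≡ true → x ≤ q * count (λ i → free used i y)) →
    ∃ λ i → used i ≡ false × mass Z ≤ q * mass (λ y → Z y ∧ 𝒢 i y)
  pick x-pos q used Z pos deg = i , unused (used i) refl , ≤-trans big (*-monoʳ-≤ q (mass-mono λ y p → weaken y p))
    where
    f : Fin x → ℕ
    f i = mass (λ y → Z y ∧ free used i y)
    weaken : ∀ {i} y → Z y ∧ free used i y ≡ true → Z y ∧ 𝒢 i y ≡ true
    weaken {i} y p = ∧-true⁺ (proj₁ (∧-true⁻ (Z y) p)) (proj₁ (∧-true⁻ (𝒢 i y) (proj₂ (∧-true⁻ (Z y) p))))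
    average : x * mass Z ≤ q * sumF f
    average = begin
      x * mass Z ≡⟨ sym (∑-* x _) ⟩
      ∑ (λ y → x * bit (Z y)) ≤⟨ ∑-mono pointwise ⟩
      ∑ (λ y → q * sumF (λ i → bit (Z y ∧ free used i y))) ≡⟨ trans (∑-* q _) (cong (q *_) (∑-sumF {x} _)) ⟩
      q * sumF f ∎
      where
      open ≤-Reasoning
      pointwise : ∀ y → x * bit (Z y) ≤ q * sumF (λ i → bit (Z y ∧ free used i y))
      pointwise y with Z y in e
      ... | false = ≤-trans (≤-reflexive (*-zeroʳ x)) z≤n
      ... | true = ≤-trans (≤-reflexive (*-identityʳ x)) (≤-trans (deg y e) (≤-reflexive (cong (q *_) (count≡sumF (λ i → free used i y)))))
    best : ∃ λ i → mass Z ≤ q * f i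
    best = argmax x-pos f average
      where
      argmax : ∀ {x} → 0 < x → (f : Fin x → ℕ) → x * mass Z ≤ q * sumF f → ∃ λ i → mass Z ≤ q * f i
      argmax {suc x} _ f le with sumF-average f
      ... | i , p = i , *-cancelˡ-≤ (suc x) (≤-trans le (≤-trans (*-monoʳ-≤ q p) (≤-reflexive (comm q (suc x) (f i)))))
        where
        comm : ∀ a b c → a * (b * c) ≡ b * (a * c)
        comm = solve-∀
    i : Fin x
    i = proj₁ best
    big : mass Z ≤ q * f i
    big = proj₂ best
    unused : ∀ b → used i ≡ b → used i ≡ false
    unused false e = e
    -- A used index has no free incidences, so it could not carry a positive share of `Z`.
    unused true e = ⊥-elim (<⇒≱ pos (≤-trans big (≤-reflexive (trans (cong (q *_) (mass-empty _ λ y → none y)) (*-zeroʳ q)))))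
      where
      none : ∀ y → Z y ∧ free used i y ≡ false
      none y rewrite e = trans (cong (Z y ∧_) (∧-zeroʳ (𝒢 i y))) (∧-zeroʳ (Z y))

  record Clones (D : ℕ) (used : Fin x → Bool) (Z : Y → Bool) (q : ℕ) (τ : ℕ) : Set where
    field
      clone : Fin D → Fin x
      clone-injective : ∀ d d′ → clone d ≡ clone d′ → d ≡ d′
      clone-unused : ∀ d → used (clone d) ≡ false
      good : Y → Bool
      good-Z : ∀ y → good y ≡ true → Z y ≡ true
      good-𝒢 : ∀ y → good y ≡ true → ∀ d → 𝒢 (clone d) y ≡ true
      good-mass : τ ≤ q * mass good

  free-degree : ∀ q K → 4 * q * K ≤ x → ∀ used (Z : Y → Bool) → count used ≤ K → (∀ y → Z y ≡ true → x ≤ 2 * q * degree y) →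
    ∀ y → Z y ≡ true → x ≤ 4 * q * count (λ i → free used i y)
  free-degree q K room used Z le deg y p = +-cancelʳ-≤ x _ _ (begin
    x + x ≤⟨ +-mono-≤ (deg y p) (deg y p) ⟩
    2 * q * degree y + 2 * q * degree y ≡⟨ double q (degree y) ⟩
    4 * q * degree y ≤⟨ *-monoʳ-≤ (4 * q) (≤-trans (count-∖ (λ i → 𝒢 i y) used) (+-monoʳ-≤ (count (λ i → free used i y)) le)) ⟩
    4 * q * (count (λ i → free used i y) + K) ≡⟨ *-distribˡ-+ (4 * q) _ K ⟩
    4 * q * count (λ i → free used i y) + 4 * q * K ≤⟨ +-monoʳ-≤ _ room ⟩
    4 * q * count (λ i → free used i y) + x ∎)
    where
    open ≤-Reasoning
    double : ∀ q d → 2 * q * d + 2 * q * d ≡ 4 * q * d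
    double = solve-∀

  mark : (Fin x → Bool) → Fin x → Fin x → Bool
  mark used i j = used j ∨ (j == i)

  mark-count : ∀ used i → count (mark used i) ≤ suc (count used)
  mark-count used i = ≤-trans (count-cover {P = mark used i} {Q = used} {R = λ j → j == i} λ j → ∨-true⁻ (used j))
    (≤-trans (+-monoʳ-≤ (count used) (≤-reflexive (trans (count≡sumF (λ j → j == i)) (sumF-δ1 i)))) (≤-reflexive (+-comm (count used) 1)))

  add-clone : ∀ {D used Z q Q} i → used i ≡ false → mass Z ≤ q * mass (λ y → Z y ∧ 𝒢 i y) →
    Clones D (mark used i) (λ y → Z y ∧ 𝒢 i y) Q (mass (λ y → Z y ∧ 𝒢 i y)) → Clones (suc D) used Z (q * Q) (mass Z)
  add-clone {D} {used} {Z} {q} {Q} i unused big rest = record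
    { clone = clone′
    ; clone-injective = inj
    ; clone-unused = λ { zero → unused ; (suc d) → proj₁ (avoid d) }
    ; good = good
    ; good-Z = λ y p → proj₁ (∧-true⁻ (Z y) (good-Z y p))
    ; good-𝒢 = λ { y p zero → proj₂ (∧-true⁻ (Z y) (good-Z y p)) ; y p (suc d) → good-𝒢 y p d }
    ; good-mass = ≤-trans big (≤-trans (*-monoʳ-≤ q good-mass) (≤-reflexive (sym (*-assoc q Q _)))) }
    where
    open Clones rest
    clone′ : Fin (suc D) → Fin x
    clone′ zero = i
    clone′ (suc d) = clone d
    avoid : ∀ d → used (clone d) ≡ false × (clone d == i) ≡ false
    avoid d = ∨-false⁻ (used (clone d)) (clone-unused d)
    inj : ∀ d d′ → clone′ d ≡ clone′ d′ → d ≡ d′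
    inj zero zero _ = refl
    inj zero (suc d′) e = ⊥-elim (dec-false⁻ (clone d′ ≟ i) (proj₂ (avoid d′)) (sym e))
    inj (suc d) zero e = ⊥-elim (dec-false⁻ (clone d ≟ i) (proj₂ (avoid d)) e)
    inj (suc d) (suc d′) e = cong suc (clone-injective d d′ e)

  -- One index at a time, each keeping at least a `1 / (4 q)` share of the surviving points. The
  -- degree condition is pointwise, so it survives the passage to a subset of `Z`.
  clones : 0 < x → ∀ q K → 4 * q * K ≤ x → ∀ D used Z → count used + D ≤ K → 0 < mass Z →
    (∀ y → Z y ≡ true → x ≤ 2 * q * degree y) → Clones D used Z ((4 * q) ^ D) (mass Z)
  clones x-pos q K room zero used Z le pos deg = record
    { clone = λ () ; clone-injective = λ () ; clone-unused = λ () ; good = Z ; good-Z = λ y p → p ; good-𝒢 = λ y p ()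
    ; good-mass = ≤-reflexive (sym (+-identityʳ _)) }
  clones x-pos q K room (suc D) used Z le pos deg = add-clone {D} {used} {Z} {4 * q} {(4 * q) ^ D} i (proj₁ (proj₂ picked)) big
    (clones x-pos q K room D (mark used i) (λ y → Z y ∧ 𝒢 i y)
      (≤-trans (+-monoˡ-≤ D (mark-count used i)) (≤-trans (≤-reflexive (sym (+-suc (count used) D))) le))
      (≰⇒> λ z → <⇒≱ pos (≤-trans big (≤-trans (*-monoʳ-≤ (4 * q) z) (≤-reflexive (*-zeroʳ (4 * q))))))
      (λ y p → deg y (proj₁ (∧-true⁻ (Z y) p))))
    where
    picked : ∃ λ i → used i ≡ false × mass Z ≤ 4 * q * mass (λ y → Z y ∧ 𝒢 i y)
    picked = pick x-pos (4 * q) used Z pos (free-degree q K room used Z (≤-trans (m≤m+n (count used) (suc D)) le) deg)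
    i : Fin x
    i = proj₁ picked
    big : mass Z ≤ 4 * q * mass (λ y → Z y ∧ 𝒢 i y)
    big = proj₂ (proj₂ picked)

  -- Points of degree below `x / (2 q)` account for at most half of the incidences, so the popular
  -- points have density at least `1 / (2 q)`.
  coordinate : 0 < x → 0 < everything → ∀ q K D used → 4 * q * K ≤ x → count used + D ≤ K →
    x * everything ≤ q * sumF (λ i → mass (𝒢 i)) → Clones D used (λ _ → true) (2 * q * (4 * q) ^ D) everything
  coordinate x-pos ev-pos q K D used room le dense = record
    { clone = clone ; clone-injective = clone-injective ; clone-unused = clone-unused ; good = good
    ; good-Z = λ _ _ → refl ; good-𝒢 = good-𝒢
    ; good-mass = ≤-trans Z-mass (≤-trans (*-monoʳ-≤ (2 * q) good-mass) (≤-reflexive (sym (*-assoc (2 * q) _ _)))) }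
    where
    Z : Y → Bool
    Z y = ⌊ x ≤? 2 * q * degree y ⌋
    Z-mass : everything ≤ 2 * q * mass Z
    Z-mass = *-cancelˡ-≤ x {{>-nonZero x-pos}} (+-cancelʳ-≤ (x * everything) _ _ (begin
      x * everything + x * everything ≤⟨ +-mono-≤ dense dense ⟩
      q * sumF (λ i → mass (𝒢 i)) + q * sumF (λ i → mass (𝒢 i)) ≡⟨ double q _ ⟩
      2 * q * sumF (λ i → mass (𝒢 i)) ≡⟨ trans (cong (2 * q *_) degrees) (sym (∑-* (2 * q) degree)) ⟩
      ∑ (λ y → 2 * q * degree y) ≤⟨ ∑-mono pointwise ⟩
      ∑ (λ y → x * (2 * q) * bit (Z y) + x * 1) ≡⟨ trans (∑-+ _ _) (cong₂ _+_ (∑-* (x * (2 * q)) _) (∑-* x _)) ⟩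
      x * (2 * q) * mass Z + x * everything ≡⟨ cong (_+ x * everything) (*-assoc x (2 * q) (mass Z)) ⟩
      x * (2 * q * mass Z) + x * everything ∎))
      where
      open ≤-Reasoning
      double : ∀ q d → q * d + q * d ≡ 2 * q * d
      double = solve-∀
      pointwise : ∀ y → 2 * q * degree y ≤ x * (2 * q) * bit (Z y) + x * 1
      pointwise y with x ≤? 2 * q * degree y
      ... | yes _ = ≤-trans (≤-trans (*-monoʳ-≤ (2 * q) (count-≤n (λ i → 𝒢 i y))) (≤-reflexive (trans (*-comm (2 * q) x) (sym (*-identityʳ _))))) (m≤m+n _ _)
      ... | no p = ≤-trans (<⇒≤ (≰⇒> p)) (≤-trans (≤-reflexive (sym (*-identityʳ x))) (m≤n+m _ _))
    C : Clones D used Z ((4 * q) ^ D) (mass Z)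
    C = clones x-pos q K room D used Z le
      (≰⇒> λ z → <⇒≱ ev-pos (≤-trans Z-mass (≤-trans (*-monoʳ-≤ (2 * q) z) (≤-reflexive (*-zeroʳ (2 * q))))))
      (λ y p → dec-true⁻ (x ≤? 2 * q * degree y) p)
    open Clones C

boxFactor : ℕ → ℕ → ℕ
boxFactor q D = 2 * q * (4 * q) ^ D

-- `K` bounds the indices already taken. Every coordinate takes `D` more at the current density
-- `1 / q`, which then drops to `1 / boxFactor q D`.
boxBound : ℕ → ℕ → ℕ → ℕ → ℕ
boxBound zero q D K = 1
boxBound (suc a) q D K = 4 * q * (K + D) + boxBound a (boxFactor q D) D (K + D)

boxBound-pos : ∀ a q D K → 0 < boxBound a q D K
boxBound-pos zero q D K = s≤s z≤n
boxBound-pos (suc a) q D K = ≤-trans (boxBound-pos a (boxFactor q D) D (K + D)) (m≤n+m _ (4 * q * (K + D)))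

record Box {x a : ℕ} (D : ℕ) (used : Fin x → Bool) (𝒢 : Vec (Fin x) a → Bool) : Set where
  field
    clone : Fin a → Fin D → Fin x
    clone-injective : ∀ c d c′ d′ → clone c d ≡ clone c′ d′ → c ≡ c′ × d ≡ d′
    clone-unused : ∀ c d → used (clone c d) ≡ false
    transversal : ∀ (σ : Fin a → Fin D) → 𝒢 (tabulate λ c → clone c (σ c)) ≡ true

^-pos : ∀ {x} a → 0 < x → 0 < x ^ a
^-pos zero p = s≤s z≤n
^-pos (suc a) p = *-mono-≤ p (^-pos a p)

module AddCoordinate {x a D Q τ : ℕ} (used : Fin x → Bool) (𝒢 : Vec (Fin x) (suc a) → Bool)
  (C : Popular.Clones (tuples x a) (λ i y → 𝒢 (i ∷ y)) D used (λ _ → true) Q τ) where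
  open Popular.Clones C

  used′ : Fin x → Bool
  used′ i = used i ∨ ⌊ any? (λ d → clone d ≟ i) ⌋

  used′-count : count used′ ≤ count used + D
  used′-count = ≤-trans (count-cover {P = used′} {Q = used} {R = λ i → ⌊ any? (λ d → clone d ≟ i) ⌋} λ i → ∨-true⁻ (used i))
    (+-monoʳ-≤ (count used) (count-covered clone _ λ i p → dec-true⁻ (any? (λ d → clone d ≟ i)) p))

  add-coordinate : Box D used′ good → Box D used 𝒢
  add-coordinate B = record
    { clone = cl
    ; clone-injective = inj
    ; clone-unused = λ { zero d → clone-unused d ; (suc c) d → proj₁ (avoid c d) }
    ; transversal = λ σ → good-𝒢 _ (B.transversal (σ ∘ suc)) (σ zero) }
    where
    module B = Box B
    avoid : ∀ c d → used (B.clone c d) ≡ false × ⌊ any? (λ d′ → clone d′ ≟ B.clone c d) ⌋ ≡ false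
    avoid c d = ∨-false⁻ (used (B.clone c d)) (B.clone-unused c d)
    cl : Fin (suc a) → Fin D → Fin x
    cl zero = clone
    cl (suc c) = B.clone c
    apart : ∀ d c d′ → clone d ≢ B.clone c d′
    apart d c d′ e = dec-false⁻ (any? (λ d → clone d ≟ B.clone c d′)) (proj₂ (avoid c d′)) (d , e)
    inj : ∀ c d c′ d′ → cl c d ≡ cl c′ d′ → c ≡ c′ × d ≡ d′
    inj zero d zero d′ e = refl , clone-injective d d′ e
    inj zero d (suc c′) d′ e = ⊥-elim (apart d c′ d′ e)
    inj (suc c) d zero d′ e = ⊥-elim (apart d′ c d (sym e))
    inj (suc c) d (suc c′) d′ e with B.clone-injective c d c′ d′ e
    ... | refl , p = refl , p

-- The theorem of Erdős on complete multipartite subhypergraphs: fix `D` clones for the first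
-- coordinate whose common link is dense, and induct on the link. Adding these clones to `used`
-- keeps the parts disjoint.
box : ∀ a q D K {x} (used : Fin x → Bool) (𝒢 : Vec (Fin x) a → Bool) → boxBound a q D K ≤ x → count used ≤ K →
  x ^ a ≤ q * Summation.mass (tuples x a) 𝒢 → Box D used 𝒢
box zero q D K used 𝒢 large few dense = record
  { clone = λ () ; clone-injective = λ () ; clone-unused = λ ()
  ; transversal = λ σ → bit-pos (≰⇒> λ z → <⇒≱ (s≤s z≤n) (≤-trans dense (≤-trans (*-monoʳ-≤ q z) (≤-reflexive (*-zeroʳ q))))) }
box (suc a) q D K {x} used 𝒢 large few dense = go (P.coordinate x-pos (subst (0 <_) (sym ev) (^-pos a x-pos)) q (K + D) D used
    (≤-trans (m≤m+n (4 * q * (K + D)) (boxBound a (boxFactor q D) D (K + D))) large) (+-monoˡ-≤ D few)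
    (≤-trans (≤-reflexive (cong (x *_) ev)) dense))
  where
  module P = Popular (tuples x a) (λ i y → 𝒢 (i ∷ y))
  x-pos : 0 < x
  x-pos = ≤-trans (boxBound-pos (suc a) q D K) large
  ev : Summation.everything (tuples x a) ≡ x ^ a
  ev = tuples-everything x a
  go : P.Clones D used (λ _ → true) (boxFactor q D) (Summation.everything (tuples x a)) → Box D used 𝒢
  go C = A.add-coordinate (box a (boxFactor q D) D (K + D) A.used′ (P.Clones.good C)
    (≤-trans (m≤n+m (boxBound a (boxFactor q D) D (K + D)) (4 * q * (K + D))) large)
    (≤-trans A.used′-count (+-monoˡ-≤ D few)) (≤-trans (≤-reflexive (sym ev)) (P.Clones.good-mass C)))
    where
    module A = AddCoordinate used 𝒢 C

record Constant {Y : Set} (S : Summation Y) {M : ℕ} (f : Fin M → Y → Bool) (Z : Y → Bool) (q τ : ℕ) : Set where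
  field
    part : Y → Bool
    value : Fin M → Bool
    part-Z : ∀ y → part y ≡ true → Z y ≡ true
    constant : ∀ y → part y ≡ true → ∀ j → f j y ≡ value j
    part-mass : τ ≤ q * Summation.mass S part

-- Pigeonhole on one Boolean at a time: keeping its more frequent value costs a factor 2.
halving : ∀ {Y} (S : Summation Y) M (f : Fin M → Y → Bool) Z q τ → τ ≤ q * Summation.mass S Z → Constant S f Z (2 ^ M * q) τ
halving S zero f Z q τ dense = record
  { part = Z ; value = λ () ; part-Z = λ y p → p ; constant = λ y p () ; part-mass = ≤-trans dense (≤-reflexive (cong (_* Summation.mass S Z) (sym (+-identityʳ q)))) }
halving {Y} S (suc M) f Z q τ dense = record
  { part = Constant.part rest
  ; value = λ { zero → v ; (suc j) → Constant.value rest j }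
  ; part-Z = λ y p → proj₁ (∧-true⁻ (Z y) (Constant.part-Z rest y p))
  ; constant = λ { y p zero → dec-true⁻ (f zero y ≟ᵇ v) (proj₂ (∧-true⁻ (Z y) (Constant.part-Z rest y p))) ; y p (suc j) → Constant.constant rest y p j }
  ; part-mass = ≤-trans (Constant.part-mass rest) (≤-reflexive (cong (_* Summation.mass S (Constant.part rest)) (alg (2 ^ M) q))) }
  where
  open Summation S
  alg : ∀ m q → m * (2 * q) ≡ 2 * m * q
  alg = solve-∀
  slice : Bool → Y → Bool
  slice b y = Z y ∧ ⌊ f zero y ≟ᵇ b ⌋
  slices : mass Z ≤ mass (slice true) + mass (slice false)
  slices = ≤-trans (∑-mono pointwise) (≤-reflexive (∑-+ _ _))
    where
    pointwise : ∀ y → bit (Z y) ≤ bit (slice true y) + bit (slice false y)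
    pointwise y with Z y | f zero y
    ... | false | _ = z≤n
    ... | true | true = s≤s z≤n
    ... | true | false = s≤s z≤n
  popular : ∃ λ v → mass Z ≤ 2 * mass (slice v)
  popular with ≤-total (mass (slice true)) (mass (slice false))
  ... | inj₁ p = false , ≤-trans slices (≤-trans (+-monoˡ-≤ _ p) (≤-reflexive (cong (mass (slice false) +_) (sym (+-identityʳ _)))))
  ... | inj₂ p = true , ≤-trans slices (≤-trans (+-monoʳ-≤ (mass (slice true)) p) (≤-reflexive (cong (mass (slice true) +_) (sym (+-identityʳ _)))))
  v : Bool
  v = proj₁ popular
  rest : Constant S (f ∘ suc) (slice v) (2 ^ M * (2 * q)) τ
  rest = halving S M (f ∘ suc) (slice v) (2 * q) τ (≤-trans dense (≤-trans (*-monoʳ-≤ q (proj₂ popular)) (≤-reflexive (alg2 q (mass (slice v))))))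
    where
    alg2 : ∀ q x → q * (2 * x) ≡ 2 * q * x
    alg2 = solve-∀

-- Exponential tail bounds

^-distribʳ-* : ∀ k m n → (m * n) ^ k ≡ m ^ k * n ^ k
^-distribʳ-* zero m n = refl
^-distribʳ-* (suc k) m n = trans (cong (m * n *_) (^-distribʳ-* k m n)) (alg m n (m ^ k) (n ^ k))
  where
  alg : ∀ a b c d → a * b * (c * d) ≡ a * c * (b * d)
  alg = solve-∀

-- For `β = B / A ≤ 1` this is `(1 + β)^L ≤ 1 + L β + 4^L β^2`, with denominators cleared.
binomial-upper : ∀ A B L → B ≤ A → (A + B) ^ L * (A * A) ≤ A ^ L * (A * A + L * (A * B) + 4 ^ L * (B * B))
binomial-upper A B zero B≤A = ≤-trans (m≤m+n _ (B * B)) (≤-reflexive (alg (A * A) (A * B) (B * B)))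
  where
  alg : ∀ x y z → 1 * x + z ≡ 1 * (x + 0 * y + 1 * z)
  alg = solve-∀
binomial-upper A B (suc L) B≤A = begin
  (A + B) * (A + B) ^ L * (A * A)
    ≡⟨ *-assoc (A + B) _ _ ⟩
  (A + B) * ((A + B) ^ L * (A * A))
    ≤⟨ *-monoʳ-≤ (A + B) (binomial-upper A B L B≤A) ⟩
  (A + B) * (A ^ L * (A * A + L * (A * B) + 4 ^ L * (B * B)))
    ≡⟨ alg1 A B L (A ^ L) (4 ^ L) ⟩
  A ^ L * (A * (A * A + suc L * (A * B)) + (4 ^ L + L) * (A * (B * B)) + 4 ^ L * (B * (B * B)))
    ≤⟨ *-monoʳ-≤ (A ^ L) (+-mono-≤ (+-monoʳ-≤ (A * (A * A + suc L * (A * B))) (*-monoˡ-≤ (A * (B * B)) (+-monoʳ-≤ (4 ^ L) (<⇒≤ (L<4^L L))))) (*-monoʳ-≤ (4 ^ L) (*-monoˡ-≤ (B * B) B≤A))) ⟩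
  A ^ L * (A * (A * A + suc L * (A * B)) + (4 ^ L + 4 ^ L) * (A * (B * B)) + 4 ^ L * (A * (B * B)))
    ≤⟨ *-monoʳ-≤ (A ^ L) (m≤m+n _ (4 ^ L * (A * (B * B)))) ⟩
  A ^ L * (A * (A * A + suc L * (A * B)) + (4 ^ L + 4 ^ L) * (A * (B * B)) + 4 ^ L * (A * (B * B)) + 4 ^ L * (A * (B * B)))
    ≡⟨ alg2 A B (suc L) (A ^ L) (4 ^ L) ⟩
  A * A ^ L * (A * A + suc L * (A * B) + 4 * 4 ^ L * (B * B)) ∎
  where
  open ≤-Reasoning
  alg1 : ∀ A B L P Q → (A + B) * (P * (A * A + L * (A * B) + Q * (B * B))) ≡
    P * (A * (A * A + suc L * (A * B)) + (Q + L) * (A * (B * B)) + Q * (B * (B * B)))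
  alg1 = solve-∀
  alg2 : ∀ A B L P Q → P * (A * (A * A + L * (A * B)) + (Q + Q) * (A * (B * B)) + Q * (A * (B * B)) + Q * (A * (B * B))) ≡
    A * P * (A * A + L * (A * B) + 4 * Q * (B * B))
  alg2 = solve-∀
  L<4^L : ∀ L → L < 4 ^ L
  L<4^L zero = s≤s z≤n
  L<4^L (suc L) = ≤-trans (+-mono-≤ (≤-trans (s≤s z≤n) (L<4^L L)) (L<4^L L)) (≤-trans (m≤m+n _ _) (≤-reflexive (alg (4 ^ L))))
    where
    alg : ∀ x → x + x + (x + x) ≡ 4 * x
    alg = solve-∀

-- The inequality `1 + (k + 1)/q ≤ (1 + 1/q)^(k + 1)` without denominators.
bernoulli : ∀ q k → q ^ suc k + suc k * q ^ k ≤ suc q ^ suc k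
bernoulli q zero = ≤-reflexive (alg q)
  where
  alg : ∀ q → q * 1 + 1 * 1 ≡ suc q * 1
  alg = solve-∀
bernoulli q (suc k) = ≤-trans (≤-trans (m≤m+n _ (suc k * q ^ k)) (≤-reflexive (alg q (q ^ k) k))) (*-monoʳ-≤ (suc q) (bernoulli q k))
  where
  alg : ∀ q p k → q * (q * p) + suc (suc k) * (q * p) + suc k * p ≡ suc q * (q * p + suc k * p)
  alg = solve-∀

total : ∀ {x a} → (Fin x → ℕ) → Vec (Fin x) a → ℕ
total g y = sumF (λ d → g (lookup y d))

exceeds : ∀ {x a} → (Fin x → ℕ) → ℕ → Vec (Fin x) a → Bool
exceeds g t y = ⌊ t ≤? total g y ⌋

module Moment (q r : ℕ) (q-pos : 0 < q) {x : ℕ} (g : Fin x → ℕ) (g≤r : ∀ i → g i ≤ r) where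
  -- The exponential weight `(1 + 1/q)^(g i)`, multiplied by `q^r` to stay an integer.
  ω : Fin x → ℕ
  ω i = suc q ^ g i * q ^ (r ∸ g i)

  moment : ∀ {a} → Vec (Fin x) a → ℕ
  moment [] = 1
  moment (i ∷ y) = ω i * moment y

  moment-sum : ∀ a → Summation.∑ (tuples x a) moment ≡ sumF ω ^ a
  moment-sum zero = refl
  moment-sum (suc a) = begin
    sumF (λ i → T.∑ (λ y → ω i * moment y)) ≡⟨ sumF-cong (λ i → trans (T.∑-* (ω i) moment) (trans (cong (ω i *_) (moment-sum a)) (*-comm (ω i) _))) ⟩
    sumF (λ i → sumF ω ^ a * ω i) ≡⟨ sumF-* (sumF ω ^ a) ω ⟩
    sumF ω ^ a * sumF ω ≡⟨ *-comm (sumF ω ^ a) _ ⟩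
    sumF ω * sumF ω ^ a ∎
    where
    open ≡-Reasoning
    module T = Summation (tuples x a)

  ω-scaled : ∀ i → q ^ g i * ω i ≡ suc q ^ g i * q ^ r
  ω-scaled i = trans (swap (q ^ g i) (suc q ^ g i) _) (cong (suc q ^ g i *_) (trans (sym (^-distribˡ-+-* q (g i) (r ∸ g i))) (cong (q ^_) (m+[n∸m]≡n (g≤r i)))))
    where
    swap : ∀ a b c → a * (b * c) ≡ b * (a * c)
    swap = solve-∀

  moment-scaled : ∀ {a} (y : Vec (Fin x) a) → q ^ total g y * moment y ≡ suc q ^ total g y * (q ^ r) ^ a
  moment-scaled [] = refl
  moment-scaled {suc a} (i ∷ y) = begin
    q ^ (g i + total g y) * (ω i * moment y)
      ≡⟨ cong (_* (ω i * moment y)) (^-distribˡ-+-* q (g i) (total g y)) ⟩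
    q ^ g i * q ^ total g y * (ω i * moment y)
      ≡⟨ inter (q ^ g i) _ (ω i) _ ⟩
    q ^ g i * ω i * (q ^ total g y * moment y)
      ≡⟨ cong₂ _*_ (ω-scaled i) (moment-scaled y) ⟩
    suc q ^ g i * q ^ r * (suc q ^ total g y * (q ^ r) ^ a)
      ≡⟨ inter (suc q ^ g i) _ _ _ ⟩
    suc q ^ g i * suc q ^ total g y * (q ^ r * (q ^ r) ^ a)
      ≡⟨ cong (_* (q ^ r * (q ^ r) ^ a)) (sym (^-distribˡ-+-* (suc q) (g i) (total g y))) ⟩
    suc q ^ (g i + total g y) * (q ^ r * (q ^ r) ^ a) ∎
    where
    open ≡-Reasoning
    inter : ∀ a b c d → a * b * (c * d) ≡ a * c * (b * d)
    inter = solve-∀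

  moment-large : ∀ {a} t (y : Vec (Fin x) a) → t ≤ total g y → suc q ^ t * (q ^ r) ^ a ≤ q ^ t * moment y
  moment-large {a} t y le = *-cancelˡ-≤ (q ^ u) {{>-nonZero (^-pos u q-pos)}} (begin
    q ^ u * (suc q ^ t * Q) ≤⟨ *-monoˡ-≤ (suc q ^ t * Q) (^-monoˡ-≤ u (n≤1+n q)) ⟩
    suc q ^ u * (suc q ^ t * Q) ≡⟨ sym (*-assoc (suc q ^ u) _ _) ⟩
    suc q ^ u * suc q ^ t * Q ≡⟨ cong (_* Q) (trans (sym (^-distribˡ-+-* (suc q) u t)) (cong (suc q ^_) ut)) ⟩
    suc q ^ total g y * Q ≡⟨ sym (moment-scaled y) ⟩
    q ^ total g y * moment y ≡⟨ cong (_* moment y) (trans (cong (q ^_) (sym ut)) (^-distribˡ-+-* q u t)) ⟩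
    q ^ u * q ^ t * moment y ≡⟨ *-assoc (q ^ u) _ _ ⟩
    q ^ u * (q ^ t * moment y) ∎)
    where
    open ≤-Reasoning
    u Q : ℕ
    u = total g y ∸ t
    Q = (q ^ r) ^ a
    ut : u + t ≡ total g y
    ut = m∸n+n≡m le

  markov : ∀ t a → suc q ^ t * (q ^ r) ^ a * Summation.mass (tuples x a) (exceeds g t) ≤ q ^ t * sumF ω ^ a
  markov t a = begin
    suc q ^ t * (q ^ r) ^ a * T.mass (exceeds g t) ≡⟨ sym (T.∑-* (suc q ^ t * (q ^ r) ^ a) (λ y → bit (exceeds g t y))) ⟩
    T.∑ (λ y → suc q ^ t * (q ^ r) ^ a * bit (exceeds g t y)) ≤⟨ T.∑-mono pointwise ⟩
    T.∑ (λ y → q ^ t * moment y) ≡⟨ trans (T.∑-* (q ^ t) moment) (cong (q ^ t *_) (moment-sum a)) ⟩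
    q ^ t * sumF ω ^ a ∎
    where
    open ≤-Reasoning
    module T = Summation (tuples x a)
    pointwise : ∀ y → suc q ^ t * (q ^ r) ^ a * bit (exceeds g t y) ≤ q ^ t * moment y
    pointwise y with t ≤? total g y
    ... | yes p = ≤-trans (≤-reflexive (*-identityʳ _)) (moment-large t y p)
    ... | no _ = ≤-trans (≤-reflexive (*-zeroʳ (suc q ^ t * (q ^ r) ^ a))) z≤n

  ω-upper : ∀ i → q * q * ω i ≤ q ^ r * (q * q + q * g i + 4 ^ r)
  ω-upper i = begin
    q * q * (suc q ^ g i * q ^ (r ∸ g i)) ≡⟨ alg1 (q * q) (suc q ^ g i) (q ^ (r ∸ g i)) ⟩
    q ^ (r ∸ g i) * (suc q ^ g i * (q * q)) ≤⟨ *-monoʳ-≤ (q ^ (r ∸ g i)) (≤-trans (≤-reflexive (cong (λ z → z ^ g i * (q * q)) (+-comm 1 q))) (binomial-upper q 1 (g i) q-pos)) ⟩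
    q ^ (r ∸ g i) * (q ^ g i * (q * q + g i * (q * 1) + 4 ^ g i * (1 * 1))) ≡⟨ alg2 (q ^ (r ∸ g i)) (q ^ g i) q (g i) (4 ^ g i) ⟩
    q ^ (r ∸ g i) * q ^ g i * (q * q + q * g i + 4 ^ g i) ≡⟨ cong (_* (q * q + q * g i + 4 ^ g i)) (trans (sym (^-distribˡ-+-* q (r ∸ g i) (g i))) (cong (q ^_) (m∸n+n≡m (g≤r i)))) ⟩
    q ^ r * (q * q + q * g i + 4 ^ g i) ≤⟨ *-monoʳ-≤ (q ^ r) (+-monoʳ-≤ (q * q + q * g i) (^-monoʳ-≤ 4 (g≤r i))) ⟩
    q ^ r * (q * q + q * g i + 4 ^ r) ∎
    where
    open ≤-Reasoning
    alg1 : ∀ a b c → a * (b * c) ≡ c * (b * a)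
    alg1 = solve-∀
    alg2 : ∀ a b q g f → a * (b * (q * q + g * (q * 1) + f * (1 * 1))) ≡ a * b * (q * q + q * g + f)
    alg2 = solve-∀

  ω-sum : ∀ L M → L * sumF g ≤ M * x → L * (q * q) * sumF ω ≤ x * q ^ r * (L * (q * q) + (M * q + L * 4 ^ r))
  ω-sum L M avg = begin
    L * (q * q) * sumF ω ≡⟨ *-assoc L _ _ ⟩
    L * (q * q * sumF ω) ≡⟨ cong (L *_) (sym (sumF-* (q * q) ω)) ⟩
    L * sumF (λ i → q * q * ω i) ≤⟨ *-monoʳ-≤ L (sumF-mono ω-upper) ⟩
    L * sumF (λ i → q ^ r * (q * q + q * g i + 4 ^ r)) ≡⟨ cong (L *_) expand ⟩
    L * (q ^ r * (x * (q * q) + q * sumF g + x * 4 ^ r)) ≡⟨ alg1 L (q ^ r) x q (sumF g) (4 ^ r) ⟩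
    q ^ r * (x * (L * (q * q)) + q * (L * sumF g) + x * (L * 4 ^ r)) ≤⟨ *-monoʳ-≤ (q ^ r) (+-monoˡ-≤ _ (+-monoʳ-≤ (x * (L * (q * q))) (*-monoʳ-≤ q avg))) ⟩
    q ^ r * (x * (L * (q * q)) + q * (M * x) + x * (L * 4 ^ r)) ≡⟨ alg2 (q ^ r) x L q M (4 ^ r) ⟩
    x * q ^ r * (L * (q * q) + (M * q + L * 4 ^ r)) ∎
    where
    open ≤-Reasoning
    expand : sumF (λ i → q ^ r * (q * q + q * g i + 4 ^ r)) ≡ q ^ r * (x * (q * q) + q * sumF g + x * 4 ^ r)
    expand = trans (sumF-* (q ^ r) (λ i → q * q + q * g i + 4 ^ r)) (cong (q ^ r *_)
      (trans (sumF-+ {x} (λ i → q * q + q * g i) (λ _ → 4 ^ r)) (cong₂ _+_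
        (trans (sumF-+ {x} (λ _ → q * q) (λ i → q * g i)) (cong₂ _+_ (sumF-const x (q * q)) (sumF-* q g))) (sumF-const x (4 ^ r)))))
    alg1 : ∀ L Q x q s K → L * (Q * (x * (q * q) + q * s + x * K)) ≡ Q * (x * (L * (q * q)) + q * (L * s) + x * (L * K))
    alg1 = solve-∀
    alg2 : ∀ Q x L q M K → Q * (x * (L * (q * q)) + q * (M * x) + x * (L * K)) ≡ x * Q * (L * (q * q) + (M * q + L * K))
    alg2 = solve-∀

  -- Markov's inequality for the moment, which factorizes over the coordinates. As proportions:
  -- `(1 + 1/q)^(-t)` times the `a`-th power of `1 + (M q + L 4^r) / (L q^2)`.
  chernoff : ∀ L M t a → L * sumF g ≤ M * x →
    suc q ^ t * (L * (q * q)) ^ a * Summation.mass (tuples x a) (exceeds g t) ≤ x ^ a * (q ^ t * (L * (q * q) + (M * q + L * 4 ^ r)) ^ a)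
  chernoff L M t a avg = *-cancelˡ-≤ Q {{>-nonZero (^-pos a (^-pos r q-pos))}} (begin
    Q * (suc q ^ t * (L * (q * q)) ^ a * m) ≡⟨ alg1 Q (suc q ^ t) ((L * (q * q)) ^ a) m ⟩
    (L * (q * q)) ^ a * (suc q ^ t * Q * m) ≤⟨ *-monoʳ-≤ ((L * (q * q)) ^ a) (markov t a) ⟩
    (L * (q * q)) ^ a * (q ^ t * sumF ω ^ a) ≡⟨ alg2 ((L * (q * q)) ^ a) (q ^ t) _ ⟩
    q ^ t * ((L * (q * q)) ^ a * sumF ω ^ a) ≡⟨ cong (q ^ t *_) (sym (^-distribʳ-* a (L * (q * q)) (sumF ω))) ⟩
    q ^ t * (L * (q * q) * sumF ω) ^ a ≤⟨ *-monoʳ-≤ (q ^ t) (^-monoˡ-≤ a (ω-sum L M avg)) ⟩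
    q ^ t * (x * q ^ r * U) ^ a ≡⟨ cong (q ^ t *_) (trans (^-distribʳ-* a (x * q ^ r) U) (cong (_* U ^ a) (^-distribʳ-* a x (q ^ r)))) ⟩
    q ^ t * (x ^ a * Q * U ^ a) ≡⟨ alg3 (q ^ t) (x ^ a) Q (U ^ a) ⟩
    Q * (x ^ a * (q ^ t * U ^ a)) ∎)
    where
    open ≤-Reasoning
    Q U m : ℕ
    Q = (q ^ r) ^ a
    U = L * (q * q) + (M * q + L * 4 ^ r)
    m = Summation.mass (tuples x a) (exceeds g t)
    alg1 : ∀ a b c d → a * (b * c * d) ≡ c * (b * a * d)
    alg1 = solve-∀
    alg2 : ∀ a b c → a * (b * c) ≡ b * (a * c)
    alg2 = solve-∀
    alg3 : ∀ a b c d → a * (b * c * d) ≡ c * (b * (a * d))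
    alg3 = solve-∀

-- The base q is chosen so large that the second-order terms in the Chernoff bound are absorbed.
module Base (r L M : ℕ) (L-pos : 0 < L) where
  K c q A B : ℕ
  K = 4 ^ r
  c = M + L * K
  q = suc (L * L * L * K + 4 ^ L * (c * c))
  A = L * (q * q)
  B = M * q + L * K

  q-pos : 0 < q
  q-pos = s≤s z≤n

  LK-pos : 0 < L * K
  LK-pos = *-mono-≤ L-pos (^-pos r (s≤s z≤n))

  c-pos : 0 < c
  c-pos = ≤-trans LK-pos (m≤n+m (L * K) M)

  c≤q : c ≤ q
  c≤q = begin
    c ≡⟨ sym (*-identityˡ c) ⟩
    1 * c ≤⟨ *-monoˡ-≤ c c-pos ⟩
    c * c ≡⟨ sym (*-identityˡ (c * c)) ⟩
    1 * (c * c) ≤⟨ *-monoˡ-≤ (c * c) (^-pos L (s≤s z≤n)) ⟩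
    4 ^ L * (c * c) ≤⟨ m≤n+m _ (L * L * L * K) ⟩
    L * L * L * K + 4 ^ L * (c * c) ≤⟨ n≤1+n _ ⟩
    q ∎
    where open ≤-Reasoning

  B≤cq : B ≤ c * q
  B≤cq = ≤-trans (+-monoʳ-≤ (M * q) (≤-trans (≤-reflexive (sym (*-identityʳ (L * K)))) (*-monoʳ-≤ (L * K) q-pos)))
    (≤-reflexive (sym (*-distribʳ-+ q M (L * K))))

  B≤A : B ≤ A
  B≤A = ≤-trans B≤cq (≤-trans (*-monoˡ-≤ q c≤q) (≤-trans (≤-reflexive (sym (*-identityˡ (q * q)))) (*-monoˡ-≤ (q * q) L-pos)))

  A-pos : 0 < A
  A-pos = *-mono-≤ L-pos (*-mono-≤ q-pos q-pos)

  second-order : q * (L * (A * B) + 4 ^ L * (B * B)) < suc M * (A * A)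
  second-order = begin-strict
    q * (L * (A * B) + 4 ^ L * (B * B))
      ≤⟨ *-monoʳ-≤ q (+-monoʳ-≤ (L * (A * B)) (*-monoʳ-≤ (4 ^ L) (*-mono-≤ B≤cq B≤cq))) ⟩
    q * (L * (L * (q * q) * (M * q + L * K)) + 4 ^ L * (c * q * (c * q)))
      ≡⟨ alg1 q L M K (4 ^ L) c ⟩
    M * (A * A) + q * q * q * (L * L * L * K + 4 ^ L * (c * c))
      <⟨ +-monoʳ-< (M * (A * A)) (*-monoʳ-< (q * q * q) {{>-nonZero (*-mono-≤ (*-mono-≤ q-pos q-pos) q-pos)}} (n<1+n _)) ⟩
    M * (A * A) + q * q * q * q
      ≤⟨ +-monoʳ-≤ (M * (A * A)) (≤-trans (≤-reflexive (sym (*-identityˡ _))) (*-monoˡ-≤ (q * q * q * q) (*-mono-≤ L-pos L-pos))) ⟩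
    M * (A * A) + L * L * (q * q * q * q)
      ≡⟨ alg2 M L q ⟩
    suc M * (A * A) ∎
    where
    open ≤-Reasoning
    alg1 : ∀ q L M K f c → q * (L * (L * (q * q) * (M * q + L * K)) + f * (c * q * (c * q))) ≡
      M * (L * (q * q) * (L * (q * q))) + q * q * q * (L * L * L * K + f * (c * c))
    alg1 = solve-∀
    alg2 : ∀ M L q → M * (L * (q * q) * (L * (q * q))) + L * L * (q * q * q * q) ≡ suc M * (L * (q * q) * (L * (q * q)))
    alg2 = solve-∀

  P₁ P₂ : ℕ
  P₁ = q ^ suc M * (A + B) ^ L
  P₂ = suc q ^ suc M * A ^ L

  -- To first order in `1/q` the power `(1 + B/A)^L` is `1 + M/q`, less than the lower bound
  -- `1 + (M + 1)/q` for `(1 + 1/q)^(M + 1)`.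
  P₁<P₂ : P₁ < P₂
  P₁<P₂ = *-cancelʳ-< (A * A) _ _ (begin-strict
    q ^ suc M * (A + B) ^ L * (A * A)
      ≡⟨ *-assoc (q ^ suc M) _ _ ⟩
    q ^ suc M * ((A + B) ^ L * (A * A))
      ≤⟨ *-monoʳ-≤ (q ^ suc M) (binomial-upper A B L B≤A) ⟩
    q ^ suc M * (A ^ L * (A * A + L * (A * B) + 4 ^ L * (B * B)))
      ≡⟨ alg1 q (q ^ M) (A ^ L) (A * A) (L * (A * B)) (4 ^ L * (B * B)) ⟩
    q ^ M * A ^ L * (q * (A * A) + q * (L * (A * B) + 4 ^ L * (B * B)))
      <⟨ *-monoʳ-< (q ^ M * A ^ L) {{>-nonZero (*-mono-≤ (^-pos M q-pos) (^-pos L A-pos))}} (+-monoʳ-< (q * (A * A)) second-order) ⟩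
    q ^ M * A ^ L * (q * (A * A) + suc M * (A * A))
      ≡⟨ alg2 q (q ^ M) (A ^ L) (A * A) (suc M) ⟩
    (q ^ suc M + suc M * q ^ M) * (A ^ L * (A * A))
      ≤⟨ *-monoˡ-≤ (A ^ L * (A * A)) (bernoulli q M) ⟩
    suc q ^ suc M * (A ^ L * (A * A))
      ≡⟨ sym (*-assoc (suc q ^ suc M) _ _) ⟩
    suc q ^ suc M * A ^ L * (A * A) ∎)
    where
    open ≤-Reasoning
    alg1 : ∀ q p a x y z → q * p * (a * (x + y + z)) ≡ p * a * (q * x + q * (y + z))
    alg1 = solve-∀
    alg2 : ∀ q p a x m → p * a * (q * x + m * x) ≡ (q * p + m * p) * (a * x)
    alg2 = solve-∀

  P₁-pos : 0 < P₁
  P₁-pos = *-mono-≤ (^-pos (suc M) q-pos) (^-pos L (≤-trans A-pos (m≤m+n A B)))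

-- Every block of `L` samples contributes a factor `P₁ / P₂`. As these are integers with `P₁ < P₂`,
-- it is at most `P₁ / (P₁ + 1)`, and `P₁` depends on `r`, `L` and `M` only.
tail-bound : ∀ r L M → 0 < L → ∃ λ k → 0 < k × (∀ {x} b (g : Fin x → ℕ) → (∀ i → g i ≤ r) → L * sumF g ≤ M * x →
  Summation.mass (tuples x (L * b)) (exceeds g (suc M * b)) * suc k ^ b ≤ k ^ b * x ^ (L * b))
tail-bound r L M L-pos = P₁ , P₁-pos , bound
  where
  open Base r L M L-pos
  bound : ∀ {x} b (g : Fin x → ℕ) → (∀ i → g i ≤ r) → L * sumF g ≤ M * x →
    Summation.mass (tuples x (L * b)) (exceeds g (suc M * b)) * suc P₁ ^ b ≤ P₁ ^ b * x ^ (L * b)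
  bound {x} b g g≤r avg = *-cancelˡ-≤ (P₁ ^ b) {{>-nonZero (^-pos b P₁-pos)}} (begin
    P₁ ^ b * (m * suc P₁ ^ b) ≡⟨ alg1 (P₁ ^ b) m _ ⟩
    m * (P₁ ^ b * suc P₁ ^ b) ≡⟨ cong (m *_) (sym (^-distribʳ-* b P₁ (suc P₁))) ⟩
    m * (P₁ * suc P₁) ^ b ≤⟨ *-monoʳ-≤ m (^-monoˡ-≤ b (*-monoʳ-≤ P₁ P₁<P₂)) ⟩
    m * (P₁ * P₂) ^ b ≡⟨ cong (m *_) (^-distribʳ-* b P₁ P₂) ⟩
    m * (P₁ ^ b * P₂ ^ b) ≡⟨ alg2 m (P₁ ^ b) (P₂ ^ b) ⟩
    P₁ ^ b * (P₂ ^ b * m) ≤⟨ *-monoʳ-≤ (P₁ ^ b) powered ⟩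
    P₁ ^ b * (x ^ (L * b) * P₁ ^ b) ≡⟨ cong (P₁ ^ b *_) (*-comm (x ^ (L * b)) _) ⟩
    P₁ ^ b * (P₁ ^ b * x ^ (L * b)) ∎)
    where
    open ≤-Reasoning
    m : ℕ
    m = Summation.mass (tuples x (L * b)) (exceeds g (suc M * b))
    alg1 : ∀ a b c → a * (b * c) ≡ b * (a * c)
    alg1 = solve-∀
    alg2 : ∀ a b c → a * (b * c) ≡ b * (c * a)
    alg2 = solve-∀
    power : ∀ u v w z → (u ^ v * w ^ z) ^ b ≡ u ^ (v * b) * w ^ (z * b)
    power u v w z = trans (^-distribʳ-* b (u ^ v) (w ^ z)) (cong₂ _*_ (^-*-assoc u v b) (^-*-assoc w z b))
    powered : P₂ ^ b * m ≤ x ^ (L * b) * P₁ ^ b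
    powered = ≤-trans (≤-reflexive (cong (_* m) (power (suc q) (suc M) A L)))
      (≤-trans (Moment.chernoff q r q-pos g g≤r L M (suc M * b) (L * b) avg)
      (≤-reflexive (cong (x ^ (L * b) *_) (sym (power q (suc M) (A + B) L)))))

-- Resampling one coordinate

-- Exchanging coordinate `c` with the fresh value `z` is a bijection of the pairs.
resample-swap : ∀ {x a} (c : Fin a) (h : Fin x → Vec (Fin x) a → ℕ) →
  Summation.∑ (tuples x a) (λ y → sumF (λ z → h (lookup y c) (y [ c ]≔ z))) ≡ Summation.∑ (tuples x a) (λ y → sumF (λ z → h z y))
resample-swap {x} {suc a} zero h = begin
  sumF (λ i → T.∑ (λ y → sumF (λ z → h i (z ∷ y)))) ≡⟨ sumF-cong {x} (λ i → T.∑-sumF (λ z y → h i (z ∷ y))) ⟩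
  sumF (λ i → sumF (λ z → T.∑ (λ y → h i (z ∷ y)))) ≡⟨ sumF-swap {x} {x} _ ⟩
  sumF (λ z → sumF (λ i → T.∑ (λ y → h i (z ∷ y)))) ≡⟨ sumF-cong {x} (λ z → sym (T.∑-sumF (λ i y → h i (z ∷ y)))) ⟩
  sumF (λ z → T.∑ (λ y → sumF (λ i → h i (z ∷ y)))) ∎
  where
  open ≡-Reasoning
  module T = Summation (tuples x a)
resample-swap {x} {suc a} (suc c) h = sumF-cong {x} λ i → resample-swap c (λ z y → h z (i ∷ y))

-- The sets to be avoided depend on sampled classes, so tail bounds for fixed sets do not apply
-- directly. Once coordinate `c` is replaced by a fresh value, its old value is an independent
-- parameter that can be held fixed.
resample : ∀ {x a} (c : Fin a) (f : Vec (Fin x) a → ℕ) (h : Fin x → Vec (Fin x) a → ℕ) {B} → 0 < x →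
  (∀ y z → f y ≤ h (lookup y c) (y [ c ]≔ z)) → (∀ z → Summation.∑ (tuples x a) (h z) ≤ B) → Summation.∑ (tuples x a) f ≤ B
resample {x} {a} c f h {B} x-pos f≤h h≤B = *-cancelˡ-≤ x {{>-nonZero x-pos}} (begin
  x * T.∑ f ≡⟨ sym (T.∑-* x f) ⟩
  T.∑ (λ y → x * f y) ≤⟨ T.∑-mono (λ y → ≤-trans (≤-reflexive (sym (sumF-const x (f y)))) (sumF-mono (f≤h y))) ⟩
  T.∑ (λ y → sumF (λ z → h (lookup y c) (y [ c ]≔ z))) ≡⟨ resample-swap c h ⟩
  T.∑ (λ y → sumF (λ z → h z y)) ≡⟨ T.∑-sumF h ⟩
  sumF (λ z → T.∑ (h z)) ≤⟨ sumF-≤const h≤B ⟩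
  x * B ∎)
  where
  open ≤-Reasoning
  module T = Summation (tuples x a)

total-update : ∀ {x a r} (g : Fin x → ℕ) → (∀ i → g i ≤ r) → (y : Vec (Fin x) a) (c : Fin a) (z : Fin x) →
  total g y ≤ total g (y [ c ]≔ z) + r
total-update {r = r} g g≤r (i ∷ y) zero z = ≤-trans (+-mono-≤ (g≤r i) (m≤n+m (total g y) (g z))) (≤-reflexive (+-comm r _))
total-update {r = r} g g≤r (i ∷ y) (suc c) z = ≤-trans (+-monoʳ-≤ (g i) (total-update g g≤r y c z)) (≤-reflexive (sym (+-assoc (g i) _ r)))

-- Random reduced digraphs

hits : ∀ {n x r} → (Fin x → Fin r → Fin n) → (Fin n → Bool) → Fin x → ℕ
hits ν Q α = sumF (λ i → bit (Q (ν α i)))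

hits≤r : ∀ {n x r} (ν : Fin x → Fin r → Fin n) Q α → hits ν Q α ≤ r
hits≤r {r = r} ν Q α = ≤-trans (sumF-≤const λ i → bit≤1 (Q (ν α i))) (≤-reflexive (*-identityʳ r))

choose : ∀ {x a} → Fin x → Vec (Fin x) a → Fin (suc a) → Fin x
choose Λ y zero = Λ
choose Λ y (suc d) = lookup y d

class : ∀ {N r} → Fin (N * r) → Fin N
class {N} {r} p = proj₁ (remQuot {N} r p)

role : ∀ {N r} → Fin (N * r) → Fin r
role {N} {r} p = proj₂ (remQuot {N} r p)

-- Edges inside a class are discarded, because different clones of a class need not see each other alike.
reduced : ∀ {n x r N} → Digraph n → (Fin x → Fin r → Fin n) → (Fin N → Fin x) → Digraph (N * r)
reduced {r = r} {N} G ν s p q = not (class {N} {r} p == class {N} {r} q) ∧ G (ν (s (class {N} {r} p)) (role {N} {r} p)) (ν (s (class {N} {r} q)) (role {N} {r} q))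

-- Vertices of an independent set of the reduced digraph lie in each other's out-misses; farMiss, which is empty
-- when u and v are close, forces them to be pairwise close, and closeMiss then bounds their number.
data Kind : Set where
  outMiss inMiss closeMiss farMiss : Kind

kinds : Fin 4 → Kind
kinds zero = outMiss
kinds (suc zero) = inMiss
kinds (suc (suc zero)) = closeMiss
kinds (suc (suc (suc zero))) = farMiss

kindIndex : ∀ k → ∃ λ j → kinds j ≡ k
kindIndex outMiss = zero , refl
kindIndex inMiss = suc zero , refl
kindIndex closeMiss = suc (suc zero) , refl
kindIndex farMiss = suc (suc (suc zero)) , refl

kindSet : ∀ {n} → Digraph n → (Fin n → Fin n → Bool) → Kind → Fin n → Fin n → Fin n → Bool
kindSet G close outMiss v u z = not (G v z)
kindSet G close inMiss v u z = not (G z v)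
kindSet G close closeMiss v u z = not (G v z) ∧ close z v
kindSet G close farMiss v u z = not (close u v) ∧ (not (G u z) ∧ not (G v z))

module Counting {n x r a : ℕ} (G : Digraph n) (ν : Fin x → Fin r → Fin n) (Λ : Fin x) (y : Vec (Fin x) a) where
  N : ℕ
  N = suc a
  s : Fin N → Fin x
  s = choose Λ y
  cls : Fin (N * r) → Fin N
  cls = class {N} {r}
  vtx : Fin (N * r) → Fin n
  vtx p = ν (s (cls p)) (role {N} {r} p)
  RG : Digraph (N * r)
  RG = reduced {N = N} G ν s

  class-combine : ∀ c i → cls (combine c i) ≡ c
  class-combine c i = cong proj₁ (remQuot-combine c i)

  vtx-combine : ∀ c i → vtx (combine c i) ≡ ν (s c) i
  vtx-combine c i = cong (λ { (c , i) → ν (s c) i }) (remQuot-combine c i)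

  -- The `3 r` stands for three whole classes: `c₁`, `c₂` and the phantom class, which is not among
  -- the random coordinates.
  count-classes : ∀ (P : Fin (N * r) → Bool) (Q : Fin n → Bool) c₁ c₂ →
    (∀ p → P p ≡ true → cls p ≡ c₁ ⊎ cls p ≡ c₂ ⊎ Q (vtx p) ≡ true) →
    count P ≤ 3 * r + total (hits ν Q) y
  count-classes P Q c₁ c₂ h = begin
    count P
      ≡⟨ count≡sumF P ⟩
    sumF (λ p → bit (P p))
      ≡⟨ sumF-combine N {r} (λ p → bit (P p)) ⟩
    sumF {N} (λ c → sumF {r} (λ i → bit (P (combine c i))))
      ≤⟨ sumF-mono {N} (λ c → sumF-mono {r} (λ i → bit-≤ (P (combine c i)) (λ p → split c i (h _ p)))) ⟩
    sumF (λ c → sumF (λ i → bit (c == c₁) + bit (c == c₂) + bit (Q (ν (s c) i))))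
      ≡⟨ sumF-cong {N} (λ c → trans (sumF-+ {r} (λ _ → bit (c == c₁) + bit (c == c₂)) (λ i → bit (Q (ν (s c) i)))) (cong (_+ hits ν Q (s c)) (trans (sumF-const r _) (*-distribˡ-+ r (bit (c == c₁)) (bit (c == c₂)))))) ⟩
    sumF (λ c → r * bit (c == c₁) + r * bit (c == c₂) + hits ν Q (s c))
      ≡⟨ trans (sumF-+ {N} (λ c → F c₁ c + F c₂ c) (λ c → hits ν Q (s c))) (cong (_+ sumF (λ c → hits ν Q (s c))) (trans (sumF-+ {N} (F c₁) (F c₂)) (cong₂ _+_ (one c₁) (one c₂)))) ⟩
    r + r + (hits ν Q Λ + total (hits ν Q) y)
      ≤⟨ +-monoʳ-≤ (r + r) (+-monoˡ-≤ _ (hits≤r ν Q Λ)) ⟩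
    r + r + (r + total (hits ν Q) y)
      ≡⟨ alg r (total (hits ν Q) y) ⟩
    3 * r + total (hits ν Q) y ∎
    where
    open ≤-Reasoning
    alg : ∀ r t → r + r + (r + t) ≡ 3 * r + t
    alg = solve-∀
    F : Fin N → Fin N → ℕ
    F c₁ c = r * bit (c == c₁)
    one : ∀ c₁ → sumF (F c₁) ≡ r
    one c₁ = trans (sumF-* {N} r (λ c → bit (c == c₁))) (trans (cong (r *_) (sumF-δ1 c₁)) (*-identityʳ r))
    split : ∀ c i → cls (combine c i) ≡ c₁ ⊎ cls (combine c i) ≡ c₂ ⊎ Q (vtx (combine c i)) ≡ true →
      1 ≤ bit (c == c₁) + bit (c == c₂) + bit (Q (ν (s c) i))
    split c i (inj₁ e) = ≤-trans (≤-reflexive (cong bit (sym (dec-true (c ≟ c₁) (trans (sym (class-combine c i)) e)))))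
      (≤-trans (m≤m+n _ (bit (c == c₂))) (m≤m+n _ _))
    split c i (inj₂ (inj₁ e)) = ≤-trans (≤-reflexive (cong bit (sym (dec-true (c ≟ c₂) (trans (sym (class-combine c i)) e)))))
      (≤-trans (m≤n+m _ (bit (c == c₁))) (m≤m+n _ _))
    split c i (inj₂ (inj₂ e)) = ≤-trans (≤-reflexive (cong bit (sym (trans (cong Q (sym (vtx-combine c i))) e))))
      (m≤n+m _ (bit (c == c₁) + bit (c == c₂)))

  nonedge : ∀ p q → RG p q ≡ false → cls q ≡ cls p ⊎ not (G (vtx p) (vtx q)) ≡ true
  nonedge p q e with cls p ≟ cls q
  ... | yes c = inj₁ (sym c)
  ... | no _ = inj₂ (not-true⁺ e)

-- The sets depend on the sampled classes `c` and `c′`. The `2 * r` pays for resampling both.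
record Typical {n x r a : ℕ} (G : Digraph n) (close : Fin n → Fin n → Bool) (ν : Fin x → Fin r → Fin n) (b : ℕ) (M : Kind → ℕ)
  (Λ : Fin x) (y : Vec (Fin x) a) : Set where
  field
    few : ∀ k c c′ → c ≢ c′ → ∀ i i′ →
      total (hits ν (kindSet G close k (ν (choose Λ y c) i) (ν (choose Λ y c′) i′))) y < suc (M k) * b + 2 * r

-- `L * b` classes are sampled besides the phantom. In `m`, one extra `b` covers `ε` and rounding,
-- another the random deviation, and `5 * r` the three uncounted classes and two resampled
-- coordinates. `C` is chosen so that `C b = (2 r + 1) d`, the room required by
-- `slack + 2 d r + d ≤ m`.
record Scale (r κ P b : ℕ) : Set where
  field
    r-pos : 0 < r
    dominates : growth r (r ∸ 1) < κ
    b-large : 5 * r ≤ b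

  C L m e d slack : ℕ
  C = (2 * r + 1) * κ * (3 * r)
  L = C + suc P
  m = suc (suc L) * b + 5 * r
  e = 3 * r * b
  d = κ * e
  slack = suc P * b + 5 * r

  M : Kind → ℕ
  M outMiss = suc L
  M inMiss = suc L
  M closeMiss = P
  M farMiss = P

  b-pos : 0 < b
  b-pos = ≤-trans (*-mono-≤ {1} {5} (s≤s z≤n) r-pos) b-large

module Typical⇒Balanced {n x r κ P b : ℕ} (σ : Scale r κ P b) (G : Digraph n) (close : Fin n → Fin n → Bool) (ν : Fin x → Fin r → Fin n)
  (Λ : Fin x) (y : Vec (Fin x) (Scale.L σ * b)) (typ : Typical G close ν b (Scale.M σ) Λ y) where
  open Scale σ
  open Counting G ν Λ y
  open Typical typ

  a-pos : 0 < L * b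
  a-pos = *-mono-≤ {1} {L} (≤-trans (s≤s z≤n) (m≤n+m (suc P) C)) b-pos

  other : ∀ (c : Fin N) → ∃ λ c′ → c ≢ c′
  other zero = suc (fromℕ< a-pos) , λ ()
  other (suc c) = zero , λ ()

  set : Kind → Fin n → Fin n → Fin n → Bool
  set = kindSet G close

  bound : ∀ k p q → cls p ≢ cls q → 3 * r + total (hits ν (set k (vtx p) (vtx q))) y < suc (M k) * b + 5 * r
  bound k p q ne = ≤-trans (+-monoʳ-< (3 * r) (few k (cls p) (cls q) ne (role {N} {r} p) (role {N} {r} q))) (≤-reflexive (alg r (suc (M k) * b)))
    where
    alg : ∀ r z → 3 * r + (z + 2 * r) ≡ z + 5 * r
    alg = solve-∀

  -- A vertex in another class, to have a second argument for the kinds that ignore it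
  partner : ∀ p → ∃ λ q → cls p ≢ cls q
  partner p = combine (proj₁ (other (cls p))) (fromℕ< r-pos) , λ e → proj₂ (other (cls p)) (trans e (class-combine _ _))

  missAtMost : MissAtMost RG m
  missAtMost = record
    { out = λ v → ≤-trans (count-classes _ (set outMiss (vtx v) (vtx (proj₁ (partner v)))) (cls v) (cls v)
        (λ q e → case nonedge v q (not-true⁻ e) of λ { (inj₁ c) → inj₁ c ; (inj₂ f) → inj₂ (inj₂ f) }))
        (<⇒≤ (bound outMiss v (proj₁ (partner v)) (proj₂ (partner v))))
    ; inn = λ v → ≤-trans (count-classes _ (set inMiss (vtx v) (vtx (proj₁ (partner v)))) (cls v) (cls v)
        (λ q e → case nonedge q v (not-true⁻ e) of λ { (inj₁ c) → inj₁ (sym c) ; (inj₂ f) → inj₂ (inj₂ f) }))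
        (<⇒≤ (bound inMiss v (proj₁ (partner v)) (proj₂ (partner v)))) }

  slack-pos : 0 < slack
  slack-pos = ≤-trans (*-mono-≤ {1} {5} (s≤s z≤n) r-pos) (m≤n+m (5 * r) (suc P * b))

  edge : ∀ U → slack ≤ count U → ∃ λ u → ∃ λ v → U u ≡ true × U v ≡ true × RG u v ≡ true
  edge U large with any? (λ u → any? (λ v → (U u ≟ᵇ true) ×-dec ((U v ≟ᵇ true) ×-dec (RG u v ≟ᵇ true))))
  ... | yes found = found
  ... | no none = ⊥-elim (<⇒≱ small large)
    where
    free : ∀ p q → U p ≡ true → U q ≡ true → cls q ≡ cls p ⊎ not (G (vtx p) (vtx q)) ≡ true
    free p q up uq = nonedge p q (not-true⁻ (lem (bool-split (RG p q))))
      where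
      lem : RG p q ≡ true ⊎ RG p q ≡ false → not (RG p q) ≡ true
      lem (inj₁ e) = ⊥-elim (none (p , q , up , uq , e))
      lem (inj₂ e) = not-true⁺ e
    v : Fin (N * r)
    v = proj₁ (count-pos U (≤-trans slack-pos large))
    uv : U v ≡ true
    uv = proj₂ (count-pos U (≤-trans slack-pos large))
    near : ∀ u → U u ≡ true → cls v ≢ cls u → close (vtx u) (vtx v) ≡ true
    near u uu ne with bool-split (close (vtx u) (vtx v))
    ... | inj₁ e = e
    ... | inj₂ e = ⊥-elim (<⇒≱ (≤-<-trans (count-classes U (set farMiss (vtx v) (vtx u)) (cls u) (cls v)
            (λ z uz → cover (free u z uu uz) (free v z uv uz))) (bound farMiss v u ne)) large)
      where
      cover : ∀ {z} → cls z ≡ cls u ⊎ not (G (vtx u) (vtx z)) ≡ true → cls z ≡ cls v ⊎ not (G (vtx v) (vtx z)) ≡ true →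
        cls z ≡ cls u ⊎ cls z ≡ cls v ⊎ set farMiss (vtx v) (vtx u) (vtx z) ≡ true
      cover (inj₁ p) _ = inj₁ p
      cover (inj₂ _) (inj₁ q) = inj₂ (inj₁ q)
      cover (inj₂ p) (inj₂ q) = inj₂ (inj₂ (∧-true⁺ (not-true⁺ e) (∧-true⁺ p q)))
    small : count U < slack
    small = ≤-<-trans (count-classes U (set closeMiss (vtx v) (vtx w)) (cls v) (cls v) (λ z uz → cover z uz (free v z uv uz) (cls v ≟ cls z)))
      (bound closeMiss v w (proj₂ (partner v)))
      where
      w : Fin (N * r)
      w = proj₁ (partner v)
      cover : ∀ z → U z ≡ true → cls z ≡ cls v ⊎ not (G (vtx v) (vtx z)) ≡ true → Dec (cls v ≡ cls z) →
        cls z ≡ cls v ⊎ cls z ≡ cls v ⊎ set closeMiss (vtx v) (vtx w) (vtx z) ≡ true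
      cover z uz _ (yes c) = inj₁ (sym c)
      cover z uz (inj₁ c) (no ne) = inj₁ c
      cover z uz (inj₂ f) (no ne) = inj₂ (inj₂ (∧-true⁺ f (near z uz ne)))

  κ-pos : 0 < κ
  κ-pos = ≤-trans (s≤s z≤n) dominates

  3rκ≤C : 3 * r * κ ≤ C
  3rκ≤C = ≤-trans (≤-reflexive (trans (*-comm (3 * r) κ) (sym (cong (_* (3 * r)) (*-identityˡ κ))))) (*-monoˡ-≤ (3 * r) (*-monoˡ-≤ κ (m≤n+m 1 (2 * r))))

  C≤L : C ≤ L
  C≤L = m≤m+n C (suc P)

  fits-in : slack + 2 * d * r + d ≤ m
  fits-in = begin
    suc P * b + 5 * r + 2 * (κ * (3 * r * b)) * r + κ * (3 * r * b) ≡⟨ alg1 r κ b (suc P) ⟩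
    ((2 * r + 1) * κ * (3 * r) + suc P) * b + 5 * r ≤⟨ +-monoˡ-≤ (5 * r) (*-monoˡ-≤ b (≤-trans (n≤1+n L) (n≤1+n (suc L)))) ⟩
    m ∎
    where
    open ≤-Reasoning
    alg1 : ∀ r κ b p → p * b + 5 * r + 2 * (κ * (3 * r * b)) * r + κ * (3 * r * b) ≡ ((2 * r + 1) * κ * (3 * r) + p) * b + 5 * r
    alg1 = solve-∀

  d≤m : d ≤ m
  d≤m = ≤-trans (m≤n+m d _) fits-in

  slack≤s : slack + 2 * d * r ≤ m ∸ d
  slack≤s = m+n≤o⇒m≤o∸n (slack + 2 * d * r) fits-in

  -- `r m` exceeds `r L b` by `2 r b + 5 r^2`, and `5 r ≤ b` turns this into the three multiples of
  -- `r b` that form `e`.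
  cover : r * m ≤ N * r + e
  cover = begin
    r * (suc (suc L) * b + 5 * r) ≡⟨ alg1 r L b ⟩
    r * (L * b) + 2 * (r * b) + r * (5 * r) ≤⟨ +-monoʳ-≤ (r * (L * b) + 2 * (r * b)) (*-monoʳ-≤ r b-large) ⟩
    r * (L * b) + 2 * (r * b) + r * b ≤⟨ m≤n+m _ r ⟩
    r + (r * (L * b) + 2 * (r * b) + r * b) ≡⟨ alg2 r L b ⟩
    suc (L * b) * r + 3 * r * b ∎
    where
    open ≤-Reasoning
    alg1 : ∀ r L b → r * (suc (suc L) * b + 5 * r) ≡ r * (L * b) + 2 * (r * b) + r * (5 * r)
    alg1 = solve-∀
    alg2 : ∀ r L b → r + (r * (L * b) + 2 * (r * b) + r * b) ≡ suc (L * b) * r + 3 * r * b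
    alg2 = solve-∀

  e<m : e < m
  e<m = ≤-trans (s≤s (*-monoˡ-≤ b (≤-trans (≤-trans (≤-reflexive (sym (*-identityʳ (3 * r)))) (*-monoʳ-≤ (3 * r) κ-pos)) (≤-trans 3rκ≤C C≤L))))
    (≤-trans (≤-reflexive (+-comm 1 (L * b))) (+-mono-≤ (*-monoˡ-≤ b (≤-trans (n≤1+n L) (n≤1+n (suc L)))) (*-mono-≤ {1} {5} (s≤s z≤n) r-pos)))

  -- `(j + 1) m ≤ r m ≤ N r + e`, while `e < m`.
  room : ∀ {j} → j < r → j * m < N * r
  room {j} j<r = +-cancelʳ-< e _ _ (<-≤-trans (+-monoʳ-< (j * m) e<m) (≤-trans (≤-reflexive (+-comm (j * m) m)) (≤-trans (*-monoˡ-≤ m j<r) cover)))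

  tiny : κ * (r * e) ≤ N * r
  tiny = begin
    κ * (r * (3 * r * b)) ≡⟨ alg κ r b ⟩
    3 * r * κ * b * r ≤⟨ *-monoˡ-≤ r (*-monoˡ-≤ b (≤-trans 3rκ≤C C≤L)) ⟩
    L * b * r ≤⟨ *-monoˡ-≤ r (n≤1+n (L * b)) ⟩
    N * r ∎
    where
    open ≤-Reasoning
    alg : ∀ k r b → k * (r * (3 * r * b)) ≡ 3 * r * k * b * r
    alg = solve-∀

  balanced : Balanced r κ RG m (m ∸ d) d e
  balanced = record
    { host = record { misses = missAtMost ; split = m∸n+n≡m d≤m ; slack = slack ; slack-≤ = slack≤s ; edge = edge }
    ; s-pos = ≤-trans slack-pos (≤-trans (m≤m+n slack _) slack≤s)
    ; e-pos = *-mono-≤ {1} {3 * r} (*-mono-≤ {1} {3} (s≤s z≤n) r-pos) b-pos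
    ; cover = cover
    ; room = room
    ; dominates = dominates
    ; gap = n≤1+n d
    ; tiny = tiny }

-- Most samples are typical

∑-sumF-≤ : ∀ {Y : Set} (S : Summation Y) Q n (f : Fin n → Y → ℕ) {X} → (∀ i → Q * Summation.∑ S (f i) ≤ X) →
  Q * Summation.∑ S (λ y → sumF (λ i → f i y)) ≤ n * X
∑-sumF-≤ S Q n f {X} h = begin
  Q * ∑ (λ y → sumF (λ i → f i y)) ≡⟨ cong (Q *_) (∑-sumF f) ⟩
  Q * sumF (λ i → ∑ (f i)) ≡⟨ sym (sumF-* {n} Q (λ i → ∑ (f i))) ⟩
  sumF (λ i → Q * ∑ (f i)) ≤⟨ sumF-≤const h ⟩
  n * X ∎
  where
  open ≤-Reasoning
  open Summation S

module Sampling {n x r κ P b : ℕ} (σ : Scale r κ P b) (G : Digraph n) (close : Fin n → Fin n → Bool) (ν : Fin x → Fin r → Fin n)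
  (x-pos : 0 < x)
  (average : ∀ k v u → Scale.L σ * sumF (hits ν (kindSet G close k v u)) ≤ Scale.M σ k * x)
  (unlikely : ∀ k (g : Fin x → ℕ) → (∀ i → g i ≤ r) → Scale.L σ * sumF g ≤ Scale.M σ k * x →
    8 * (suc (Scale.L σ * b) * suc (Scale.L σ * b)) * (r * r) * Summation.mass (tuples x (Scale.L σ * b)) (exceeds g (suc (Scale.M σ k) * b))
      ≤ x ^ (Scale.L σ * b)) where
  open Scale σ

  a N X : ℕ
  a = L * b
  N = suc a
  X = x ^ a

  S : Summation (Vec (Fin x) a)
  S = tuples x a
  open Summation S

  hit : Kind → Fin x → Fin r → Fin x → Fin r → Fin x → ℕ
  hit k α i β i′ = hits ν (kindSet G close k (ν α i) (ν β i′))

  hit≤r : ∀ k α i β i′ γ → hit k α i β i′ γ ≤ r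
  hit≤r k α i β i′ = hits≤r ν (kindSet G close k (ν α i) (ν β i′))

  -- `w` is the part of the threshold held back for resampling, `r` for each coordinate still to be
  -- resampled.
  failure : ℕ → Fin x → Fin x → Vec (Fin x) a → Fin 4 → Fin r → Fin r → ℕ
  failure w α β y j i i′ = bit (exceeds (hit (kinds j) α i β i′) (suc (M (kinds j)) * b + w) y)

  failures : ℕ → Fin x → Fin x → Vec (Fin x) a → ℕ
  failures w α β y = sumF {4} (λ j → sumF {r} (λ i → sumF {r} (λ i′ → failure w α β y j i i′)))

  sum₃-mono : ∀ {f g : Fin 4 → Fin r → Fin r → ℕ} → (∀ j i i′ → f j i i′ ≤ g j i i′) →
    sumF (λ j → sumF (λ i → sumF (λ i′ → f j i i′))) ≤ sumF (λ j → sumF (λ i → sumF (λ i′ → g j i i′)))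
  sum₃-mono {f} {g} h = sumF-mono {4} {λ j → sumF (λ i → sumF (f j i))} {λ j → sumF (λ i → sumF (g j i))} λ j → sumF-mono {r} λ i → sumF-mono {r} (h j i)

  failures-weaken : ∀ w α β y → failures w α β y ≤ failures 0 α β y
  failures-weaken w α β y = sum₃-mono λ j i i′ → bit-mono λ e →
    dec-true (_ ≤? _) (≤-trans (+-monoʳ-≤ (suc (M (kinds j)) * b) z≤n) (dec-true⁻ (suc (M (kinds j)) * b + w ≤? total (hit (kinds j) α i β i′) y) e))

  failures-update : ∀ w α β y d z → failures (w + r) α β y ≤ failures w α β (y [ d ]≔ z)
  failures-update w α β y d z = sum₃-mono λ j i i′ → bit-mono λ e →
    dec-true (_ ≤? _) (+-cancelʳ-≤ r _ _ (≤-trans (≤-reflexive (+-assoc (suc (M (kinds j)) * b) w r))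
      (≤-trans (dec-true⁻ (suc (M (kinds j)) * b + (w + r) ≤? total (hit (kinds j) α i β i′) y) e)
        (total-update (hit (kinds j) α i β i′) (hit≤r (kinds j) α i β i′) y d z))))

  -- Proportion at most `1 / (2 N^2)`, so that a union over the `N^2` pairs of classes leaves half
  -- of the samples.
  Rare : (Vec (Fin x) a → ℕ) → Set
  Rare f = 2 * (N * N) * ∑ f ≤ X

  rare-mono : ∀ {f g} → (∀ y → f y ≤ g y) → Rare g → Rare f
  rare-mono h rare = ≤-trans (*-monoʳ-≤ (2 * (N * N)) (∑-mono h)) rare

  rare-0 : ∀ {f} → (∀ y → f y ≡ 0) → Rare f
  rare-0 {f} h = ≤-trans (≤-reflexive (trans (cong (2 * (N * N) *_) (trans (∑-cong h) ∑-0)) (*-zeroʳ (2 * (N * N))))) z≤n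

  rare-resample : ∀ d (f : Vec (Fin x) a → ℕ) (h : Fin x → Vec (Fin x) a → ℕ) →
    (∀ y z → f y ≤ h (lookup y d) (y [ d ]≔ z)) → (∀ z → Rare (h z)) → Rare f
  rare-resample d f h le rare = ≤-trans (≤-reflexive (sym (∑-* c f)))
    (resample d (λ y → c * f y) (λ z y → c * h z y) x-pos (λ y z → *-monoʳ-≤ c (le y z))
      (λ z → ≤-trans (≤-reflexive (∑-* c (h z))) (rare z)))
    where
    c : ℕ
    c = 2 * (N * N)

  rare-failures : ∀ w α β → Rare (failures w α β)
  rare-failures w α β = rare-mono (failures-weaken w α β) (*-cancelˡ-≤ (4 * (r * r)) {{>-nonZero (*-mono-≤ {1} {4} (s≤s z≤n) (*-mono-≤ r-pos r-pos))}} (begin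
    4 * (r * r) * (2 * (N * N) * ∑ (failures 0 α β))
      ≡⟨ alg1 r (N * N) (∑ (failures 0 α β)) ⟩
    Q * ∑ (failures 0 α β)
      ≤⟨ ∑-sumF-≤ S Q 4 _ (λ j → ∑-sumF-≤ S Q r _ (λ i → ∑-sumF-≤ S Q r (λ i′ y → failure 0 α β y j i i′) (single j i))) ⟩
    4 * (r * (r * X))
      ≡⟨ alg2 r X ⟩
    4 * (r * r) * X ∎))
    where
    open ≤-Reasoning
    Q : ℕ
    Q = 8 * (N * N) * (r * r)
    alg1 : ∀ r n s → 4 * (r * r) * (2 * n * s) ≡ 8 * n * (r * r) * s
    alg1 = solve-∀
    alg2 : ∀ r X → 4 * (r * (r * X)) ≡ 4 * (r * r) * X
    alg2 = solve-∀
    single : ∀ j i i′ → Q * ∑ (λ y → failure 0 α β y j i i′) ≤ X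
    single j i i′ = ≤-trans (*-monoʳ-≤ Q (≤-reflexive (∑-cong λ y → cong (λ t → bit (exceeds (hit (kinds j) α i β i′) t y)) (+-identityʳ (suc (M (kinds j)) * b)))))
      (unlikely (kinds j) (hit (kinds j) α i β i′) (hit≤r (kinds j) α i β i′) (average (kinds j) (ν α i) (ν β i′)))

  pairFailure : Fin x → Fin N → Fin N → Vec (Fin x) a → ℕ
  pairFailure Λ c c′ y = bit (not (c == c′)) * failures (r + r) (choose Λ y c) (choose Λ y c′) y

  -- Two random classes are resampled one after the other. In a pair with the phantom class only one
  -- coordinate is random. Afterwards the sets are fixed and `rare-failures` applies.
  rare-pair : ∀ Λ c c′ → Rare (pairFailure Λ c c′)
  rare-pair Λ c c′ with c ≟ c′
  ... | yes _ = rare-0 λ y → refl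
  ... | no ne = rare-mono (λ y → ≤-reflexive (+-identityʳ _)) (distinct c c′ ne)
    where
    one : ∀ w α d → Rare (λ y → failures (w + r) α (lookup y d) y)
    one w α d = rare-resample d _ (λ β y → failures w α β y) (λ y z → failures-update w α (lookup y d) y d z) (rare-failures w α)
    distinct : ∀ c c′ → c ≢ c′ → Rare (λ y → failures (r + r) (choose Λ y c) (choose Λ y c′) y)
    distinct zero zero ne = ⊥-elim (ne refl)
    distinct zero (suc d) ne = one r Λ d
    distinct (suc d) zero ne = rare-resample d _ (λ α y → failures r α Λ y) (λ y z → failures-update r (lookup y d) Λ y d z) (λ α → rare-failures r α Λ)
    distinct (suc d) (suc d′) ne = rare-resample d _ (λ α y → failures r α (lookup y d′) y)
      (λ y z → ≤-trans (failures-update r (lookup y d) (lookup y d′) y d z)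
        (≤-reflexive (cong (λ β → failures r (lookup y d) β (y [ d ]≔ z)) (sym (lookup∘update′ (λ e → ne (cong suc (sym e))) y z)))))
      (λ α → one 0 α d′)

  allFailures : Fin x → Vec (Fin x) a → ℕ
  allFailures Λ y = sumF {N} (λ c → sumF {N} (λ c′ → pairFailure Λ c c′ y))

  typical : Fin x → Vec (Fin x) a → Bool
  typical Λ y = ⌊ allFailures Λ y <? 1 ⌋

  typical⇒Typical : ∀ Λ y → typical Λ y ≡ true → Typical G close ν b M Λ y
  typical⇒Typical Λ y e = record { few = λ k c c′ ne i i′ → ≰⇒> λ le → <⇒≱ (dec-true⁻ (allFailures Λ y <? 1) e) (found k c c′ ne i i′ le) }
    where
    found : ∀ k c c′ → c ≢ c′ → ∀ i i′ → suc (M k) * b + 2 * r ≤ total (hit k (choose Λ y c) i (choose Λ y c′) i′) y → 1 ≤ allFailures Λ y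
    found k c c′ ne i i′ le with kindIndex k
    ... | j , refl = begin
      1 ≡⟨ cong bit (sym (dec-true (suc (M (kinds j)) * b + (r + r) ≤? total (hit (kinds j) α i β i′) y)
             (≤-trans (≤-reflexive (cong (λ z → suc (M (kinds j)) * b + (r + z)) (sym (+-identityʳ r)))) le))) ⟩
      failure (r + r) α β y j i i′ ≤⟨ term≤sumF {r} (failure (r + r) α β y j i) i′ ⟩
      sumF (failure (r + r) α β y j i) ≤⟨ term≤sumF {r} (λ i → sumF (failure (r + r) α β y j i)) i ⟩
      sumF (λ i → sumF (failure (r + r) α β y j i)) ≤⟨ term≤sumF {4} (λ j → sumF (λ i → sumF (failure (r + r) α β y j i))) j ⟩
      failures (r + r) α β y ≡⟨ sym (+-identityʳ _) ⟩
      1 * failures (r + r) α β y ≡⟨ cong (λ t → bit (not t) * failures (r + r) α β y) (sym (dec-false (c ≟ c′) ne)) ⟩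
      pairFailure Λ c c′ y ≤⟨ term≤sumF {N} (λ c′ → pairFailure Λ c c′ y) c′ ⟩
      sumF (λ c′ → pairFailure Λ c c′ y) ≤⟨ term≤sumF {N} (λ c → sumF (λ c′ → pairFailure Λ c c′ y)) c ⟩
      allFailures Λ y ∎
      where
      open ≤-Reasoning
      α β : Fin x
      α = choose Λ y c
      β = choose Λ y c′

  half-typical : ∀ Λ → X ≤ 2 * mass (typical Λ)
  half-typical Λ = +-cancelʳ-≤ X _ _ (begin
    X + X ≡⟨ cong (λ z → z + z) (sym (tuples-everything x a)) ⟩
    ∑ (λ _ → 1) + ∑ (λ _ → 1) ≡⟨ alg1 (∑ (λ _ → 1)) ⟩
    2 * ∑ (λ _ → 1) ≤⟨ *-monoʳ-≤ 2 (∑-mono cover) ⟩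
    2 * ∑ (λ y → bit (typical Λ y) + allFailures Λ y) ≡⟨ trans (cong (2 *_) (∑-+ _ _)) (*-distribˡ-+ 2 (mass (typical Λ)) _) ⟩
    2 * mass (typical Λ) + 2 * ∑ (allFailures Λ) ≤⟨ +-monoʳ-≤ (2 * mass (typical Λ)) union ⟩
    2 * mass (typical Λ) + X ∎)
    where
    open ≤-Reasoning
    alg1 : ∀ z → z + z ≡ 2 * z
    alg1 = solve-∀
    cover : ∀ y → 1 ≤ bit (typical Λ y) + allFailures Λ y
    cover y with allFailures Λ y <? 1
    ... | yes _ = s≤s z≤n
    ... | no p = ≮⇒≥ p
    union : 2 * ∑ (allFailures Λ) ≤ X
    union = *-cancelˡ-≤ (N * N) (begin
      N * N * (2 * ∑ (allFailures Λ)) ≡⟨ alg2 (N * N) (∑ (allFailures Λ)) ⟩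
      Q * ∑ (allFailures Λ) ≤⟨ ∑-sumF-≤ S Q N _ (λ c → ∑-sumF-≤ S Q N (pairFailure Λ c) (rare-pair Λ c)) ⟩
      N * (N * X) ≡⟨ sym (*-assoc N N X) ⟩
      N * N * X ∎)
      where
      Q : ℕ
      Q = 2 * (N * N)
      alg2 : ∀ n s → n * (2 * s) ≡ 2 * n * s
      alg2 = solve-∀

-- Augmenting a packing

-- `super c` lists the classes that may stand in for the sampled class `c`. Those for class `zero`
-- are phantoms, so that using them destroys no copy of the packing.
record Blowup {n r k p a : ℕ} (G : Digraph n) (ν : Fin (k + p) → Fin r → Fin n) (E : Digraph (suc a * r)) (D : ℕ) : Set where
  field
    super : Fin (suc a) → Fin D → Fin (k + p)
    super-injective : ∀ c d c′ d′ → super c d ≡ super c′ d′ → c ≡ c′ × d ≡ d′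
    super-zero : ∀ d j → super zero d ≢ j ↑ˡ p
    homogeneous : ∀ u v → E u v ≡ true → ∀ d d′ →
      G (ν (super (class {suc a} {r} u) d) (role {suc a} {r} u)) (ν (super (class {suc a} {r} v) d′) (role {suc a} {r} v)) ≡ true

class-role-injective : ∀ {N r} (u v : Fin (N * r)) → class {N} {r} u ≡ class {N} {r} v → role {N} {r} u ≡ role {N} {r} v → u ≡ v
class-role-injective {N} {r} u v p q = trans (sym (combine-remQuot {N} r u)) (trans (cong₂ combine p q) (combine-remQuot {N} r v))

module Rebuild {n r k p a t D : ℕ} {T : Digraph r} (tour : IsTournament T) (G : Digraph n) (ν : Fin (k + p) → Fin r → Fin n)
  (ν-injective : ∀ j i j′ i′ → ν j i ≡ ν j′ i′ → j ≡ j′ × i ≡ i′)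
  (isCopy₀ : ∀ j → Copy T G (ν (j ↑ˡ p)))
  {E : Digraph (suc a * r)} (loop : Loopless E) (B : Blowup {k = k} {p} {a} G ν E D) (F : Family T E t) (load≤D : ∀ v → Family.load F v ≤ D)
  (aD<t : a * D < t) where
  open Blowup B
  open Family F

  vertex : Fin t → Fin r → Fin (suc a * r)
  vertex = copy

  cls : Fin t → Fin r → Fin (suc a)
  cls j ρ = class {suc a} {r} (vertex j ρ)

  clone : Fin t → Fin r → Fin D
  clone j ρ = fromℕ< (<-≤-trans (label< j ρ) (load≤D (vertex j ρ)))

  new : Fin t → Fin r → Fin n
  new j ρ = ν (super (cls j ρ) (clone j ρ)) (role {suc a} {r} (vertex j ρ))

  new-isCopy : ∀ j → Copy T G (new j)
  new-isCopy j ρ ρ′ e = homogeneous (vertex j ρ) (vertex j ρ′) (isCopy j ρ ρ′ e) (clone j ρ) (clone j ρ′)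

  new-injective : ∀ j ρ j′ ρ′ → new j ρ ≡ new j′ ρ′ → j ≡ j′ × ρ ≡ ρ′
  new-injective j ρ j′ ρ′ e = j≡j′ , same-role j′ j≡j′ vertices
    where
    supers : super (cls j ρ) (clone j ρ) ≡ super (cls j′ ρ′) (clone j′ ρ′) × role {suc a} {r} (vertex j ρ) ≡ role {suc a} {r} (vertex j′ ρ′)
    supers = ν-injective _ _ _ _ e
    classes : cls j ρ ≡ cls j′ ρ′ × clone j ρ ≡ clone j′ ρ′
    classes = super-injective _ _ _ _ (proj₁ supers)
    vertices : vertex j ρ ≡ vertex j′ ρ′
    vertices = class-role-injective {suc a} {r} _ _ (proj₁ classes) (proj₂ supers)
    labels : label j ρ ≡ label j′ ρ′
    labels = trans (sym (toℕ-fromℕ< (<-≤-trans (label< j ρ) (load≤D (vertex j ρ))))) (trans (cong toℕ (proj₂ classes))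
      (toℕ-fromℕ< (<-≤-trans (label< j′ ρ′) (load≤D (vertex j′ ρ′)))))
    j≡j′ : j ≡ j′
    j≡j′ = separated j ρ j′ ρ′ vertices labels
    same-role : ∀ j′ → j ≡ j′ → vertex j ρ ≡ vertex j′ ρ′ → ρ ≡ ρ′
    same-role .j refl q = copy-injective {E = E} tour loop (isCopy j) ρ ρ′ q

  reused : Fin (k + p) → Bool
  reused i = ⌊ any? {n = a} (λ c → any? {n = D} (λ d → super (suc c) d ≟ i)) ⌋

  reused-count : count reused ≤ a * D
  reused-count = count-covered (λ j → super (suc (proj₁ (remQuot {a} D j))) (proj₂ (remQuot {a} D j))) reused covers
    where
    covers : ∀ i → reused i ≡ true → ∃ λ j → super (suc (proj₁ (remQuot {a} D j))) (proj₂ (remQuot {a} D j)) ≡ i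
    covers i e with dec-true⁻ (any? {n = a} (λ c → any? {n = D} (λ d → super (suc c) d ≟ i))) e
    ... | c , d , q = combine c d , trans (cong (λ { (c , d) → super (suc c) d }) (remQuot-combine c d)) q

  touched : Fin k → Bool
  touched j = reused (j ↑ˡ p)

  touched-count : count touched ≤ a * D
  touched-count = ≤-trans (≤-reflexive (count≡sumF touched)) (≤-trans (sumF-image (_↑ˡ p) reused (↑ˡ-injective p)) reused-count)

  rest : ℕ
  rest = count (not ∘ touched)

  old : Fin rest → Fin k
  old = proj₁ (enumerate (not ∘ touched))

  old-untouched : ∀ u → touched (old u) ≡ false
  old-untouched u = not-true⁻ (proj₁ (proj₂ (enumerate (not ∘ touched))) u)

  old-injective : ∀ u u′ → old u ≡ old u′ → u ≡ u′
  old-injective = proj₂ (proj₂ (enumerate (not ∘ touched)))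

  -- An old copy is lost only if it is a clone of one of the `a` classes other than the phantom, so
  -- at most `a * D` are lost for `t` new ones.
  more : k < t + rest
  more = ≤-<-trans (≤-trans (≤-reflexive (sym (count-not touched))) (+-monoˡ-≤ rest touched-count)) (+-monoˡ-< rest aD<t)

  new≢old : ∀ j ρ u ρ′ → new j ρ ≢ ν (old u ↑ˡ p) ρ′
  new≢old j ρ u ρ′ e = apart (cls j ρ) (clone j ρ) (proj₁ (ν-injective _ _ _ _ e))
    where
    apart : ∀ c d → super c d ≢ old u ↑ˡ p
    apart zero d q = super-zero d (old u) q
    apart (suc c) d q = dec-false⁻ (any? {n = a} (λ c → any? {n = D} (λ d → super (suc c) d ≟ old u ↑ˡ p))) (old-untouched u) (c , d , q)

  place : Fin t ⊎ Fin rest → Fin r → Fin n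
  place (inj₁ j) = new j
  place (inj₂ u) = ν (old u ↑ˡ p)

  place-injective : ∀ s i s′ i′ → place s i ≡ place s′ i′ → s ≡ s′ × i ≡ i′
  place-injective (inj₁ j) i (inj₁ j′) i′ e with new-injective j i j′ i′ e
  ... | refl , q = refl , q
  place-injective (inj₁ j) i (inj₂ u) i′ e = ⊥-elim (new≢old j i u i′ e)
  place-injective (inj₂ u) i (inj₁ j) i′ e = ⊥-elim (new≢old j i′ u i (sym e))
  place-injective (inj₂ u) i (inj₂ u′) i′ e with ν-injective _ _ _ _ e
  ... | p₁ , q = cong inj₂ (old-injective u u′ (↑ˡ-injective p _ _ p₁)) , q

  place-isCopy : ∀ s → Copy T G (place s)
  place-isCopy (inj₁ j) = new-isCopy j
  place-isCopy (inj₂ u) = isCopy₀ (old u)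

  augmented : ∃ λ k′ → k < k′ × Σ (Fin k′ → Fin r → Fin n) (IsTPacking T G k′)
  augmented = t + rest , more , (λ j → place (splitAt t j)) ,
    (λ j j′ i i′ e → split-injective j j′ (proj₁ (place-injective _ _ _ _ e)) , proj₂ (place-injective (splitAt t j) i (splitAt t j′) i′ e)) ,
    (λ j → place-isCopy (splitAt t j))
    where
    split-injective : ∀ j j′ → splitAt t {rest} j ≡ splitAt t j′ → j ≡ j′
    split-injective j j′ e = trans (sym (join-splitAt t rest j)) (trans (cong (join t rest) e) (join-splitAt t rest j′))

-- The phantom coordinate ranges over the p leftover classes only, so that the box yields D of them.
module Homogenize {n r k p a D q : ℕ} (G : Digraph n) (ν : Fin (k + p) → Fin r → Fin n)
  (typical : Fin (k + p) → Vec (Fin (k + p)) a → Bool)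
  (half : ∀ Λ → (k + p) ^ a ≤ 2 * Summation.mass (tuples (k + p) a) (typical Λ))
  (q≡ : 2 ^ ((suc a * r) * (suc a * r)) * 2 ≡ q) (D-pos : 0 < D) (p-pos : 0 < p) (p-large : 4 * q * D ≤ p)
  (x-large : boxBound a (boxFactor q D) D D ≤ k + p) where
  x N V : ℕ
  x = k + p
  N = suc a
  V = N * r

  open Summation (tuples x a) using (∑; mass; everything)

  S : Summation (Fin p × Vec (Fin x) a)
  S = finite p ⊗ tuples x a

  sample : Fin p × Vec (Fin x) a → Fin N → Fin x
  sample (γ , y) = choose (k ↑ʳ γ) y

  RG : Fin p × Vec (Fin x) a → Digraph V
  RG z = reduced {N = N} G ν (sample z)

  adjacency : Fin (V * V) → Fin p × Vec (Fin x) a → Bool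
  adjacency j z = RG z (proj₁ (remQuot {V} V j)) (proj₂ (remQuot {V} V j))

  Z : Fin p × Vec (Fin x) a → Bool
  Z (γ , y) = typical (k ↑ʳ γ) y

  Z-mass : p * x ^ a ≤ 2 * Summation.mass S Z
  Z-mass = ≤-trans (≤-reflexive (sym (sumF-const p (x ^ a)))) (≤-trans (sumF-mono {p} (λ γ → half (k ↑ʳ γ)))
    (≤-reflexive (sumF-* {p} 2 (λ γ → mass (typical (k ↑ʳ γ))))))

  -- There is one Boolean for each ordered pair of the `V` vertices. The last factor 2 in `q` comes
  -- from the samples that are not typical.
  uniform : Constant S adjacency Z q (p * x ^ a)
  uniform = subst (λ z → Constant S adjacency Z z (p * x ^ a)) q≡ (halving S (V * V) adjacency Z 2 (p * x ^ a) Z-mass)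

  module WithPattern (part : Fin p × Vec (Fin x) a → Bool) (value : Fin (V * V) → Bool)
    (part-Z : ∀ z → part z ≡ true → Z z ≡ true)
    (constant : ∀ z → part z ≡ true → ∀ j → adjacency j z ≡ value j)
    (part-mass : p * x ^ a ≤ q * Summation.mass S part) where
    module P = Popular (tuples x a) (λ γ y → part (γ , y))

    x-pos : 0 < x
    x-pos = ≤-trans p-pos (m≤n+m p k)

    ev : everything ≡ x ^ a
    ev = tuples-everything x a

    none : Fin p → Bool
    none _ = false

    none-count : count none ≡ 0
    none-count = trans (count≡sumF none) (sumF-0 {p} λ _ → refl)

    phantoms : P.Clones D none (λ _ → true) (boxFactor q D) everything
    phantoms = P.coordinate p-pos (subst (0 <_) (sym ev) (^-pos a x-pos)) q D D none p-large (≤-reflexive (cong (_+ D) none-count))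
      (≤-trans (≤-reflexive (cong (p *_) ev)) part-mass)

    module WithPhantoms (C : P.Clones D none (λ _ → true) (boxFactor q D) everything) where
      open P.Clones C

      used : Fin x → Bool
      used i = ⌊ any? (λ d → k ↑ʳ clone d ≟ i) ⌋

      used-count : count used ≤ D
      used-count = count-covered (λ d → k ↑ʳ clone d) used λ i e → dec-true⁻ (any? (λ d → k ↑ʳ clone d ≟ i)) e

      boxed : Box D used good
      boxed = box a (boxFactor q D) D D used good x-large used-count (≤-trans (≤-reflexive (sym ev)) good-mass)

      module WithBox (B : Box D used good) where
        module B = Box B

        super : Fin N → Fin D → Fin x
        super zero d = k ↑ʳ clone d
        super (suc c) d = B.clone c d

        transversal : (Fin N → Fin D) → Fin p × Vec (Fin x) a
        transversal τ = clone (τ zero) , tabulate (λ c → B.clone c (τ (suc c)))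

        sample-transversal : ∀ τ c → sample (transversal τ) c ≡ super c (τ c)
        sample-transversal τ zero = refl
        sample-transversal τ (suc c) = lookup∘tabulate (λ c → B.clone c (τ (suc c))) c

        inside : ∀ τ → part (transversal τ) ≡ true
        inside τ = good-𝒢 _ (B.transversal (τ ∘ suc)) (τ zero)

        first : Fin N → Fin D
        first _ = fromℕ< D-pos

        base : Fin p × Vec (Fin x) a
        base = transversal first

        base-typical : Z base ≡ true
        base-typical = part-Z base (inside first)

        same-pattern : ∀ τ u v → RG base u v ≡ RG (transversal τ) u v
        same-pattern τ u v = trans (at base) (trans (trans (constant base (inside first) j) (sym (constant (transversal τ) (inside τ) j))) (sym (at (transversal τ))))
          where
          j : Fin (V * V)
          j = combine u v
          at : ∀ z → RG z u v ≡ adjacency j z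
          at z = cong (λ { (u , v) → RG z u v }) (sym (remQuot-combine u v))

        cls : Fin V → Fin N
        cls = class {N} {r}
        rol : Fin V → Fin r
        rol = role {N} {r}

        -- An edge joins different classes, so a single transversal can select clone `d` in the
        -- class of `u` and `d′` in that of `v`. It induces the same digraph as `base`.
        homogeneous : ∀ u v → RG base u v ≡ true → ∀ d d′ → G (ν (super (cls u) d) (rol u)) (ν (super (cls v) d′) (rol v)) ≡ true
        homogeneous u v e d d′ = trans (cong₂ (λ i j → G (ν i (rol u)) (ν j (rol v))) (sym (at-u)) (sym (at-v)))
          (proj₂ (∧-true⁻ (not (cls u == cls v)) (trans (sym (same-pattern τ u v)) e)))
          where
          apart : cls u ≢ cls v
          apart = dec-false⁻ (cls u ≟ cls v) (not-true⁻ (proj₁ (∧-true⁻ (not (cls u == cls v)) e)))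
          τ : Fin N → Fin D
          τ c = if cls u == c then d else d′
          at-u : sample (transversal τ) (cls u) ≡ super (cls u) d
          at-u = trans (sample-transversal τ (cls u)) (cong (λ t → super (cls u) (if t then d else d′)) (==-refl (cls u)))
          at-v : sample (transversal τ) (cls v) ≡ super (cls v) d′
          at-v = trans (sample-transversal τ (cls v)) (cong (λ t → super (cls v) (if t then d else d′)) (dec-false (cls u ≟ cls v) apart))

        super-injective : ∀ c d c′ d′ → super c d ≡ super c′ d′ → c ≡ c′ × d ≡ d′
        super-injective zero d zero d′ e = refl , clone-injective d d′ (↑ʳ-injective k _ _ e)
        super-injective zero d (suc c′) d′ e = ⊥-elim (dec-false⁻ (any? (λ d → k ↑ʳ clone d ≟ B.clone c′ d′)) (B.clone-unused c′ d′) (d , e))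
        super-injective (suc c) d zero d′ e = ⊥-elim (dec-false⁻ (any? (λ δ → k ↑ʳ clone δ ≟ B.clone c d)) (B.clone-unused c d) (d′ , sym e))
        super-injective (suc c) d (suc c′) d′ e with B.clone-injective c d c′ d′ e
        ... | refl , q′ = refl , q′

        left≢right : ∀ {k p} (i : Fin p) (j : Fin k) → k ↑ʳ i ≢ j ↑ˡ p
        left≢right {k} {p} i j e = case trans (sym (splitAt-↑ʳ k p i)) (trans (cong (splitAt k) e) (splitAt-↑ˡ k j p)) of λ ()

        result : ∃ λ z → Z z ≡ true × Blowup {k = k} {p} {a} G ν (RG z) D
        result = base , base-typical , record
          { super = super ; super-injective = super-injective ; super-zero = λ d j → left≢right (clone d) j ; homogeneous = homogeneous }

  homogenized : ∃ λ z → Z z ≡ true × Blowup {k = k} {p} {a} G ν (RG z) D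
  homogenized = W.WithPhantoms.WithBox.result W.phantoms (W.WithPhantoms.boxed W.phantoms)
    where
    open Constant uniform
    module W = WithPattern part value part-Z constant part-mass

-- Completing a packing to a partition into classes

module Classes {n r k : ℕ} (φ : Fin k → Fin r → Fin n) (φ-injective : ∀ j j′ i i′ → φ j i ≡ φ j′ i′ → j ≡ j′ × i ≡ i′)
  (p : ℕ) (room : (k + p) * r ≤ n) where
  covered : Fin n → Bool
  covered v = ⌊ any? (λ j → any? (λ i → φ j i ≟ v)) ⌋

  covered-count : count covered ≤ k * r
  covered-count = count-covered (λ z → φ (proj₁ (remQuot {k} r z)) (proj₂ (remQuot {k} r z))) covered covers
    where
    covers : ∀ v → covered v ≡ true → ∃ λ z → φ (proj₁ (remQuot {k} r z)) (proj₂ (remQuot {k} r z)) ≡ v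
    covers v e with dec-true⁻ (any? (λ j → any? (λ i → φ j i ≟ v))) e
    ... | j , i , q = combine j i , trans (cong (λ { (j , i) → φ j i }) (remQuot-combine j i)) q

  free : ℕ
  free = count (not ∘ covered)

  free-count : p * r ≤ free
  free-count = +-cancelˡ-≤ (k * r) _ _ (≤-trans (≤-reflexive (sym (*-distribʳ-+ r k p))) (≤-trans room
    (≤-trans (≤-reflexive (sym (count-not covered))) (+-monoˡ-≤ free covered-count))))

  phantom : Fin p → Fin r → Fin n
  phantom j i = proj₁ (enumerate (not ∘ covered)) (inject≤ (combine j i) free-count)

  phantom-uncovered : ∀ j i → covered (phantom j i) ≡ false
  phantom-uncovered j i = not-true⁻ (proj₁ (proj₂ (enumerate (not ∘ covered))) _)

  phantom-injective : ∀ j i j′ i′ → phantom j i ≡ phantom j′ i′ → j ≡ j′ × i ≡ i′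
  phantom-injective j i j′ i′ e = cong proj₁ pairs , cong proj₂ pairs
    where
    combined : combine j i ≡ combine j′ i′
    combined = inject≤-injective free-count free-count _ _ (proj₂ (proj₂ (enumerate (not ∘ covered))) _ _ e)
    pairs : (j , i) ≡ (j′ , i′)
    pairs = trans (sym (remQuot-combine j i)) (trans (cong (remQuot r) combined) (remQuot-combine j′ i′))

  place : Fin k ⊎ Fin p → Fin r → Fin n
  place (inj₁ j) = φ j
  place (inj₂ j) = phantom j

  disjoint : ∀ j i j′ i′ → φ j i ≢ phantom j′ i′
  disjoint j i j′ i′ e = dec-false⁻ (any? (λ j → any? (λ i → φ j i ≟ phantom j′ i′))) (phantom-uncovered j′ i′) (j , i , e)

  place-injective : ∀ s i s′ i′ → place s i ≡ place s′ i′ → s ≡ s′ × i ≡ i′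
  place-injective (inj₁ j) i (inj₁ j′) i′ e with φ-injective j j′ i i′ e
  ... | refl , q = refl , q
  place-injective (inj₁ j) i (inj₂ j′) i′ e = ⊥-elim (disjoint j i j′ i′ e)
  place-injective (inj₂ j) i (inj₁ j′) i′ e = ⊥-elim (disjoint j′ i′ j i (sym e))
  place-injective (inj₂ j) i (inj₂ j′) i′ e with phantom-injective j i j′ i′ e
  ... | refl , q = refl , q

  ν : Fin (k + p) → Fin r → Fin n
  ν α = place (splitAt k α)

  ν-injective : ∀ j i j′ i′ → ν j i ≡ ν j′ i′ → j ≡ j′ × i ≡ i′
  ν-injective j i j′ i′ e = trans (sym (join-splitAt k p j)) (trans (cong (join k p) (proj₁ q)) (join-splitAt k p j′)) , proj₂ q
    where
    q : splitAt k j ≡ splitAt k j′ × i ≡ i′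
    q = place-injective (splitAt k j) i (splitAt k j′) i′ e

  ν-left : ∀ j i → ν (j ↑ˡ p) i ≡ φ j i
  ν-left j i = cong (λ s → place s i) (splitAt-↑ˡ k j p)

hits-total : ∀ {n x r} (ν : Fin x → Fin r → Fin n) → (∀ j i j′ i′ → ν j i ≡ ν j′ i′ → j ≡ j′ × i ≡ i′) → ∀ Q →
  sumF (hits ν Q) ≤ count Q
hits-total {n} {x} {r} ν inj Q = ≤-trans (≤-reflexive (sym flat)) (sumF-image f Q f-injective)
  where
  f : Fin (x * r) → Fin n
  f z = ν (proj₁ (remQuot {x} r z)) (proj₂ (remQuot {x} r z))
  flat : sumF (λ z → bit (Q (f z))) ≡ sumF (hits ν Q)
  flat = trans (sumF-combine x {r} (λ z → bit (Q (f z)))) (sumF-cong {x} λ j → sumF-cong {r} λ i →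
    cong (λ { (j , i) → bit (Q (ν j i)) }) (remQuot-combine j i))
  f-injective : ∀ i j → f i ≡ f j → i ≡ j
  f-injective i j e = class-role-injective {x} {r} i j (proj₁ (inj _ _ _ _ e)) (proj₂ (inj _ _ _ _ e))

-- Large sparse sets

addVertex : ∀ {n} → (Fin n → Bool) → Fin n → Fin n → Bool
addVertex S v u = S u ∨ (u == v)

addVertex-edges : ∀ {n} (E : Digraph n) S v → edgesIn E (addVertex S v) ≤ edgesIn E S + 2 * n
addVertex-edges {n} E S v = begin
  sumF (λ u → count (λ w → addVertex S v u ∧ (addVertex S v w ∧ E u w)))
    ≤⟨ sumF-mono row ⟩
  sumF (λ u → count (λ w → S u ∧ (S w ∧ E u w)) + (n * bit (u == v) + 1))
    ≡⟨ trans (sumF-+ {n} (λ u → count (λ w → S u ∧ (S w ∧ E u w))) _) (cong (edgesIn E S +_) (trans (sumF-+ {n} (λ u → n * bit (u == v)) (λ _ → 1))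
        (cong₂ _+_ (trans (sumF-* {n} n (λ u → bit (u == v))) (trans (cong (n *_) (sumF-δ1 v)) (*-identityʳ n))) (trans (sumF-const n 1) (*-identityʳ n))))) ⟩
  edgesIn E S + (n + n)
    ≡⟨ cong (λ z → edgesIn E S + (n + z)) (sym (+-identityʳ n)) ⟩
  edgesIn E S + 2 * n ∎
  where
  open ≤-Reasoning
  cell : ∀ a b c d e → bit ((a ∨ b) ∧ ((c ∨ d) ∧ e)) ≤ bit (a ∧ (c ∧ e)) + (bit b + bit d)
  cell false false c d e = z≤n
  cell true b false false e = z≤n
  cell true b true d e = m≤m+n _ _
  cell true b false true e = ≤-trans (bit≤1 e) (m≤n+m 1 (bit b))
  cell false true false false e = z≤n
  cell false true true d e = ≤-trans (bit≤1 e) (s≤s z≤n)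
  cell false true false true e = ≤-trans (bit≤1 e) (s≤s z≤n)
  row : ∀ u → count (λ w → addVertex S v u ∧ (addVertex S v w ∧ E u w)) ≤ count (λ w → S u ∧ (S w ∧ E u w)) + (n * bit (u == v) + 1)
  row u = begin
    count (λ w → addVertex S v u ∧ (addVertex S v w ∧ E u w))
      ≡⟨ count≡sumF (λ w → addVertex S v u ∧ (addVertex S v w ∧ E u w)) ⟩
    sumF (λ w → bit (addVertex S v u ∧ (addVertex S v w ∧ E u w)))
      ≤⟨ sumF-mono (λ w → cell (S u) (u == v) (S w) (w == v) (E u w)) ⟩
    sumF (λ w → bit (S u ∧ (S w ∧ E u w)) + (bit (u == v) + bit (w == v)))
      ≡⟨ trans (sumF-+ {n} (λ w → bit (S u ∧ (S w ∧ E u w))) _) (cong₂ _+_ (sym (count≡sumF (λ w → S u ∧ (S w ∧ E u w))))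
           (trans (sumF-+ {n} (λ _ → bit (u == v)) (λ w → bit (w == v))) (cong₂ _+_ (sumF-const n (bit (u == v))) (sumF-δ1 v)))) ⟩
    count (λ w → S u ∧ (S w ∧ E u w)) + (n * bit (u == v) + 1) ∎

addVertex-count : ∀ {n} (S : Fin n → Bool) v → S v ≡ false → count (addVertex S v) ≡ suc (count S)
addVertex-count {n} S v e = begin
  count (addVertex S v) ≡⟨ count≡sumF (addVertex S v) ⟩
  sumF (λ u → bit (addVertex S v u)) ≡⟨ sumF-cong {n} pointwise ⟩
  sumF (λ u → bit (u == v) + bit (S u)) ≡⟨ trans (sumF-+ {n} (λ u → bit (u == v)) (λ u → bit (S u))) (cong₂ _+_ (sumF-δ1 v) (sym (count≡sumF S))) ⟩
  suc (count S) ∎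
  where
  open ≡-Reasoning
  pointwise : ∀ u → bit (addVertex S v u) ≡ bit (u == v) + bit (S u)
  pointwise u with u ≟ v
  ... | yes refl rewrite e = refl
  ... | no _ with S u
  ...   | true = refl
  ...   | false = refl

-- Vertices are added only until the size reaches `n / r`. Hence `minimal`: unless nothing was
-- added, the last vertex was still needed and the overshoot is less than one vertex.
record Enlarged {n : ℕ} (E : Digraph n) (r : ℕ) (S : Fin n → Bool) : Set where
  field
    set : Fin n → Bool
    added : ℕ
    set-count : count set ≡ count S + added
    set-edges : edgesIn E set ≤ edgesIn E S + added * (2 * n)
    enough : n ≤ r * count set
    minimal : added ≡ 0 ⊎ r * count set ≤ n + r

enlarge : ∀ {n r} → 0 < r → (E : Digraph n) → ∀ fuel S → n ≤ count S + fuel → Enlarged E r S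
enlarge {n} {r} r-pos E fuel S le with n ≤? r * count S
... | yes p = record { set = S ; added = 0 ; set-count = sym (+-identityʳ _) ; set-edges = ≤-reflexive (sym (+-identityʳ _)) ; enough = p ; minimal = inj₁ refl }
enlarge {n} {r} r-pos E zero S le | no p =
  ⊥-elim (p (≤-trans le (≤-trans (≤-reflexive (trans (+-identityʳ _) (sym (*-identityˡ _)))) (*-monoˡ-≤ (count S) r-pos))))
enlarge {n} {r} r-pos E (suc fuel) S le | no p = step (count-pos (not ∘ S) (+-cancelˡ-< (count S) _ _ (subst₂ _<_ (sym (+-identityʳ _)) (sym (count-not S)) small)))
  where
  small : count S < n
  small = ≤-<-trans (≤-trans (≤-reflexive (sym (*-identityˡ _))) (*-monoˡ-≤ (count S) r-pos)) (≰⇒> p)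
  step : (∃ λ v → not (S v) ≡ true) → Enlarged E r S
  step (v , nv) = record
    { set = set
    ; added = suc added
    ; set-count = trans set-count (trans (cong (_+ added) counts) (sym (+-suc (count S) added)))
    ; set-edges = ≤-trans set-edges (≤-trans (+-monoˡ-≤ (added * (2 * n)) (addVertex-edges E S v)) (≤-reflexive (+-assoc (edgesIn E S) _ _)))
    ; enough = enough
    ; minimal = inj₂ (tight minimal) }
    where
    counts : count (addVertex S v) ≡ suc (count S)
    counts = addVertex-count S v (not-true⁻ nv)
    open Enlarged (enlarge r-pos E fuel (addVertex S v) (≤-trans le (≤-reflexive (trans (+-suc (count S) fuel) (cong (_+ fuel) (sym counts))))))
    tight : added ≡ 0 ⊎ r * count set ≤ n + r → r * count set ≤ n + r
    tight (inj₂ q) = q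
    tight (inj₁ z) = begin
      r * count set ≡⟨ cong (r *_) (trans set-count (trans (cong₂ _+_ counts z) (+-identityʳ _))) ⟩
      r * suc (count S) ≡⟨ trans (*-suc r (count S)) (+-comm r _) ⟩
      r * count S + r ≤⟨ +-monoˡ-≤ r (<⇒≤ (≰⇒> p)) ⟩
      n + r ∎
      where open ≤-Reasoning

Sparse : ∀ {n} → Digraph n → ℕ → ℕ → Set
Sparse {n} E g r = Σ (Fin n → Bool) λ S → g * edgesIn E S ≤ n * n × n ≤ r * count S

module Twins {n : ℕ} (G : Digraph n) (r g C Q : ℕ) (r-pos : 0 < r)
  (dense : g * (6 * C + 13) ≤ C + suc (suc Q)) (n-large : 4 * g ≤ n)
  (misses : ∀ v → 2 * (r * (C + suc (suc Q))) * count (λ w → not (G v w)) ≤ suc (2 * (C + suc (suc Q))) * n) where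
  L : ℕ
  L = C + suc (suc Q)

  common : Fin n → Fin n → ℕ
  common u v = count (λ w → not (G u w) ∧ not (G v w))

  -- As `Q / L` is slightly below 1, close vertices share out-misses that fill almost `n / r`.
  close : Fin n → Fin n → Bool
  close u v = ⌊ Q * n <? r * L * common u v ⌋

  twins : Fin n → Fin n → Bool
  twins v u = not (G v u) ∧ close u v

  -- An outneighbour of `u` among the twins of `v` is an out-miss of `v` not shared by `u`, and
  -- closeness leaves few of those.
  degree-in-twins : ∀ v u → twins v u ≡ true → 2 * (r * L) * count (λ w → twins v w ∧ G u w) ≤ (2 * C + 5) * n
  degree-in-twins v u e = +-cancelʳ-≤ (2 * (Q * n)) _ _ (begin
    2 * (r * L) * deg + 2 * (Q * n)
      ≤⟨ +-monoʳ-≤ (2 * (r * L) * deg) (*-monoʳ-≤ 2 (<⇒≤ (dec-true⁻ (Q * n <? r * L * common u v) (proj₂ (∧-true⁻ (not (G v u)) e))))) ⟩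
    2 * (r * L) * deg + 2 * (r * L * common u v)
      ≡⟨ alg1 (r * L) deg (common u v) ⟩
    2 * (r * L) * (deg + common u v)
      ≤⟨ *-monoʳ-≤ (2 * (r * L)) (count-disjoint {P = λ w → twins v w ∧ G u w} {Q = λ w → not (G u w) ∧ not (G v w)} {R = λ w → not (G v w)}
           (λ w p q → true≢false (proj₂ (∧-true⁻ (twins v w) p)) (not-true⁻ (proj₁ (∧-true⁻ (not (G u w)) q))))
           (λ w p → proj₁ (∧-true⁻ (not (G v w)) (proj₁ (∧-true⁻ (twins v w) p))))
           (λ w q → proj₂ (∧-true⁻ (not (G u w)) q))) ⟩
    2 * (r * L) * count (λ w → not (G v w))
      ≤⟨ misses v ⟩
    suc (2 * (C + suc (suc Q))) * n
      ≡⟨ alg2 C Q n ⟩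
    (2 * C + 5) * n + 2 * (Q * n) ∎)
    where
    open ≤-Reasoning
    deg : ℕ
    deg = count (λ w → twins v w ∧ G u w)
    alg1 : ∀ l d c → 2 * l * d + 2 * (l * c) ≡ 2 * l * (d + c)
    alg1 = solve-∀
    alg2 : ∀ C Q n → suc (2 * (C + suc (suc Q))) * n ≡ (2 * C + 5) * n + 2 * (Q * n)
    alg2 = solve-∀

  twins-edges : ∀ v → 2 * (r * L) * edgesIn G (twins v) ≤ n * ((2 * C + 5) * n)
  twins-edges v = ≤-trans (≤-reflexive (sym (sumF-* {n} (2 * (r * L)) (λ u → count (λ w → twins v u ∧ (twins v w ∧ G u w)))))) (sumF-≤const row)
    where
    row : ∀ u → 2 * (r * L) * count (λ w → twins v u ∧ (twins v w ∧ G u w)) ≤ (2 * C + 5) * n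
    row u with bool-split (twins v u)
    ... | inj₁ e = ≤-trans (*-monoʳ-≤ (2 * (r * L)) (count-mono {P = λ w → twins v u ∧ (twins v w ∧ G u w)} {Q = λ w → twins v w ∧ G u w} λ w p → proj₂ (∧-true⁻ (twins v u) p))) (degree-in-twins v u e)
    ... | inj₂ e = ≤-trans (*-monoʳ-≤ (2 * (r * L)) (≤-trans (count-mono {P = λ w → twins v u ∧ (twins v w ∧ G u w)} {Q = λ _ → false} λ w p → ⊥-elim (true≢false (proj₁ (∧-true⁻ (twins v u) p)) e))
            (≤-reflexive (trans (count≡sumF {n} (λ _ → false)) (sumF-0 {n} λ _ → refl))))) (≤-trans (≤-reflexive (*-zeroʳ (2 * (r * L)))) z≤n)

  sparse : ∀ v → Q * n < r * L * count (twins v) → Sparse G g r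
  sparse v many = set , *-cancelˡ-≤ (2 * (r * L)) {{>-nonZero rL-pos}} bound , enough
    where
    open ≤-Reasoning
    open Enlarged (enlarge r-pos G n (twins v) (m≤n+m n _))
    rL-pos : 0 < 2 * (r * L)
    rL-pos = *-mono-≤ {1} {2} (s≤s z≤n) (*-mono-≤ r-pos (≤-trans (s≤s z≤n) (m≤n+m (suc (suc Q)) C)))
    few : r * L * added ≤ (C + 2) * n + r * L
    few = bounded minimal
      where
      bounded : added ≡ 0 ⊎ r * count set ≤ n + r → r * L * added ≤ (C + 2) * n + r * L
      bounded (inj₁ z) = ≤-trans (≤-reflexive (trans (cong (r * L *_) z) (*-zeroʳ (r * L)))) z≤n
      bounded (inj₂ q) = +-cancelˡ-≤ (Q * n) _ _ (begin
        Q * n + r * L * added ≤⟨ +-monoˡ-≤ _ (<⇒≤ many) ⟩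
        r * L * count (twins v) + r * L * added ≡⟨ trans (sym (*-distribˡ-+ (r * L) _ added)) (cong (r * L *_) (sym set-count)) ⟩
        r * L * count set ≡⟨ alg r L (count set) ⟩
        L * (r * count set) ≤⟨ *-monoʳ-≤ L q ⟩
        (C + suc (suc Q)) * (n + r) ≡⟨ alg′ C Q n r ⟩
        Q * n + ((C + 2) * n + r * (C + suc (suc Q))) ∎)
        where
        alg : ∀ r L c → r * L * c ≡ L * (r * c)
        alg = solve-∀
        alg′ : ∀ C Q n r → (C + suc (suc Q)) * (n + r) ≡ Q * n + ((C + 2) * n + r * (C + suc (suc Q)))
        alg′ = solve-∀
    bound : 2 * (r * L) * (g * edgesIn G set) ≤ 2 * (r * L) * (n * n)
    bound = begin
      2 * (r * L) * (g * edgesIn G set) ≤⟨ *-monoʳ-≤ (2 * (r * L)) (*-monoʳ-≤ g set-edges) ⟩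
      2 * (r * L) * (g * (edgesIn G (twins v) + added * (2 * n))) ≡⟨ alg1 (r * L) g (edgesIn G (twins v)) added n ⟩
      g * (2 * (r * L) * edgesIn G (twins v) + 4 * n * (r * L * added)) ≤⟨ *-monoʳ-≤ g (+-mono-≤ (twins-edges v) (*-monoʳ-≤ (4 * n) few)) ⟩
      g * (n * ((2 * C + 5) * n) + 4 * n * ((C + 2) * n + r * L)) ≡⟨ alg2 g n C (r * L) ⟩
      -- The `2 C + 5` from inside the twins and `4 (C + 2)` from the added vertices make
      -- `6 C + 13`. `dense` lets this use one half of the allowance, and `n-large` lets the
      -- rounding term use the other.
      g * (6 * C + 13) * (n * n) + 4 * g * (n * (r * L)) ≤⟨ +-mono-≤ (*-monoˡ-≤ (n * n) (≤-trans dense L≤rL)) (*-monoˡ-≤ (n * (r * L)) n-large) ⟩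
      r * L * (n * n) + n * (n * (r * L)) ≡⟨ alg3 (r * L) n ⟩
      2 * (r * L) * (n * n) ∎
      where
      L≤rL : L ≤ r * L
      L≤rL = ≤-trans (≤-reflexive (sym (*-identityˡ L))) (*-monoˡ-≤ L r-pos)
      alg1 : ∀ l g e j n → 2 * l * (g * (e + j * (2 * n))) ≡ g * (2 * l * e + 4 * n * (l * j))
      alg1 = solve-∀
      alg2 : ∀ g n C l → g * (n * ((2 * C + 5) * n) + 4 * n * ((C + 2) * n + l)) ≡ g * (6 * C + 13) * (n * n) + 4 * g * (n * l)
      alg2 = solve-∀
      alg3 : ∀ l n → l * (n * n) + n * (n * l) ≡ 2 * l * (n * n)
      alg3 = solve-∀

-- Iterated augmentation

-- The dependencies run one way: `Q` and `L` come from `g`, then `b` from the tail bounds, then `N`,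
-- then `t`, `D` and `q`, and finally the thresholds `p₀` for the phantoms and `x₀` for all classes.
record Constants (r g : ℕ) : Set where
  field
    κ Q b D t q p₀ x₀ : ℕ
    scale : Scale r κ (suc Q) b
  open Scale scale public using (C; L; M; r-pos)
  N : ℕ
  N = suc (L * b)
  field
    unlikely : ∀ k {x} (h : Fin x → ℕ) → (∀ i → h i ≤ r) → L * sumF h ≤ M k * x →
      8 * (N * N) * (r * r) * Summation.mass (tuples x (L * b)) (exceeds h (suc (M k) * b)) ≤ x ^ (L * b)
    load≤D : ∀ {T : Digraph r} {E : Digraph (N * r)} (F : Family T E t) v → Family.load F v ≤ D
    aD<t : L * b * D < t
    q≡ : 2 ^ ((N * r) * (N * r)) * 2 ≡ q
    D-pos : 0 < D
    p₀-pos : 0 < p₀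
    p₀-large : 4 * q * D ≤ p₀
    x₀-box : boxBound (L * b) (boxFactor q D) D D ≤ x₀
    x₀-L : suc (2 * L) ≤ x₀
    x₀-Q : Q ≤ x₀
    dense : g * (6 * C + 13) ≤ L

tournament-oriented : ∀ {r} {T : Digraph r} → IsTournament T → Oriented T
tournament-oriented (loop , tour) i j p q with i ≟ j
... | yes refl = true≢false p (loop i)
... | no ne with tour i j ne
...   | inj₁ (_ , f) = true≢false q f
...   | inj₂ (f , _) = true≢false p f

reduced-loopless : ∀ {n x r N} (G : Digraph n) (ν : Fin x → Fin r → Fin n) (s : Fin N → Fin x) → Loopless (reduced {N = N} G ν s)
reduced-loopless {r = r} {N} G ν s v = cong (λ t → not t ∧ G (ν (s (class {N} {r} v)) (role {N} {r} v)) (ν (s (class {N} {r} v)) (role {N} {r} v))) (==-refl (class {N} {r} v))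

module Improve {r′ g n k p : ℕ} (c : Constants (suc (suc r′)) g) {T : Digraph (suc (suc r′))} (tour : IsTournament T) (G : Digraph n)
  (φ : Fin k → Fin (suc (suc r′)) → Fin n) (packing : IsTPacking T G k φ) (n-large : 4 * g ≤ n) where
  r : ℕ
  r = suc (suc r′)
  open Constants c

  module Improving
    (outMisses : ∀ v → 2 * (r * L) * count (λ w → not (G v w)) ≤ suc (2 * L) * n)
    (inMisses : ∀ v → 2 * (r * L) * count (λ w → not (G w v)) ≤ suc (2 * L) * n)
    (room : (k + p) * r ≤ n) (tight : n ≤ r * suc (k + p)) (p-large : p₀ ≤ p) (x-large : x₀ ≤ k + p) where
    open Twins G r g C Q r-pos dense n-large outMisses using (common; close; twins)

    x : ℕ
    x = k + p

    module _ (few-twins : ∀ v → r * L * count (twins v) ≤ Q * n) where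
      module K = Classes φ (λ j j′ i i′ → proj₁ packing j j′ i i′) p room

      -- The misses allow `L + 1/2` per class. The remaining half of `x` absorbs the fewer than `r`
      -- vertices outside all classes, by `2 L + 1 ≤ x`.
      miss-average : ∀ z → 2 * (r * L) * z ≤ suc (2 * L) * n → L * z ≤ suc L * x
      miss-average z le = *-cancelˡ-≤ (2 * r) (begin
        2 * r * (L * z) ≡⟨ alg1 r L z ⟩
        2 * (r * L) * z ≤⟨ le ⟩
        suc (2 * L) * n ≤⟨ *-monoʳ-≤ (suc (2 * L)) tight ⟩
        suc (2 * L) * (r * suc x) ≡⟨ alg2 L r x ⟩
        r * (suc (2 * L) * x + suc (2 * L)) ≤⟨ *-monoʳ-≤ r (+-monoʳ-≤ (suc (2 * L) * x) (≤-trans x₀-L x-large)) ⟩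
        r * (suc (2 * L) * x + x) ≡⟨ alg3 r L x ⟩
        2 * r * (suc L * x) ∎)
        where
        open ≤-Reasoning
        alg1 : ∀ r L z → 2 * r * (L * z) ≡ 2 * (r * L) * z
        alg1 = solve-∀
        alg2 : ∀ L r x → suc (2 * L) * (r * suc x) ≡ r * (suc (2 * L) * x + suc (2 * L))
        alg2 = solve-∀
        alg3 : ∀ r L x → r * (suc (2 * L) * x + x) ≡ 2 * r * (suc L * x)
        alg3 = solve-∀

      twin-average : ∀ z → r * L * z ≤ Q * n → L * z ≤ suc Q * x
      twin-average z le = *-cancelˡ-≤ r (begin
        r * (L * z) ≡⟨ sym (*-assoc r L z) ⟩
        r * L * z ≤⟨ le ⟩
        Q * n ≤⟨ *-monoʳ-≤ Q tight ⟩
        Q * (r * suc x) ≡⟨ alg1 Q r x ⟩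
        r * (Q * x + Q) ≤⟨ *-monoʳ-≤ r (+-monoʳ-≤ (Q * x) (≤-trans x₀-Q x-large)) ⟩
        r * (Q * x + x) ≡⟨ cong (r *_) (+-comm (Q * x) x) ⟩
        r * (suc Q * x) ∎)
        where
        open ≤-Reasoning
        alg1 : ∀ Q r x → Q * (r * suc x) ≡ r * (Q * x + Q)
        alg1 = solve-∀

      -- For close `u` and `v` the set is empty by definition, otherwise the bound is the negation
      -- of closeness.
      far-bound : ∀ v u → r * L * count (kindSet G close farMiss v u) ≤ Q * n
      far-bound v u with Q * n <? r * L * common u v
      ... | yes _ = ≤-trans (*-monoʳ-≤ (r * L) (≤-reflexive (trans (count≡sumF {n} (λ _ → false)) (sumF-0 {n} λ _ → refl))))
                      (≤-trans (≤-reflexive (*-zeroʳ (r * L))) z≤n)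
      ... | no p = ≮⇒≥ p

      set-average : ∀ κ′ v u → L * count (kindSet G close κ′ v u) ≤ M κ′ * x
      set-average outMiss v u = miss-average (count (λ z → not (G v z))) (outMisses v)
      set-average inMiss v u = miss-average (count (λ z → not (G z v))) (inMisses v)
      set-average closeMiss v u = twin-average (count (twins v)) (few-twins v)
      set-average farMiss v u = twin-average (count (kindSet G close farMiss v u)) (far-bound v u)

      p-pos : 0 < p
      p-pos = ≤-trans p₀-pos p-large

      module S = Sampling scale G close K.ν (≤-trans p-pos (m≤n+m p k))
        (λ κ′ v u → ≤-trans (*-monoʳ-≤ L (hits-total K.ν K.ν-injective (kindSet G close κ′ v u))) (set-average κ′ v u))
        (λ κ′ h → unlikely κ′ h)

      module H = Homogenize {n} {r} {k} {p} {L * b} {D} {q} G K.ν S.typical S.half-typical q≡ D-pos p-pos (≤-trans p₀-large p-large) (≤-trans x₀-box x-large)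

      rebuild : (∃ λ z → H.Z z ≡ true × Blowup {k = k} {p} {L * b} G K.ν (H.RG z) D) →
        ∃ λ k′ → k < k′ × Σ (Fin k′ → Fin r → Fin n) (IsTPacking T G k′)
      rebuild (z , typ , B) = Rebuild.augmented {t = t} {D} tour G K.ν K.ν-injective isCopy₀ loop B F (load≤D F) aD<t
        where
        isCopy₀ : ∀ j → Copy T G (K.ν (j ↑ˡ p))
        isCopy₀ j i i′ e = trans (cong₂ G (K.ν-left j i) (K.ν-left j i′)) (proj₂ packing j i i′ e)
        loop : Loopless (H.RG z)
        loop = reduced-loopless G K.ν (H.sample z)
        balanced : Balanced r κ (H.RG z) _ _ _ _
        balanced = Typical⇒Balanced.balanced scale G close K.ν (k ↑ʳ proj₁ z) (proj₂ z) (S.typical⇒Typical (k ↑ʳ proj₁ z) (proj₂ z) typ)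
        F : Family T (H.RG z) t
        F = family tour loop (light-copy balanced (tournament-oriented tour)) t

      improved : ∃ λ k′ → k < k′ × Σ (Fin k′ → Fin r → Fin n) (IsTPacking T G k′)
      improved = rebuild H.homogenized

module Core {r′ g n : ℕ} (c : Constants (suc (suc r′)) g) {T : Digraph (suc (suc r′))} (tour : IsTournament T) (G : Digraph n)
  (n-large : suc (suc r′) * Constants.x₀ c + 4 * g ≤ n) where
  r : ℕ
  r = suc (suc r′)
  open Constants c

  ℓ₀ : ℕ
  ℓ₀ = r * suc p₀

  4g≤n : 4 * g ≤ n
  4g≤n = ≤-trans (m≤n+m (4 * g) (r * x₀)) n-large

  module _
    (outMisses : ∀ v → 2 * (r * L) * count (λ w → not (G v w)) ≤ suc (2 * L) * n)
    (inMisses : ∀ v → 2 * (r * L) * count (λ w → not (G w v)) ≤ suc (2 * L) * n) where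
    open Twins G r g C Q r-pos dense 4g≤n outMisses using (twins; sparse)

    -- The classes always number `n / r` rounded down. As the packing grows, phantoms are traded for
    -- copies.
    quotient : ℕ
    quotient = n / r

    quotient≤ : quotient * r ≤ n
    quotient≤ = m/n*n≤m n r

    <quotient : n < r * suc quotient
    <quotient = subst (_< r * suc quotient) (sym (m≡m%n+[m/n]*n n r)) (<-≤-trans (+-monoˡ-< (quotient * r) (m%n<n n r)) (≤-reflexive (alg r quotient)))
      where
      alg : ∀ r z → r + z * r ≡ r * suc z
      alg = solve-∀

    improve : (∀ v → r * L * count (twins v) ≤ Q * n) → ∀ k φ → IsTPacking T G k φ → k * r + ℓ₀ < n →
      ∃ λ k′ → k < k′ × Σ (Fin k′ → Fin r → Fin n) (IsTPacking T G k′)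
    improve few-twins k φ packing more = Improve.Improving.improved {p = quotient ∸ k} c tour G φ packing 4g≤n outMisses inMisses
      (subst (λ z → z * r ≤ n) (sym total≡) quotient≤)
      (subst (λ z → n ≤ r * suc z) (sym total≡) (<⇒≤ <quotient))
      (+-cancelˡ-≤ k _ _ (≤-trans (<⇒≤ k+p₀<quotient) (≤-reflexive (sym total≡))))
      (≤-trans x₀≤quotient (≤-reflexive (sym total≡)))
      few-twins
      where
      k+p₀<quotient : k + p₀ < quotient
      k+p₀<quotient = s≤s⁻¹ (*-cancelˡ-< r _ _ (<-trans (≤-<-trans (≤-reflexive (alg k r p₀)) more) <quotient))
        where
        alg : ∀ k r p → r * suc (k + p) ≡ k * r + r * suc p
        alg = solve-∀
      total≡ : k + (quotient ∸ k) ≡ quotient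
      total≡ = m+[n∸m]≡n (≤-trans (m≤m+n k p₀) (<⇒≤ k+p₀<quotient))
      x₀≤quotient : x₀ ≤ quotient
      x₀≤quotient = s≤s⁻¹ (*-cancelˡ-< r _ _ (≤-<-trans (≤-trans (m≤m+n (r * x₀) (4 * g)) n-large) <quotient))

    iterate : (∀ v → r * L * count (twins v) ≤ Q * n) → ∀ fuel k φ → IsTPacking T G k φ → n < k + fuel → HasAlmostPerfectPacking T G ℓ₀
    -- Here `n < k ≤ k * r`, so the inequality required of the packing is immediate.
    iterate few-twins zero k φ packing lt = k , φ , packing , ≤-trans (<⇒≤ lt) (≤-trans (≤-reflexive (trans (+-identityʳ k) (sym (*-identityʳ k))))
      (≤-trans (*-monoʳ-≤ k {1} {r} (s≤s z≤n)) (m≤m+n (k * r) ℓ₀)))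
    iterate few-twins (suc fuel) k φ packing lt = case n ≤? k * r + ℓ₀ of λ where
      (yes p) → k , φ , packing , p
      (no p) → case improve few-twins k φ packing (≰⇒> p) of λ where
        (k′ , k<k′ , φ′ , packing′) → iterate few-twins fuel k′ φ′ packing′
          (<-≤-trans lt (≤-trans (≤-reflexive (+-suc k fuel)) (+-monoˡ-≤ fuel k<k′)))

    core : HasAlmostPerfectPacking T G ℓ₀ ⊎ Sparse G g r
    core = case any? (λ v → Q * n <? r * L * count (twins v)) of λ where
      (yes (v , many)) → inj₂ (sparse v many)
      (no none) → inj₁ (iterate (λ v → ≮⇒≥ λ many → none (v , many)) (suc n) 0 (λ ()) ((λ ()) , λ ()) ≤-refl)

-- Choice of the constants

-- Bernoulli gives `z k^z ≤ k (k + 1)^z`. Its cube has the factor `z^3` on the left, two powers for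
-- the square and one to beat `A k^3`.
power-beats-square : ∀ k A z → A * (k * k * k) ≤ z → A * (z * z) * k ^ (3 * z) ≤ suc k ^ (3 * z)
power-beats-square zero A z le = power-zero z
  where
  power-zero : ∀ z → A * (z * z) * 0 ^ (3 * z) ≤ suc 0 ^ (3 * z)
  power-zero zero = ≤-trans (≤-reflexive (trans (*-identityʳ (A * 0)) (*-zeroʳ A))) z≤n
  power-zero (suc z) = ≤-trans (≤-reflexive (*-zeroʳ (A * (suc z * suc z)))) z≤n
power-beats-square (suc j) A z le = *-cancelˡ-≤ (k * k * k) (begin
  k * k * k * (A * (z * z) * k ^ (3 * z)) ≡⟨ alg1 k A z (k ^ (3 * z)) ⟩
  A * (k * k * k) * (z * z) * k ^ (3 * z) ≤⟨ *-monoˡ-≤ (k ^ (3 * z)) (*-monoˡ-≤ (z * z) le) ⟩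
  z * (z * z) * k ^ (3 * z) ≡⟨ cong (z * (z * z) *_) (cube k) ⟩
  z * (z * z) * (k ^ z * (k ^ z * k ^ z)) ≡⟨ alg2 z (k ^ z) ⟩
  z * k ^ z * (z * k ^ z * (z * k ^ z)) ≤⟨ *-mono-≤ base (*-mono-≤ base base) ⟩
  k * suc k ^ z * (k * suc k ^ z * (k * suc k ^ z)) ≡⟨ alg3 k (suc k ^ z) ⟩
  k * k * k * (suc k ^ z * (suc k ^ z * suc k ^ z)) ≡⟨ cong (k * k * k *_) (sym (cube (suc k))) ⟩
  k * k * k * suc k ^ (3 * z) ∎)
  where
  open ≤-Reasoning
  k : ℕ
  k = suc j
  cube : ∀ k → k ^ (3 * z) ≡ k ^ z * (k ^ z * k ^ z)
  cube k = trans (^-distribˡ-+-* k z (z + (z + 0))) (cong (k ^ z *_) (trans (^-distribˡ-+-* k z (z + 0)) (cong (λ y → k ^ z * k ^ y) (+-identityʳ z))))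
  base : z * k ^ z ≤ k * suc k ^ z
  base = lemma z
    where
    lemma : ∀ z → z * k ^ z ≤ k * suc k ^ z
    lemma zero = z≤n
    lemma (suc z) = ≤-trans (≤-reflexive (alg4 (suc z) k (k ^ z))) (*-monoʳ-≤ k (≤-trans (m≤n+m (suc z * k ^ z) (k ^ suc z)) (bernoulli k z)))
      where
      alg4 : ∀ z k p → z * (k * p) ≡ k * (z * p)
      alg4 = solve-∀
  alg1 : ∀ k A z p → k * k * k * (A * (z * z) * p) ≡ A * (k * k * k) * (z * z) * p
  alg1 = solve-∀
  alg2 : ∀ z p → z * (z * z) * (p * (p * p)) ≡ z * p * (z * p * (z * p))
  alg2 = solve-∀
  alg3 : ∀ k p → k * p * (k * p * (k * p)) ≡ k * k * k * (p * (p * p))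
  alg3 = solve-∀

module Choice (r′ g : ℕ) where
  r κ C Q L : ℕ
  r = suc (suc r′)
  κ = suc (growth r (r ∸ 1))
  C = (2 * r + 1) * κ * (3 * r)
  -- Makes the edge density of the sparse set, of order `(6 C + 13) / L`, at most `1 / g`.
  Q = g * (6 * C + 13)
  L = C + suc (suc Q)

  L-pos : 0 < L
  L-pos = ≤-trans (s≤s z≤n) (m≤n+m (suc (suc Q)) C)

  module WithTails (k₁ k₂ : ℕ) (k₁-pos : 0 < k₁) (k₂-pos : 0 < k₂)
    (tail₁ : ∀ {x} b (h : Fin x → ℕ) → (∀ i → h i ≤ r) → L * sumF h ≤ suc L * x →
      Summation.mass (tuples x (L * b)) (exceeds h (suc (suc L) * b)) * suc k₁ ^ b ≤ k₁ ^ b * x ^ (L * b))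
    (tail₂ : ∀ {x} b (h : Fin x → ℕ) → (∀ i → h i ≤ r) → L * sumF h ≤ suc Q * x →
      Summation.mass (tuples x (L * b)) (exceeds h (suc (suc Q) * b)) * suc k₂ ^ b ≤ k₂ ^ b * x ^ (L * b)) where
    -- The union bound requires a factor `8 N^2 r^2`, and `N ≤ 4 L z` bounds it by `A z^2`. The
    -- multiple `3 z` is the exponent for which `power-beats-square` defeats this.
    A z b : ℕ
    A = 128 * (L * L) * (r * r)
    z = suc (5 * r + A * (k₁ * k₁ * k₁) + A * (k₂ * k₂ * k₂))
    b = 3 * z

    scale : Scale r κ (suc Q) b
    scale = record { r-pos = s≤s z≤n ; dominates = n<1+n _ ; b-large = ≤-trans (≤-trans (m≤m+n (5 * r) (A * (k₁ * k₁ * k₁)))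
      (≤-trans (m≤m+n _ (A * (k₂ * k₂ * k₂))) (n≤1+n _))) (m≤n*m z 3) }

    module WithLength (N : ℕ) (N≡ : N ≡ suc (L * b)) where
      N-bound : 8 * (N * N) * (r * r) ≤ A * (z * z)
      N-bound = ≤-trans (*-monoˡ-≤ (r * r) (*-monoʳ-≤ 8 (*-mono-≤ N≤ N≤))) (≤-reflexive (alg L z r))
        where
        alg : ∀ L z r → 8 * (4 * (L * z) * (4 * (L * z))) * (r * r) ≡ 128 * (L * L) * (r * r) * (z * z)
        alg = solve-∀
        N≤ : N ≤ 4 * (L * z)
        N≤ = ≤-trans (≤-reflexive N≡) (≤-trans (+-monoˡ-≤ (L * b) (*-mono-≤ {1} {L} {1} {z} L-pos (s≤s z≤n))) (≤-reflexive (alg′ L z)))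
          where
          alg′ : ∀ L z → L * z + L * (3 * z) ≡ 4 * (L * z)
          alg′ = solve-∀

      absorb : ∀ k → 0 < k → A * (k * k * k) ≤ z → ∀ m X → m * suc k ^ b ≤ k ^ b * X → 8 * (N * N) * (r * r) * m ≤ X
      absorb k k-pos kz m X le = *-cancelˡ-≤ (k ^ b) {{>-nonZero (^-pos b k-pos)}} (begin
        k ^ b * (8 * (N * N) * (r * r) * m) ≤⟨ *-monoʳ-≤ (k ^ b) (*-monoˡ-≤ m N-bound) ⟩
        k ^ b * (A * (z * z) * m) ≡⟨ alg (k ^ b) (A * (z * z)) m ⟩
        m * (A * (z * z) * k ^ b) ≤⟨ *-monoʳ-≤ m (power-beats-square k A z kz) ⟩
        m * suc k ^ b ≤⟨ le ⟩
        k ^ b * X ∎)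
        where
        open ≤-Reasoning
        alg : ∀ p w m → p * (w * m) ≡ m * (w * p)
        alg = solve-∀

      k₁z : A * (k₁ * k₁ * k₁) ≤ z
      k₁z = ≤-trans (m≤n+m _ (5 * r)) (≤-trans (m≤m+n _ (A * (k₂ * k₂ * k₂))) (n≤1+n _))

      k₂z : A * (k₂ * k₂ * k₂) ≤ z
      k₂z = ≤-trans (m≤n+m _ (5 * r + A * (k₁ * k₁ * k₁))) (n≤1+n _)

      tails : ∀ k {x} (h : Fin x → ℕ) → (∀ i → h i ≤ r) → L * sumF h ≤ Scale.M scale k * x →
        8 * (N * N) * (r * r) * Summation.mass (tuples x (L * b)) (exceeds h (suc (Scale.M scale k) * b)) ≤ x ^ (L * b)
      tails outMiss {x} h h≤r avg = absorb k₁ k₁-pos k₁z _ (x ^ (L * b)) (tail₁ b h h≤r avg)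
      tails inMiss {x} h h≤r avg = absorb k₁ k₁-pos k₁z _ (x ^ (L * b)) (tail₁ b h h≤r avg)
      tails closeMiss {x} h h≤r avg = absorb k₂ k₂-pos k₂z _ (x ^ (L * b)) (tail₂ b h h≤r avg)
      tails farMiss {x} h h≤r avg = absorb k₂ k₂-pos k₂z _ (x ^ (L * b)) (tail₂ b h h≤r avg)

    module W = WithLength (suc (L * b)) refl

    constants-with : ∀ D t q x₀ →
      (∀ {T : Digraph r} {E : Digraph (suc (L * b) * r)} (F : Family T E t) v → Family.load F v ≤ D) →
      L * b * D < t → 2 ^ ((suc (L * b) * r) * (suc (L * b) * r)) * 2 ≡ q → 0 < D →
      boxBound (L * b) (boxFactor q D) D D ≤ x₀ → Constants r g
    constants-with D t q x₀ load≤D aD<t q≡ D-pos x₀-box = record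
      { κ = κ ; Q = Q ; b = b ; D = D ; t = t ; q = q ; p₀ = suc (4 * q * D) ; x₀ = x₀ + (suc (2 * L) + Q)
      ; scale = scale ; unlikely = W.tails ; load≤D = load≤D ; aD<t = aD<t ; q≡ = q≡ ; D-pos = D-pos
      ; p₀-pos = s≤s z≤n ; p₀-large = n≤1+n _
      ; x₀-box = ≤-trans x₀-box (m≤m+n x₀ _)
      ; x₀-L = ≤-trans (m≤m+n (suc (2 * L)) Q) (m≤n+m _ x₀)
      ; x₀-Q = ≤-trans (m≤n+m Q (suc (2 * L))) (m≤n+m _ x₀)
      ; dense = ≤-trans (n≤1+n Q) (≤-trans (n≤1+n (suc Q)) (m≤n+m (suc (suc Q)) C)) }

    constants : Constants r g
    constants = constants-with (cap r N) (copies r N) (2 ^ ((N * r) * (N * r)) * 2) _ load≤cap (cap-copies r (L * b) (s≤s z≤n)) refl D-pos ≤-refl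
      where
      N : ℕ
      N = suc (L * b)
      D-pos : 0 < cap r N
      D-pos = ≤-trans (*-mono-≤ {1} {r} {1} {N * N * N} (s≤s z≤n) (*-mono-≤ {1} {N * N} {1} {N} (*-mono-≤ {1} {N} {1} {N} (s≤s z≤n) (s≤s z≤n)) (s≤s z≤n))) (m≤m+n (r * (N * N * N)) (r * (N * N)))

constants : ∀ r′ g → Constants (suc (suc r′)) g
constants r′ g = from (tail-bound _ L (suc L) L-pos) (tail-bound _ L (suc Q) L-pos)
  where
  open Choice r′ g
  Tail : ℕ → ℕ → Set
  Tail M k = 0 < k × (∀ {x} b (h : Fin x → ℕ) → (∀ i → h i ≤ r) → L * sumF h ≤ M * x →
    Summation.mass (tuples x (L * b)) (exceeds h (suc M * b)) * suc k ^ b ≤ k ^ b * x ^ (L * b))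
  from : ∃ (Tail (suc L)) → ∃ (Tail (suc Q)) → Constants (suc (suc r′)) g
  from (k₁ , pos₁ , tail₁) (k₂ , pos₂ , tail₂) = WithTails.constants k₁ k₂ pos₁ pos₂ tail₁ tail₂

-- From rationals to natural numbers

toℚᵘ-toℚ : ∀ k → toℚᵘ (toℚ k) U.≃ U.mkℚᵘ (Z.+ k) 0
toℚᵘ-toℚ k = QP.toℚᵘ-fromℚᵘ (U.mkℚᵘ (Z.+ k) 0)

toℚᵘ-inv : ∀ k → toℚᵘ (inv (suc k)) U.≃ U.mkℚᵘ (Z.+ 1) k
toℚᵘ-inv k = QP.toℚᵘ-fromℚᵘ (U.mkℚᵘ (Z.+ 1) k)

toℚ-+ : ∀ a b → toℚ (a + b) ≡ toℚ a Q.+ toℚ b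
toℚ-+ a b = QP.toℚᵘ-injective (UP.≃-trans (toℚᵘ-toℚ (a + b)) (UP.≃-sym (UP.≃-trans (QP.toℚᵘ-homo-+ (toℚ a) (toℚ b))
  (UP.≃-trans (UP.+-cong (toℚᵘ-toℚ a) (toℚᵘ-toℚ b)) (U.*≡* (cong (Z._* Z.+ 1) (cong₂ Z._+_ (ZP.*-identityʳ (Z.+ a)) (ZP.*-identityʳ (Z.+ b)))))))))

toℚ-* : ∀ a b → toℚ (a * b) ≡ toℚ a Q.* toℚ b
toℚ-* a b = QP.toℚᵘ-injective (UP.≃-trans (toℚᵘ-toℚ (a * b)) (UP.≃-sym (UP.≃-trans (QP.toℚᵘ-homo-* (toℚ a) (toℚ b))
  (UP.≃-trans (UP.*-cong (toℚᵘ-toℚ a) (toℚᵘ-toℚ b)) (U.*≡* (cong (Z._* Z.+ 1) (sym (ZP.pos-* a b))))))))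

inv-toℚ : ∀ k → inv (suc k) Q.* toℚ (suc k) ≡ 1ℚ
inv-toℚ k = QP.toℚᵘ-injective (UP.≃-trans (QP.toℚᵘ-homo-* (inv (suc k)) (toℚ (suc k)))
  (UP.≃-trans (UP.*-cong (toℚᵘ-inv k) (toℚᵘ-toℚ (suc k)))
  (U.*≡* (trans (ZP.*-identityʳ _) (trans (ZP.*-identityˡ (Z.+ suc k)) (cong Z.+_ (sym (trans (+-identityʳ _) (*-identityʳ (suc k))))))))))

toℚ-mono : ∀ {a b} → a ≤ b → toℚ a Q.≤ toℚ b
toℚ-mono {a} {b} le = QP.toℚᵘ-cancel-≤ (UP.≤-respˡ-≃ (UP.≃-sym (toℚᵘ-toℚ a)) (UP.≤-respʳ-≃ (UP.≃-sym (toℚᵘ-toℚ b))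
  (U.*≤* (subst₂ Z._≤_ (sym (ZP.*-identityʳ (Z.+ a))) (sym (ZP.*-identityʳ (Z.+ b))) (Z.+≤+ le)))))

toℚ-cancel : ∀ {a b} → toℚ a Q.≤ toℚ b → a ≤ b
toℚ-cancel {a} {b} le with UP.≤-respˡ-≃ (toℚᵘ-toℚ a) (UP.≤-respʳ-≃ (toℚᵘ-toℚ b) (QP.toℚᵘ-mono-≤ le))
... | U.*≤* p = ZP.drop‿+≤+ (subst₂ Z._≤_ (ZP.*-identityʳ (Z.+ a)) (ZP.*-identityʳ (Z.+ b)) p)

toℚ-nonNegative : ∀ k → NonNegative (toℚ k)
toℚ-nonNegative k = nonNegative (toℚ-mono {0} {k} z≤n)

inv-positive : ∀ k → 0ℚ Q.< inv (suc k)
inv-positive k = QP.positive⁻¹ (inv (suc k)) {{QP.normalize-pos 1 (suc k)}}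

-- A positive fraction has numerator at least 1, so its own denominator serves.
inv-below : ∀ γ → 0ℚ Q.< γ → ∃ λ g → inv (suc g) Q.≤ γ
inv-below (mkℚ (Z.+ zero) d co) (Q.*<* (Z.+<+ ()))
inv-below (mkℚ Z.-[1+ a ] d co) (Q.*<* ())
inv-below (mkℚ (Z.+ suc a) d co) _ = d , QP.toℚᵘ-cancel-≤ (UP.≤-respˡ-≃ (UP.≃-sym (toℚᵘ-inv d))
  (U.*≤* (ZP.*-monoʳ-≤-nonNeg (Z.+ suc d) {Z.+ 1} {Z.+ suc a} (Z.+≤+ (s≤s z≤n)))))

scaled-below : ∀ g {γ e m} → inv (suc g) Q.≤ γ → suc g * e ≤ m → toℚ e Q.≤ γ Q.* toℚ m
scaled-below g {γ} {e} {m} inv≤γ le = begin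
  toℚ e
    ≡⟨ sym (QP.*-identityˡ (toℚ e)) ⟩
  1ℚ Q.* toℚ e
    ≡⟨ cong (Q._* toℚ e) (sym (inv-toℚ g)) ⟩
  inv (suc g) Q.* toℚ (suc g) Q.* toℚ e
    ≡⟨ trans (QP.*-assoc (inv (suc g)) (toℚ (suc g)) (toℚ e)) (cong (inv (suc g) Q.*_) (sym (toℚ-* (suc g) e))) ⟩
  inv (suc g) Q.* toℚ (suc g * e)
    ≤⟨ QP.*-monoˡ-≤-nonNeg (inv (suc g)) {{QP.pos⇒nonNeg (inv (suc g)) {{QP.normalize-pos 1 (suc g)}}}} (toℚ-mono le) ⟩
  inv (suc g) Q.* toℚ m
    ≤⟨ QP.*-monoʳ-≤-nonNeg (toℚ m) {{toℚ-nonNegative m}} inv≤γ ⟩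
  γ Q.* toℚ m ∎
  where open QP.≤-Reasoning

-- Multiplication by the denominators of `inv (suc r)` and `inv (suc E)` turns the degree condition
-- into one on natural numbers.
degree-bound : ∀ r E n d {ε} → ε Q.≤ inv (suc E) → (1ℚ Q.- inv (suc r) Q.- ε) Q.* toℚ n Q.≤ toℚ d →
  suc r * suc E * n ≤ suc r * suc E * d + (suc E + suc r) * n
degree-bound r E n d {ε} ε≤ deg = toℚ-cancel (begin
  toℚ (suc r * suc E * n)
    ≡⟨ trans (toℚ-* (suc r * suc E) n) (cong (Q._* toℚ n) (toℚ-* (suc r) (suc E))) ⟩
  R Q.* F Q.* toℚ n
    ≡⟨ split R F (toℚ n) i ε ⟩
  R Q.* F Q.* ((1ℚ Q.- i Q.- ε) Q.* toℚ n Q.+ (i Q.* toℚ n Q.+ ε Q.* toℚ n))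
    ≤⟨ QP.*-monoˡ-≤-nonNeg (R Q.* F) {{subst NonNegative (toℚ-* (suc r) (suc E)) (toℚ-nonNegative (suc r * suc E))}}
         (QP.+-mono-≤ deg (QP.+-monoʳ-≤ (i Q.* toℚ n) (QP.*-monoʳ-≤-nonNeg (toℚ n) {{toℚ-nonNegative n}} ε≤))) ⟩
  R Q.* F Q.* (toℚ d Q.+ (i Q.* toℚ n Q.+ j Q.* toℚ n))
    ≡⟨ collect R F (toℚ n) (toℚ d) i j ⟩
  R Q.* F Q.* toℚ d Q.+ (i Q.* R Q.* F Q.+ j Q.* F Q.* R) Q.* toℚ n
    ≡⟨ cong (λ z → R Q.* F Q.* toℚ d Q.+ z Q.* toℚ n) (cong₂ Q._+_ (trans (cong (Q._* F) (inv-toℚ r)) (QP.*-identityˡ F)) (trans (cong (Q._* R) (inv-toℚ E)) (QP.*-identityˡ R))) ⟩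
  R Q.* F Q.* toℚ d Q.+ (F Q.+ R) Q.* toℚ n
    ≡⟨ sym (trans (toℚ-+ (suc r * suc E * d) _) (cong₂ Q._+_ (trans (toℚ-* (suc r * suc E) d) (cong (Q._* toℚ d) (toℚ-* (suc r) (suc E))))
         (trans (toℚ-* (suc E + suc r) n) (cong (Q._* toℚ n) (toℚ-+ (suc E) (suc r)))))) ⟩
  toℚ (suc r * suc E * d + (suc E + suc r) * n) ∎)
  where
  open QP.≤-Reasoning
  open +-*-Solver using (solve; _:+_; _:*_; :-_; con; _:=_)
  R F i j : ℚ
  R = toℚ (suc r)
  F = toℚ (suc E)
  i = inv (suc r)
  j = inv (suc E)
  split : ∀ R F n i ε → R Q.* F Q.* n ≡ R Q.* F Q.* ((1ℚ Q.- i Q.- ε) Q.* n Q.+ (i Q.* n Q.+ ε Q.* n))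
  split = solve 5 (λ R F n i ε → R :* F :* n := R :* F :* ((con 1ℚ :+ (:- i) :+ (:- ε)) :* n :+ (i :* n :+ ε :* n))) refl
  collect : ∀ R F n d i j → R Q.* F Q.* (d Q.+ (i Q.* n Q.+ j Q.* n)) ≡ R Q.* F Q.* d Q.+ (i Q.* R Q.* F Q.+ j Q.* F Q.* R) Q.* n
  collect = solve 6 (λ R F n d i j → R :* F :* (d :+ (i :* n :+ j :* n)) := R :* F :* d :+ (i :* R :* F :+ j :* F :* R) :* n) refl

miss-bound : ∀ r E n (P : Fin n → Bool) → suc r * suc E * n ≤ suc r * suc E * count P + (suc E + suc r) * n →
  suc r * suc E * count (not ∘ P) ≤ (suc E + suc r) * n
miss-bound r E n P le = +-cancelˡ-≤ (suc r * suc E * count P) _ _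
  (≤-trans (≤-reflexive (trans (sym (*-distribˡ-+ (suc r * suc E) (count P) _)) (cong (suc r * suc E *_) (count-not P)))) le)

theorem5p3 : (r : ℕ) → 3 ≤ r →
    Σ ℚ λ γ₀ → 0ℚ Q.< γ₀ × ((γ : ℚ) → 0ℚ Q.< γ → γ Q.≤ γ₀ →
    Σ ℚ λ ε₀ → 0ℚ Q.< ε₀ × ((ε : ℚ) → 0ℚ Q.< ε → ε Q.≤ ε₀ →
    Σ ℕ λ ℓ₀ → (ℓ : ℕ) → ℓ₀ ≤ ℓ →
    Σ ℕ λ n₀ → (n : ℕ) → n₀ ≤ n →
    (T : Digraph r) → IsTournament T →
    (G : Digraph n) → Loopless G →
    MinSemideg≥ G ((1ℚ Q.- inv r Q.- ε) Q.* toℚ n) →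
    HasAlmostPerfectPacking T G ℓ ⊎ HasIndepSet G γ r))
theorem5p3 (suc zero) (s≤s ())
theorem5p3 (suc (suc r′)) _ = 1ℚ , inv-positive 0 , λ γ γ-pos _ → atScale γ (inv-below γ γ-pos)
  where
  r : ℕ
  r = suc (suc r′)
  atScale : ∀ γ → (∃ λ g → inv (suc g) Q.≤ γ) → Σ ℚ λ ε₀ → 0ℚ Q.< ε₀ × ((ε : ℚ) → 0ℚ Q.< ε → ε Q.≤ ε₀ →
    Σ ℕ λ ℓ₀ → (ℓ : ℕ) → ℓ₀ ≤ ℓ → Σ ℕ λ n₀ → (n : ℕ) → n₀ ≤ n →
    (T : Digraph r) → IsTournament T → (G : Digraph n) → Loopless G →
    MinSemideg≥ G ((1ℚ Q.- inv r Q.- ε) Q.* toℚ n) →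
    HasAlmostPerfectPacking T G ℓ ⊎ HasIndepSet G γ r)
  atScale γ (g , inv≤γ) = from (constants r′ (suc g))
    where
    from : Constants r (suc g) → _
    from c = inv (suc E) , inv-positive E , λ ε _ ε≤ → r * suc p₀ , λ ℓ ℓ₀≤ℓ → r * x₀ + 4 * suc g , λ n large T tour G loop deg →
        conclude ℓ₀≤ℓ (Core.core c {T} tour G large
          (λ v → miss n (G v) (degree-bound (suc r′) E n (outdeg G v) ε≤ (proj₁ (deg v))))
          (λ v → miss n (λ w → G w v) (degree-bound (suc r′) E n (indeg G v) ε≤ (proj₂ (deg v)))))
      where
      open Constants c
      -- `ε₀ = 1 / (2 r L)` makes the misses at most `n/r + n/(2 r L) = (2 L + 1) n / (2 r L)`, the
      -- form demanded by `Core`.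
      E : ℕ
      E = 2 * (r * L) ∸ 1
      rL-pos : 0 < r * L
      rL-pos = *-mono-≤ {1} {r} {1} {L} (s≤s z≤n) (≤-trans (s≤s z≤n) (m≤n+m (suc (suc Q)) C))
      sucE : suc E ≡ 2 * (r * L)
      sucE = m+[n∸m]≡n (*-mono-≤ {1} {2} {1} {r * L} (s≤s z≤n) rL-pos)
      miss : ∀ n (P : Fin n → Bool) → r * suc E * n ≤ r * suc E * count P + (suc E + r) * n →
        2 * (r * L) * count (not ∘ P) ≤ suc (2 * L) * n
      miss n P le = *-cancelˡ-≤ r (≤-trans (≤-reflexive (trans (sym (*-assoc r (2 * (r * L)) _)) (cong (λ z → r * z * count (not ∘ P)) (sym sucE))))
        (≤-trans (miss-bound (suc r′) E n P le) (≤-reflexive (trans (cong (λ z → (z + r) * n) sucE) (alg r L n)))))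
        where
        alg : ∀ r L n → (2 * (r * L) + r) * n ≡ r * (suc (2 * L) * n)
        alg = solve-∀
      conclude : ∀ {n ℓ} {T : Digraph r} {G : Digraph n} → r * suc p₀ ≤ ℓ → HasAlmostPerfectPacking T G (r * suc p₀) ⊎ Sparse G (suc g) r →
        HasAlmostPerfectPacking T G ℓ ⊎ HasIndepSet G γ r
      conclude ℓ₀≤ℓ (inj₁ (k , φ , packing , cover)) = inj₁ (k , φ , packing , ≤-trans cover (+-monoʳ-≤ (k * r) ℓ₀≤ℓ))
      conclude ℓ₀≤ℓ (inj₂ (S , sparse , big)) = inj₂ (S , scaled-below g inv≤γ sparse , big)
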